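{- Let $p$ be a prime and let $G$ be a finite non-abelian $p$-group. Then $$\mathsf D(G)\leq \frac{p^2+2p-2}{p^3}|G|.$$
   Context: A sequence over a finite group $G$ is a finite unordered list of elements of $G$ with repetition allowed; its length is its number of terms with multiplicity. It is product-one if its terms can be ordered so that their product is the identity. A minimal product-one sequence is a nonempty product-one sequence that cannot be partitioned into two nonempty product-one subsequences. $\mathsf D(G)$ (the large Davenport constant) is the maximal length of a minimal product-one sequence over $G$. -}

module Defs where

open import Data.Nat using (ℕ)
open import Data.Fin using (Fin)
open import Data.List using (List; []; _++_; foldr)
open import Data.Product using (_×_; ∃-syntax)
open import Relation.Nullary using (¬_)
open import Relation.Binary.PropositionalEquality using (_≡_; _≢_)
open import Data.List.Relation.Binary.Permutation.Propositional using (_↭_)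
open import Algebra.Core using (Op₂)

-- A finite group of order n is represented (up to isomorphism) by a group
-- structure on Fin n with propositional equality.  A sequence over G is a
-- list of elements, considered up to permutation (_↭_).

module _ {n : ℕ} (_∙_ : Op₂ (Fin n)) (ε : Fin n) where

  prod : List (Fin n) → Fin n
  prod = foldr _∙_ ε

  ProductOne : List (Fin n) → Set
  ProductOne xs = ∃[ ys ] (ys ↭ xs × prod ys ≡ ε)

  MinimalProductOne : List (Fin n) → Set
  MinimalProductOne xs =
    xs ≢ [] × ProductOne xs ×
    (∀ (S T : List (Fin n)) → (S ++ T) ↭ xs → S ≢ [] → T ≢ [] →
       ¬ (ProductOne S × ProductOne T))

{-# OPTIONS --safe #-}
module Submission where

-- For a subgroup H, a product-one sequence visits each coset of H with its partial products;
-- cutting it at the visits to one coset gives a product-one sequence over H, and a splitting of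
-- the latter splits the former.  Hence D(G) ≤ [G : H] D(H) for every subgroup H.  The class
-- equation on G / Z(G) yields a and g whose commutator c has order p and commutes with both,
-- and one takes H = ⟨a , g⟩ Z₀ with Z₀ = Z(C(a) ∩ C(g)) the centre of H.  Then H / Z₀ ≅ 𝔽_p²,
-- commutators in H are c^det, and with |Z₀| = p m, |H| = p³ m the claim is
-- D(H) ≤ (p² + 2p − 2) m.
--
-- Call a sequence T full if its orderings realise the whole coset of ⟨c⟩ containing its products.
-- A sequence of more than p noncentral elements, not all parallel in 𝔽_p², has a full
-- subsequence T of length p: add elements one by one, each not parallel to the sum of the previous
-- ones, so that putting it left or right changes the product; p − 1 nonzero residues have all of
-- 𝔽_p as subset sums.  After setting T aside, it suffices to find a product-one subsequence R in
-- the rest, since the complement of R has its product in ⟨c⟩ and contains T.  For this one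
-- removes blocks with sum zero in 𝔽_p²; any 2p − 1 elements contain one, of length at most p
-- or else full.  As soon as there are m full blocks or p m blocks altogether, the pigeonhole
-- principle in Z₀ / ⟨c⟩ or in Z₀ gives R.

open import Defs
open import Data.Nat as ℕ using (ℕ; zero; suc; _+_; _*_; _∸_; _^_; _≤_; _<_; z≤n; s≤s; nonTrivial⇒n>1)
import Data.Nat.Properties as ℕP
open import Data.Nat.Divisibility as ℕD using (_∣_; _∣?_; divides)
open import Data.Nat.DivMod using (_%_; _/_; m%n<n; m≡m%n+[m/n]*n)
open import Data.Nat.Primality using (Prime; euclidsLemma; prime⇒irreducible; prime⇒nonTrivial; ¬prime[0])
open import Data.Nat.Coprimality as Coprime using (Coprime; coprime-Bézout; coprime-divisor)
import Data.Nat.GCD as GCD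
open import Data.Nat.ListAction using (sum; product)
import Data.Nat.Tactic.RingSolver as ℕS
open import Data.Integer as ℤ using (ℤ; +_; 0ℤ; 1ℤ; _-_)
import Data.Integer.Properties as ℤP
import Data.Integer.Divisibility.Signed as ℤD
import Data.Integer.Tactic.RingSolver as ℤS
open import Data.Fin as Fin using (Fin; toℕ)
import Data.Fin.Properties as FinP
open import Data.List as List using (List; []; _∷_; _++_; length; map; take; drop; concat; [_])
import Data.List.Properties as ListP
open import Data.List.Relation.Unary.All as All using (All; []; _∷_)
import Data.List.Relation.Unary.All.Properties as AllP
open import Data.List.Relation.Unary.Any as Any using (Any; here; there)
import Data.List.Relation.Unary.Any.Properties as AnyP
open import Data.List.Relation.Unary.AllPairs using (AllPairs; []; _∷_)
import Data.List.Relation.Unary.Unique.Propositional.Properties as UniqueP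
open import Data.List.Membership.Propositional using (_∈_)
open import Data.List.Membership.Propositional.Properties using (∈-allFin; ∈-lookup; ∈-filter⁺; ∈-filter⁻)
open import Data.List.Relation.Binary.Permutation.Propositional as Perm using (_↭_; ↭-refl; ↭-sym; ↭-trans; ↭-reflexive; prep; swap; module PermutationReasoning)
open import Data.List.Relation.Binary.Permutation.Propositional.Properties as PermP using (shift; ++-comm; ++⁺ˡ; ++⁺ʳ; shifts; ↭-length; All-resp-↭)
open import Data.Product using (_×_; _,_; proj₁; proj₂; ∃-syntax)
open import Data.Sum using (_⊎_; inj₁; inj₂; fromInj₁; fromInj₂)
open import Data.Unit using (⊤; tt)
open import Data.Empty using (⊥-elim)
open import Function using (_∘_)
open import Algebra.Core using (Op₁; Op₂)
open import Algebra.Structures using (IsGroup)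
open import Relation.Nullary using (¬_; yes; no; Dec; _×-dec_; _→-dec_; ¬?)
import Relation.Nullary.Decidable as Dec
open import Relation.Binary.Definitions using (tri<; tri≈; tri>)
open import Relation.Binary.PropositionalEquality using (_≡_; _≢_; refl; sym; trans; cong; cong₂; subst; subst₂; module ≡-Reasoning)

-- The constant is dictated by m = 1: T takes p elements, p - 1 short blocks take at most p (p - 1),
-- and 2p - 1 elements must remain to yield one more block, p² + 2p - 1 in all, one more than the
-- bound. For general m, at most m - 1 full blocks precede the last block, each costing at most p -
-- 1 more than a short one; the summand 2 (p - 1) m of the bound covers them. A suitable T need not
-- exist. If all noncentral elements are parallel, all elements commute and the complement of R has
-- product one in any order. If at most p elements are noncentral, at least p m are central and R is
-- found among those. The two facts on residues rest on the polynomial C(x + p - 1, p - 1) of degree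
-- p - 1, which p divides unless p divides x. An alternating sum of its values over all subset sums
-- is an iterated difference and hence known from the degree: the product of the steps after exactly
-- p - 1 differences, and 0 once there are more differences than the degree. Exponents of c are
-- natural numbers throughout, with p - 1 in the place of -1.

-- Finite differences and zero sums modulo p

-- multichoose k x = C(x + k, k)
multichoose : ℕ → ℕ → ℕ
multichoose zero x = 1
multichoose (suc k) zero = 1
multichoose (suc k) (suc x) = multichoose k (suc x) + multichoose (suc k) x

multichoose-1 : ∀ k → multichoose k 1 ≡ suc k
multichoose-1 zero = refl
multichoose-1 (suc k) = trans (cong (_+ 1) (multichoose-1 k)) (ℕP.+-comm (suc k) 1)

-- This is (k + 1) C(x + k + 1, k + 1) = (x + 1) C(x + k + 1, k). For k + 1 = p it exhibits (x + 1)
-- · `multichoose q (suc x)` as a multiple of p.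
multichoose-absorption : ∀ k x → suc k * multichoose (suc k) x ≡ suc x * multichoose k (suc x)
multichoose-absorption k zero = begin
  suc k * 1                  ≡⟨ ℕP.*-identityʳ (suc k) ⟩
  suc k                      ≡⟨ multichoose-1 k ⟨
  multichoose k 1            ≡⟨ ℕP.*-identityˡ _ ⟨
  1 * multichoose k 1        ∎
  where open ≡-Reasoning
multichoose-absorption zero (suc x) = begin
  1 * (1 + multichoose 1 x)       ≡⟨ cong (λ z → 1 * (1 + z)) (sym (ℕP.*-identityˡ (multichoose 1 x))) ⟩
  1 * (1 + 1 * multichoose 1 x)   ≡⟨ cong (λ z → 1 * (1 + z)) (multichoose-absorption zero x) ⟩
  1 * (1 + suc x * 1)             ≡⟨ ℕP.*-identityˡ _ ⟩
  1 + suc x * 1                   ∎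
  where open ≡-Reasoning
multichoose-absorption (suc k) (suc x) = begin
  suc (suc k) * (B + C)           ≡⟨ ℕP.*-distribˡ-+ (suc (suc k)) B C ⟩
  suc (suc k) * B + suc (suc k) * C ≡⟨ cong (λ z → suc (suc k) * B + z) (multichoose-absorption (suc k) x) ⟩
  suc (suc k) * B + suc x * B     ≡⟨ lemma k x B ⟩
  suc k * B + suc (suc x) * B     ≡⟨ cong (λ z → z + suc (suc x) * B) (multichoose-absorption k (suc x)) ⟩
  suc (suc x) * A + suc (suc x) * B ≡⟨ ℕP.*-distribˡ-+ (suc (suc x)) A B ⟨
  suc (suc x) * (A + B)           ∎
  where
  open ≡-Reasoning
  A = multichoose k (suc (suc x))
  B = multichoose (suc k) (suc x)
  C = multichoose (suc (suc k)) x
  lemma : ∀ k x B → suc (suc k) * B + suc x * B ≡ suc k * B + suc (suc x) * B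
  lemma = ℕS.solve-∀

-- Total degree below d, expressed by the vanishing of all d-fold mixed unit differences, so that
-- functions need no representation as polynomials.
Deg< : ℕ → (ℕ → ℕ → ℤ) → Set
Deg< zero    f = ∀ x y → f x y ≡ 0ℤ
Deg< (suc d) f = Deg< d (λ x y → f (suc x) y - f x y) × Deg< d (λ x y → f x (suc y) - f x y)

Deg<-cong : ∀ d {f g : ℕ → ℕ → ℤ} → (∀ x y → f x y ≡ g x y) → Deg< d f → Deg< d g
Deg<-cong zero    e p = λ x y → trans (sym (e x y)) (p x y)
Deg<-cong (suc d) e (p , q) =
  Deg<-cong d (λ x y → cong₂ _-_ (e (suc x) y) (e x y)) p ,
  Deg<-cong d (λ x y → cong₂ _-_ (e x (suc y)) (e x y)) q

Deg<-0 : ∀ d → Deg< d (λ _ _ → 0ℤ)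
Deg<-0 zero    = λ x y → refl
Deg<-0 (suc d) = Deg<-0 d , Deg<-0 d

+-−-interchange : ∀ a b c d → (a - b) ℤ.+ (c - d) ≡ (a ℤ.+ c) - (b ℤ.+ d)
+-−-interchange = ℤS.solve-∀

telescope : ∀ a b c → (a - b) ℤ.+ (b - c) ≡ a - c
telescope = ℤS.solve-∀

Deg<-+ : ∀ d {f g : ℕ → ℕ → ℤ} → Deg< d f → Deg< d g → Deg< d (λ x y → f x y ℤ.+ g x y)
Deg<-+ zero    p q = λ x y → cong₂ ℤ._+_ (p x y) (q x y)
Deg<-+ (suc d) {f} {g} (p , p′) (q , q′) =
  Deg<-cong d (λ x y → +-−-interchange (f (suc x) y) (f x y) (g (suc x) y) (g x y)) (Deg<-+ d p q) ,
  Deg<-cong d (λ x y → +-−-interchange (f x (suc y)) (f x y) (g x (suc y)) (g x y)) (Deg<-+ d p′ q′)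

Deg<-shiftˣ : ∀ d u {f : ℕ → ℕ → ℤ} → Deg< d f → Deg< d (λ x y → f (u + x) y)
Deg<-shiftˣ d zero    P = P
Deg<-shiftˣ d (suc u) P = Deg<-shiftˣ d u (shift₁ d P)
  where
  shift₁ : ∀ d {f : ℕ → ℕ → ℤ} → Deg< d f → Deg< d (λ x y → f (suc x) y)
  shift₁ zero    P = λ x y → P (suc x) y
  shift₁ (suc d) (P , Q) = shift₁ d P , shift₁ d Q

Deg<-shiftʸ : ∀ d v {f : ℕ → ℕ → ℤ} → Deg< d f → Deg< d (λ x y → f x (v + y))
Deg<-shiftʸ d zero    P = P
Deg<-shiftʸ d (suc v) P = Deg<-shiftʸ d v (shift₁ d P)
  where
  shift₁ : ∀ d {f : ℕ → ℕ → ℤ} → Deg< d f → Deg< d (λ x y → f x (suc y))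
  shift₁ zero    P = λ x y → P x (suc y)
  shift₁ (suc d) (P , Q) = shift₁ d P , shift₁ d Q

-- A step (u , v) is composed of unit steps, so the difference telescopes into shifted unit
-- differences, each of degree below d.
Deg<-Δ : ∀ d {f : ℕ → ℕ → ℤ} → Deg< (suc d) f → ∀ u v → Deg< d (λ x y → f (u + x) (v + y) - f x y)
Deg<-Δ d {f} P zero zero = Deg<-cong d (λ x y → sym (ℤP.+-inverseʳ (f x y))) (Deg<-0 d)
Deg<-Δ d {f} P zero (suc v) = Deg<-cong d (λ x y → telescope (f x (suc v + y)) (f x (v + y)) (f x y))
  (Deg<-+ d (Deg<-shiftʸ d v (proj₂ P)) (Deg<-Δ d {f} P zero v))
Deg<-Δ d {f} P (suc u) v = Deg<-cong d (λ x y → telescope (f (suc u + x) (v + y)) (f (u + x) (v + y)) (f x y))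
  (Deg<-+ d (Deg<-shiftˣ d u (Deg<-shiftʸ d v (proj₁ P))) (Deg<-Δ d {f} P u v))

-- A unit difference lowers an index of `multichoose` and moves the argument by one; the offsets s
-- and t absorb this movement, which closes the family under differences.
binomials : ℕ → ℕ → ℕ → ℕ → ℕ → ℕ → ℤ
binomials i j s t x y = + multichoose i (s + x) ℤ.* + multichoose j (t + y)

-- Each difference lowers i or j by one, and vanishes in a variable whose index is 0. The degree is
-- a separate variable tied by an equation, so that the recursion follows that of `Deg<`.
Deg<-binomials : ∀ d i j s t → d ≡ suc (i + j) → Deg< d (binomials i j s t)
Deg<-binomials (suc d) i j s t e₀ = Δˣ i j (ℕP.suc-injective e₀) , Δʸ i j (ℕP.suc-injective e₀)
  where
  cancel : ∀ (a b : ℤ) → a ≡ b → a - b ≡ 0ℤ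
  cancel a .a refl = ℤP.+-inverseʳ a
  Δ₁ : ∀ k s x → + multichoose (suc k) (s + suc x) - + multichoose (suc k) (s + x) ≡ + multichoose k (suc s + x)
  Δ₁ k s x rewrite ℕP.+-suc s x =
    trans (cong (_- + multichoose (suc k) (s + x)) (ℤP.pos-+ (multichoose k (suc (s + x))) (multichoose (suc k) (s + x))))
          (lemma (+ multichoose k (suc (s + x))) (+ multichoose (suc k) (s + x)))
    where
    lemma : ∀ a b → (a ℤ.+ b) - b ≡ a
    lemma = ℤS.solve-∀
  Δˣ : ∀ i j → d ≡ i + j → Deg< d (λ x y → binomials i j s t (suc x) y - binomials i j s t x y)
  Δˣ zero j _ = Deg<-cong d (λ x y → sym (cancel (binomials zero j s t (suc x) y) (binomials zero j s t x y) refl)) (Deg<-0 d)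
  Δˣ (suc i) j e = Deg<-cong d
    (λ x y → sym (trans (lemma (+ multichoose (suc i) (s + suc x)) (+ multichoose (suc i) (s + x)) (+ multichoose j (t + y)))
                        (cong (ℤ._* + multichoose j (t + y)) (Δ₁ i s x))))
    (Deg<-binomials d i j (suc s) t e)
    where
    lemma : ∀ a b c → a ℤ.* c - b ℤ.* c ≡ (a - b) ℤ.* c
    lemma = ℤS.solve-∀
  Δʸ : ∀ i j → d ≡ i + j → Deg< d (λ x y → binomials i j s t x (suc y) - binomials i j s t x y)
  Δʸ i zero _ = Deg<-cong d (λ x y → sym (cancel (binomials i zero s t x (suc y)) (binomials i zero s t x y) refl)) (Deg<-0 d)
  Δʸ i (suc j) e = Deg<-cong d
    (λ x y → sym (trans (lemma (+ multichoose i (s + x)) (+ multichoose (suc j) (t + suc y)) (+ multichoose (suc j) (t + y)))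
                        (cong (+ multichoose i (s + x) ℤ.*_) (Δ₁ j t y))))
    (Deg<-binomials d i j s (suc t) (trans e (ℕP.+-suc i j)))
    where
    lemma : ∀ c a b → c ℤ.* a - c ℤ.* b ≡ c ℤ.* (a - b)
    lemma = ℤS.solve-∀

module _ {A : Set} (s t : A → ℕ) where

  -- Alternating sum, over all subsequences I of the list, of the values of f at (x , y) translated
  -- by the sums of s and t over I.
  Δ* : List A → (ℕ → ℕ → ℤ) → ℕ → ℕ → ℤ
  Δ* []       f x y = f x y
  Δ* (a ∷ as) f x y = Δ* as f (s a + x) (t a + y) - Δ* as f x y

  Deg<-Δ* : ∀ d as {f} → Deg< (d + length as) f → Deg< d (Δ* as f)
  Deg<-Δ* d []       {f} P = subst (λ e → Deg< e f) (ℕP.+-identityʳ d) P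
  Deg<-Δ* d (a ∷ as) {f} P =
    Deg<-Δ d {Δ* as f} (Deg<-Δ* (suc d) as {f} (subst (λ e → Deg< e f) (ℕP.+-suc d (length as)) P)) (s a) (t a)

module Mod-p (q : ℕ) (p-prime : Prime (suc q)) where

  p : ℕ
  p = suc q

  0<q : 0 < q
  0<q = ℕ.s<s⁻¹ (nonTrivial⇒n>1 p {{prime⇒nonTrivial p-prime}})

  p∤1 : ¬ (p ∣ 1)
  p∤1 p∣1 = ℕP.<⇒≱ 0<q (ℕ.s≤s⁻¹ (ℕD.∣⇒≤ p∣1))

  -- `multichoose q` replaces the polynomial 1 - x^(p - 1): degree p - 1, value 1 at 0, and zero
  -- modulo p off the multiples of p.
  p∣multichoose : ∀ x → ¬ (p ∣ x) → p ∣ multichoose q x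
  p∣multichoose zero    p∤x = ⊥-elim (p∤x (p ℕD.∣0))
  p∣multichoose (suc x) p∤x
    with euclidsLemma (suc x) (multichoose q (suc x)) p-prime
           (divides (multichoose p x) (trans (sym (multichoose-absorption q x)) (ℕP.*-comm p (multichoose p x))))
  ... | inj₁ p∣x = ⊥-elim (p∤x p∣x)
  ... | inj₂ p∣c = p∣c

  pos-∣ : ∀ {k} → p ∣ k → + p ℤD.∣ + k
  pos-∣ = ℤD.∣ᵤ⇒∣

  module ZeroSum {A : Set} (s t : A → ℕ) where

    Σs Σt : List A → ℕ
    Σs xs = sum (map s xs)
    Σt xs = sum (map t xs)

    private
      f : ℕ → ℕ → ℤ
      f = binomials q q 0 0

    -- If no subsequence translates (x , y) to zero modulo p, then p divides every term of the
    -- alternating sum.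
    subsum-hits : ∀ xs x y →
      (∃[ I ] ∃[ J ] (I ++ J ↭ xs × p ∣ Σs I + x × p ∣ Σt I + y)) ⊎ (+ p ℤD.∣ Δ* s t xs f x y)
    subsum-hits [] x y with p ∣? x | p ∣? y
    ... | yes p∣x | yes p∣y = inj₁ ([] , [] , ↭-refl , p∣x , p∣y)
    ... | no p∤x  | _       = inj₂ (ℤD.∣m⇒∣m*n (+ multichoose q y) (pos-∣ (p∣multichoose x p∤x)))
    ... | yes _   | no p∤y  = inj₂ (ℤD.∣n⇒∣m*n (+ multichoose q x) (pos-∣ (p∣multichoose y p∤y)))
    subsum-hits (a ∷ xs) x y with subsum-hits xs (s a + x) (t a + y) | subsum-hits xs x y
    ... | inj₁ (I , J , π , p∣s , p∣t) | _ =
      inj₁ (a ∷ I , J , prep a π , subst (p ∣_) (rearrange (Σs I) (s a) x) p∣s , subst (p ∣_) (rearrange (Σt I) (t a) y) p∣t)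
      where
      rearrange : ∀ S a x → S + (a + x) ≡ (a + S) + x
      rearrange = ℕS.solve-∀
    ... | inj₂ _  | inj₁ (I , J , π , p∣s , p∣t) = inj₁ (I , a ∷ J , ↭-trans (shift a I J) (prep a π) , p∣s , p∣t)
    ... | inj₂ d₁ | inj₂ d₂ = inj₂ (ℤD.∣m∣n⇒∣m-n d₁ d₂)

    ZeroSumPart : List A → Set
    ZeroSumPart xs = ∃[ I ] ∃[ J ] (I ++ J ↭ xs × I ≢ [] × p ∣ Σs I × p ∣ Σt I)

    -- Without a nonempty zero-sum subsequence, every term of the alternating sum at the origin is
    -- divisible by p, except the one of the empty subsequence, which is 1 or -1.
    zero-sum-or : ∀ xs → ZeroSumPart xs ⊎ ¬ (+ p ℤD.∣ Δ* s t xs f 0 0)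
    zero-sum-or [] = inj₂ λ d → p∤1 (subst (p ∣_) f00 (ℤD.∣⇒∣ᵤ d))
      where
      mc0 : ∀ k → multichoose k 0 ≡ 1
      mc0 zero = refl
      mc0 (suc k) = refl
      f00 : ℤ.∣ + multichoose q 0 ℤ.* + multichoose q 0 ∣ ≡ 1
      f00 rewrite mc0 q = refl
    zero-sum-or (a ∷ xs) with subsum-hits xs (s a + 0) (t a + 0) | zero-sum-or xs
    ... | inj₁ (I , J , π , p∣s , p∣t) | _ =
      inj₁ (a ∷ I , J , prep a π , (λ ()) , subst (p ∣_) (rearrange (Σs I) (s a)) p∣s , subst (p ∣_) (rearrange (Σt I) (t a)) p∣t)
      where
      rearrange : ∀ S a → S + (a + 0) ≡ a + S
      rearrange = ℕS.solve-∀
    ... | inj₂ _ | inj₁ (I , J , π , I≢[] , p∣s , p∣t) = inj₁ (I , a ∷ J , ↭-trans (shift a I J) (prep a π) , I≢[] , p∣s , p∣t)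
    ... | inj₂ d | inj₂ ¬d = inj₂ λ e → ¬d (subst (+ p ℤD.∣_) (lemma (Δ* s t xs f (s a + 0) (t a + 0)) _) (ℤD.∣m∣n⇒∣m-n d e))
      where
      lemma : ∀ a b → a - (a - b) ≡ b
      lemma = ℤS.solve-∀

    abstract
      -- Olson's bound 2p - 1 for the Davenport constant of C_p ⊕ C_p. The product of two
      -- polynomials of degree q is annihilated by 2q + 1 differences, so the alternating sum is 0,
      -- which p does divide.
      zero-sum : ∀ xs → length xs ≡ suc (q + q) → ZeroSumPart xs
      zero-sum xs len with zero-sum-or xs
      ... | inj₁ z  = z
      ... | inj₂ ¬d = ⊥-elim (¬d (subst (+ p ℤD.∣_)
        (sym (Deg<-Δ* s t 0 xs (subst (λ e → Deg< e f) (sym len) (Deg<-binomials _ q q 0 0 refl)) 0 0)) (ℤD.divides 0ℤ refl)))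

-- Differences in one variable and subset sums modulo p

-- Degree at most k, with c equal to k! times the coefficient in degree k.
Lead : ℕ → ℤ → (ℕ → ℤ) → Set
Lead zero    c f = ∀ x → f x ≡ c
Lead (suc k) c f = Lead k c (λ x → f (suc x) - f x)

Lead-cong : ∀ k {c} {f g : ℕ → ℤ} → (∀ x → f x ≡ g x) → Lead k c f → Lead k c g
Lead-cong zero    e p = λ x → trans (sym (e x)) (p x)
Lead-cong (suc k) e p = Lead-cong k (λ x → cong₂ _-_ (e (suc x)) (e x)) p

Lead-0 : ∀ k → Lead k 0ℤ (λ _ → 0ℤ)
Lead-0 zero    = λ x → refl
Lead-0 (suc k) = Lead-0 k

Lead-+ : ∀ k {b c} {f g : ℕ → ℤ} → Lead k b f → Lead k c g → Lead k (b ℤ.+ c) (λ x → f x ℤ.+ g x)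
Lead-+ zero    p q = λ x → cong₂ ℤ._+_ (p x) (q x)
Lead-+ (suc k) {f = f} {g} p q = Lead-cong k (λ x → +-−-interchange (f (suc x)) (f x) (g (suc x)) (g x)) (Lead-+ k p q)

Lead-shift : ∀ k u {c} {f : ℕ → ℤ} → Lead k c f → Lead k c (λ x → f (u + x))
Lead-shift k zero    P = P
Lead-shift k (suc u) P = Lead-shift k u (shift₁ k P)
  where
  shift₁ : ∀ k {c} {f : ℕ → ℤ} → Lead k c f → Lead k c (λ x → f (suc x))
  shift₁ zero    P = λ x → P (suc x)
  shift₁ (suc k) P = shift₁ k P

Lead-Δ : ∀ k {c f} → Lead (suc k) c f → ∀ u → Lead k (+ u ℤ.* c) (λ x → f (u + x) - f x)
Lead-Δ k {c} {f} P zero = Lead-cong k (λ x → sym (ℤP.+-inverseʳ (f x))) (Lead-0 k)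
Lead-Δ k {c} {f} P (suc u) = subst (λ e → Lead k e _) (sym (ℤP.suc-* (+ u) c))
  (Lead-cong k (λ x → telescope (f (suc u + x)) (f (u + x)) (f x)) (Lead-+ k (Lead-shift k u P) (Lead-Δ k {f = f} P u)))

Δ¹ : List ℕ → (ℕ → ℤ) → ℕ → ℤ
Δ¹ []       f x = f x
Δ¹ (d ∷ ds) f x = Δ¹ ds f (d + x) - Δ¹ ds f x

-- A difference with step d multiplies the leading constant by d, so the iterated difference records
-- whether some step is divisible by p.
Lead-Δ¹ : ∀ k ds {c f} → Lead (k + length ds) c f → Lead k (+ product ds ℤ.* c) (Δ¹ ds f)
Lead-Δ¹ k [] {c} {f} P = subst (λ e → Lead k e f) (sym (ℤP.*-identityˡ c)) (subst (λ e → Lead e c f) (ℕP.+-identityʳ k) P)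
Lead-Δ¹ k (d ∷ ds) {c} {f} P = subst (λ e → Lead k e _)
  (trans (sym (ℤP.*-assoc (+ d) (+ product ds) c)) (cong (ℤ._* c) (sym (ℤP.pos-* d (product ds)))))
  (Lead-Δ k {f = Δ¹ ds f} (Lead-Δ¹ (suc k) ds {f = f} (subst (λ e → Lead e c f) (ℕP.+-suc k (length ds)) P)) d)

Lead-multichoose : ∀ k u → Lead k 1ℤ (λ x → + multichoose k (u + x))
Lead-multichoose zero    u = λ x → refl
Lead-multichoose (suc k) u = Lead-cong k step (Lead-multichoose k (suc u))
  where
  lemma : ∀ a b → a ≡ (a ℤ.+ b) - b
  lemma = ℤS.solve-∀
  step : ∀ x → + multichoose k (suc u + x) ≡ + multichoose (suc k) (u + suc x) - + multichoose (suc k) (u + x)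
  step x rewrite ℕP.+-suc u x = trans (lemma (+ multichoose k (suc (u + x))) (+ multichoose (suc k) (u + x)))
    (cong (_- + multichoose (suc k) (u + x)) (sym (ℤP.pos-+ (multichoose k (suc (u + x))) (multichoose (suc k) (u + x)))))

data SubSum : List ℕ → ℕ → Set where
  []   : SubSum [] 0
  keep : ∀ {d ds e} → SubSum ds e → SubSum (d ∷ ds) (d + e)
  skip : ∀ {d ds e} → SubSum ds e → SubSum (d ∷ ds) e

module SubsetSums (q : ℕ) (p-prime : Prime (suc q)) where
  open Mod-p q p-prime

  subsum-or : ∀ ds x → (∃[ e ] (SubSum ds e × p ∣ e + x)) ⊎ (+ p ℤD.∣ Δ¹ ds (λ x → + multichoose q x) x)
  subsum-or [] x with p ∣? x
  ... | yes p∣x = inj₁ (0 , [] , p∣x)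
  ... | no p∤x  = inj₂ (pos-∣ (p∣multichoose x p∤x))
  subsum-or (d ∷ ds) x with subsum-or ds (d + x) | subsum-or ds x
  ... | inj₁ (e , σ , p∣) | _ = inj₁ (d + e , keep σ , subst (p ∣_) (rearrange e d x) p∣)
    where
    rearrange : ∀ S a x → S + (a + x) ≡ (a + S) + x
    rearrange = ℕS.solve-∀
  ... | inj₂ _ | inj₁ (e , σ , p∣) = inj₁ (e , skip σ , p∣)
  ... | inj₂ a | inj₂ b = inj₂ (ℤD.∣m∣n⇒∣m-n a b)

  p∤product : ∀ ds → All (λ d → ¬ (p ∣ d)) ds → ¬ (p ∣ product ds)
  p∤product [] [] p∣ = p∤1 p∣
  p∤product (d ∷ ds) (p∤d ∷ p∤ds) p∣ with euclidsLemma d (product ds) p-prime p∣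
  ... | inj₁ p∣d = p∤d p∣d
  ... | inj₂ p∣π = p∤product ds p∤ds p∣π

  abstract
    -- Exactly q differences of a polynomial of degree q leave the constant `product ds`, which is
    -- prime to p. Hence p fails to divide some term of the alternating sum, and the corresponding e
    -- + x is a multiple of p.
    subsum-surjective : ∀ ds → All (λ d → ¬ (p ∣ d)) ds → length ds ≡ q → ∀ x → ∃[ e ] (SubSum ds e × p ∣ e + x)
    subsum-surjective ds p∤ds len x with subsum-or ds x
    ... | inj₁ r = r
    ... | inj₂ d = ⊥-elim (p∤product ds p∤ds (ℤD.∣⇒∣ᵤ (subst (+ p ℤD.∣_) Δ≡ d)))
      where
      Δ≡ : Δ¹ ds (λ x → + multichoose q x) x ≡ + product ds
      Δ≡ = trans (Lead-Δ¹ 0 ds (subst (λ k → Lead k 1ℤ (λ x → + multichoose q x)) (sym len) (Lead-multichoose q 0)) x)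
                 (ℤP.*-identityʳ (+ product ds))

-- Pigeonhole principle for the prefixes of a list

module _ {A : Set} where

  segment : ∀ (xs : List A) i j → i < j → j ≤ length xs →
    ∃[ u ] ∃[ v ] ∃[ w ] (xs ≡ u ++ v ++ w × v ≢ [] × length v ≤ j × take i xs ≡ u × take j xs ≡ u ++ v)
  segment (x ∷ xs) zero (suc j) _ j≤l =
    [] , take (suc j) (x ∷ xs) , drop (suc j) (x ∷ xs) , sym (ListP.take++drop≡id (suc j) (x ∷ xs)) , (λ ()) ,
    ℕP.≤-trans (ℕP.≤-reflexive (ListP.length-take (suc j) (x ∷ xs))) (ℕP.m⊓n≤m (suc j) _) , refl , refl
  segment (x ∷ xs) (suc i) (suc j) (s≤s i<j) (s≤s j≤l)
    with u , v , w , e , v≢[] , l , e₁ , e₂ ← segment xs i j i<j j≤l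
    = x ∷ u , v , w , cong (x ∷_) e , v≢[] , ℕP.m≤n⇒m≤1+n l , cong (x ∷_) e₁ , cong (x ∷_) e₂

  abstract
    -- Two of the N + 1 prefixes of length at most N already agree under F, whence the bound on the
    -- length of v.
    prefix-pigeonhole : ∀ {N} (F : List A → Fin N) xs → N ≤ length xs →
      ∃[ u ] ∃[ v ] ∃[ w ] (xs ≡ u ++ v ++ w × v ≢ [] × length v ≤ N × F u ≡ F (u ++ v))
    prefix-pigeonhole {N} F xs N≤l
      with i , j , i<j , e ← FinP.pigeonhole (ℕP.n<1+n N) (λ i → F (take (toℕ i) xs))
      with u , v , w , xs≡ , v≢[] , l , e₁ , e₂ ← segment xs (toℕ i) (toℕ j) i<j (ℕP.≤-trans (FinP.toℕ≤pred[n] j) N≤l)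
      = u , v , w , xs≡ , v≢[] , ℕP.≤-trans l (FinP.toℕ≤pred[n] j) ,
        trans (cong F (sym e₁)) (trans e (cong F e₂))

-- The plane over 𝔽_p, with integer representatives

Vec² : Set
Vec² = ℤ × ℤ

det : Vec² → Vec² → ℤ
det (x₁ , x₂) (y₁ , y₂) = x₁ ℤ.* y₂ - y₁ ℤ.* x₂

infixl 6 _⊕_
_⊕_ : Vec² → Vec² → Vec²
(x₁ , x₂) ⊕ (y₁ , y₂) = x₁ ℤ.+ y₁ , x₂ ℤ.+ y₂

module Plane (p : ℕ) (p-prime : Prime p) where

  infix 4 p∣_
  p∣_ : ℤ → Set
  p∣ z = + p ℤD.∣ z

  Zero : Vec² → Set
  Zero (x₁ , x₂) = (p∣ x₁) × (p∣ x₂)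

  euclid : ∀ a b → p∣ a ℤ.* b → p∣ a ⊎ p∣ b
  euclid a b d with euclidsLemma ℤ.∣ a ∣ ℤ.∣ b ∣ p-prime (subst (p ∣_) (ℤP.abs-* a b) (ℤD.∣⇒∣ᵤ d))
  ... | inj₁ h = inj₁ (ℤD.∣ᵤ⇒∣ h)
  ... | inj₂ h = inj₂ (ℤD.∣ᵤ⇒∣ h)

  det-⊕ : ∀ x y z → det x (y ⊕ z) ≡ det x y ℤ.+ det x z
  det-⊕ (a , b) (c , d) (e , f) = lemma a b c d e f
    where
    lemma : ∀ a b c d e f → a ℤ.* (d ℤ.+ f) - (c ℤ.+ e) ℤ.* b ≡ (a ℤ.* d - c ℤ.* b) ℤ.+ (a ℤ.* f - e ℤ.* b)
    lemma = ℤS.solve-∀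

  det-swap : ∀ x y → det x y ≡ ℤ.- det y x
  det-swap (a , b) (c , d) = lemma a b c d
    where
    lemma : ∀ a b c d → a ℤ.* d - c ℤ.* b ≡ ℤ.- (c ℤ.* b - a ℤ.* d)
    lemma = ℤS.solve-∀

  p∣det-swap : ∀ x y → p∣ det x y → p∣ det y x
  p∣det-swap x y d = subst p∣_ (sym (det-swap y x)) (ℤD.∣m⇒∣-m d)

  p∣det-self : ∀ x → p∣ det x x
  p∣det-self (a , b) = subst p∣_ (sym (ℤP.+-inverseʳ (a ℤ.* b))) (ℤD.divides 0ℤ refl)

  p∣det-⊕ : ∀ x y z → p∣ det x y → p∣ det x z → p∣ det x (y ⊕ z)
  p∣det-⊕ x y z d e = subst p∣_ (sym (det-⊕ x y z)) (ℤD.∣m∣n⇒∣m+n d e)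

  p∣det-⊕ˡ : ∀ x y z → p∣ det x (y ⊕ z) → p∣ det x y → p∣ det x z
  p∣det-⊕ˡ x y z d e = ℤD.∣m+n∣m⇒∣n (subst p∣_ (det-⊕ x y z) d) e

  p∣det-⊕ʳ : ∀ x y z → p∣ det x (y ⊕ z) → p∣ det x z → p∣ det x y
  p∣det-⊕ʳ x y z d e = ℤD.∣m+n∣n⇒∣m (subst p∣_ (det-⊕ x y z) d) e

  -- Cramer's rule: det x y · w = det x w · y − det y w · x.
  cramer : ∀ x y w → ¬ (p∣ det x y) → p∣ det x w → p∣ det y w → Zero w
  cramer x@(x₁ , x₂) y@(y₁ , y₂) w@(w₁ , w₂) ¬d d e = first , second
    where
    lemma₁ : ∀ x₁ x₂ y₁ y₂ w₁ w₂ → (x₁ ℤ.* w₂ - w₁ ℤ.* x₂) ℤ.* y₁ - (y₁ ℤ.* w₂ - w₁ ℤ.* y₂) ℤ.* x₁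
                                 ≡ (x₁ ℤ.* y₂ - y₁ ℤ.* x₂) ℤ.* w₁
    lemma₁ = ℤS.solve-∀
    lemma₂ : ∀ x₁ x₂ y₁ y₂ w₁ w₂ → (x₁ ℤ.* w₂ - w₁ ℤ.* x₂) ℤ.* y₂ - (y₁ ℤ.* w₂ - w₁ ℤ.* y₂) ℤ.* x₂
                                 ≡ (x₁ ℤ.* y₂ - y₁ ℤ.* x₂) ℤ.* w₂
    lemma₂ = ℤS.solve-∀
    first : p∣ w₁
    first = fromInj₂ (⊥-elim ∘ ¬d) (euclid (det x y) w₁ (subst p∣_ (lemma₁ x₁ x₂ y₁ y₂ w₁ w₂)
      (ℤD.∣m∣n⇒∣m-n (ℤD.∣m⇒∣m*n y₁ d) (ℤD.∣m⇒∣m*n x₁ e))))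
    second : p∣ w₂
    second = fromInj₂ (⊥-elim ∘ ¬d) (euclid (det x y) w₂ (subst p∣_ (lemma₂ x₁ x₂ y₁ y₂ w₁ w₂)
      (ℤD.∣m∣n⇒∣m-n (ℤD.∣m⇒∣m*n y₂ d) (ℤD.∣m⇒∣m*n x₂ e))))

  -- Otherwise y and z would be independent, and x, being parallel to both, would vanish.
  parallel-trans : ∀ x y z → ¬ Zero x → p∣ det x y → p∣ det x z → p∣ det y z
  parallel-trans x y z ¬0 d e with + p ℤD.∣? det y z
  ... | yes h = h
  ... | no ¬h = ⊥-elim (¬0 (cramer y z x ¬h (p∣det-swap x y d) (p∣det-swap x z e)))

  -- If y is parallel to x + σ and to one of x and σ, it is parallel to the other as well; these are
  -- independent, so y would vanish.
  transversal : ∀ x σ y → ¬ (p∣ det x σ) → ¬ Zero y → p∣ det y (x ⊕ σ) → (¬ (p∣ det y x)) × (¬ (p∣ det y σ))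
  transversal x σ y ¬d ¬0 e =
    (λ h → ¬0 (cramer x σ y ¬d (p∣det-swap y x h) (p∣det-swap y σ (p∣det-⊕ˡ y x σ e h)))) ,
    (λ h → ¬0 (cramer x σ y ¬d (p∣det-swap y x (p∣det-⊕ʳ y x σ e h)) (p∣det-swap y σ h)))

  -- Otherwise x + y + σ would be parallel both to y and to x, which are independent, and would
  -- vanish.
  exchange : ∀ x σ y → ¬ (p∣ det y x) → ¬ Zero (x ⊕ (y ⊕ σ)) → p∣ det y (x ⊕ σ) → ¬ (p∣ det x (y ⊕ σ))
  exchange x@(x₁ , x₂) σ@(σ₁ , σ₂) y@(y₁ , y₂) ¬d ¬0 e h = ¬0 (cramer y x (x ⊕ (y ⊕ σ)) ¬d
    (subst (λ v → p∣ det y v) (cong₂ _,_ (lemma y₁ x₁ σ₁) (lemma y₂ x₂ σ₂)) (p∣det-⊕ y y (x ⊕ σ) (p∣det-self y) e))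
    (p∣det-⊕ x x (y ⊕ σ) (p∣det-self x) h))
    where
    lemma : ∀ a b c → a ℤ.+ (b ℤ.+ c) ≡ b ℤ.+ (a ℤ.+ c)
    lemma = ℤS.solve-∀

  -- A line through the origin other than the second axis meets that axis only in the origin. So for
  -- parallel vectors a single coordinate decides whether a sum is zero.
  parallel-second : ∀ x y → p∣ det x y → ¬ (p∣ proj₁ x) → p∣ proj₁ y → p∣ proj₂ y
  parallel-second (x₁ , x₂) (y₁ , y₂) d x₁≢0 e = fromInj₂ (⊥-elim ∘ x₁≢0)
    (euclid x₁ y₂ (subst p∣_ (lemma (x₁ ℤ.* y₂) (y₁ ℤ.* x₂)) (ℤD.∣m∣n⇒∣m+n d (ℤD.∣m⇒∣m*n x₂ e))))
    where
    lemma : ∀ a b → (a - b) ℤ.+ b ≡ a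
    lemma = ℤS.solve-∀

  parallel-first : ∀ x y → p∣ det x y → ¬ (p∣ proj₂ x) → p∣ proj₂ y → p∣ proj₁ y
  parallel-first (x₁ , x₂) (y₁ , y₂) d x₂≢0 e = fromInj₁ (⊥-elim ∘ x₂≢0)
    (euclid y₁ x₂ (subst p∣_ (lemma (x₁ ℤ.* y₂) (y₁ ℤ.* x₂)) (ℤD.∣m∣n⇒∣m-n (ℤD.∣n⇒∣m*n x₁ e) d)))
    where
    lemma : ∀ a b → a - (a - b) ≡ b
    lemma = ℤS.solve-∀

-- Powers and commutation in a group

module GroupFacts {n : ℕ} (_∙_ : Op₂ (Fin n)) (ε : Fin n) (_⁻¹ : Op₁ (Fin n)) (isGroup : IsGroup _≡_ _∙_ ε _⁻¹) where

  open IsGroup isGroup public using (assoc; identityˡ; identityʳ; inverseˡ; inverseʳ)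
  open ≡-Reasoning

  infixr 7 _·_
  _·_ : Op₂ (Fin n)
  _·_ = _∙_

  Commute : Fin n → Fin n → Set
  Commute x y = x · y ≡ y · x

  -- Products are nested to the right; this rewrites the two leading factors of a longer product.
  head-≡ : ∀ {a b x y} → a · b ≡ x · y → ∀ z → a · b · z ≡ x · y · z
  head-≡ {a} {b} {x} {y} e z = trans (sym (assoc a b z)) (trans (cong (_· z) e) (assoc x y z))

  cancelˡ : ∀ x {y z} → x · y ≡ x · z → y ≡ z
  cancelˡ x {y} {z} e = begin
    y               ≡⟨ identityˡ y ⟨
    ε · y           ≡⟨ cong (_· y) (inverseˡ x) ⟨
    (x ⁻¹ · x) · y  ≡⟨ assoc _ _ _ ⟩
    x ⁻¹ · x · y    ≡⟨ cong (x ⁻¹ ·_) e ⟩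
    x ⁻¹ · x · z    ≡⟨ assoc _ _ _ ⟨
    (x ⁻¹ · x) · z  ≡⟨ cong (_· z) (inverseˡ x) ⟩
    ε · z           ≡⟨ identityˡ z ⟩
    z               ∎

  cancelʳ : ∀ x {y z} → y · x ≡ z · x → y ≡ z
  cancelʳ x {y} {z} e = begin
    y               ≡⟨ identityʳ y ⟨
    y · ε           ≡⟨ cong (y ·_) (inverseʳ x) ⟨
    y · x · x ⁻¹    ≡⟨ assoc _ _ _ ⟨
    (y · x) · x ⁻¹  ≡⟨ cong (_· x ⁻¹) e ⟩
    (z · x) · x ⁻¹  ≡⟨ assoc _ _ _ ⟩
    z · x · x ⁻¹    ≡⟨ cong (z ·_) (inverseʳ x) ⟩
    z · ε           ≡⟨ identityʳ z ⟩
    z               ∎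

  inv-cancelˡ : ∀ x y → x ⁻¹ · x · y ≡ y
  inv-cancelˡ x y = trans (sym (assoc _ _ _)) (trans (cong (_· y) (inverseˡ x)) (identityˡ y))

  cancel-invˡ : ∀ x y → x · x ⁻¹ · y ≡ y
  cancel-invˡ x y = trans (sym (assoc _ _ _)) (trans (cong (_· y) (inverseʳ x)) (identityˡ y))

  commute-· : ∀ {x y z} → Commute x z → Commute y z → Commute (x · y) z
  commute-· {x} {y} {z} e f = begin
    (x · y) · z  ≡⟨ assoc _ _ _ ⟩
    x · y · z    ≡⟨ cong (x ·_) f ⟩
    x · z · y    ≡⟨ head-≡ e y ⟩
    z · x · y    ∎

  commute-⁻¹ : ∀ {x z} → Commute x z → Commute (x ⁻¹) z
  commute-⁻¹ {x} {z} e = cancelˡ x (begin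
    x · x ⁻¹ · z  ≡⟨ cancel-invˡ x z ⟩
    z             ≡⟨ identityʳ z ⟨
    z · ε         ≡⟨ cong (z ·_) (inverseʳ x) ⟨
    z · x · x ⁻¹  ≡⟨ head-≡ (sym e) _ ⟩
    x · z · x ⁻¹  ∎)

  commute-ε : ∀ {z} → Commute ε z
  commute-ε {z} = trans (identityˡ z) (sym (identityʳ z))

  pow : Fin n → ℕ → Fin n
  pow x zero    = ε
  pow x (suc k) = x · pow x k

  pow-+ : ∀ x i j → pow x (i + j) ≡ pow x i · pow x j
  pow-+ x zero    j = sym (identityˡ _)
  pow-+ x (suc i) j = trans (cong (x ·_) (pow-+ x i j)) (sym (assoc _ _ _))

  pow-ε : ∀ k → pow ε k ≡ ε
  pow-ε zero    = refl
  pow-ε (suc k) = trans (identityˡ _) (pow-ε k)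

  pow-* : ∀ x i j → pow x (i * j) ≡ pow (pow x j) i
  pow-* x zero    j = refl
  pow-* x (suc i) j = trans (pow-+ x j (i * j)) (cong (pow x j ·_) (pow-* x i j))

  commute-pow : ∀ {x z} k → Commute x z → Commute (pow x k) z
  commute-pow zero    e = commute-ε
  commute-pow (suc k) e = commute-· e (commute-pow k e)

  pow-· : ∀ x k → pow x k · x ≡ x · pow x k
  pow-· x k = commute-pow k refl

  pow-twistʳ : ∀ {x y c} k → x · y ≡ c · y · x → Commute c x → Commute c y → ∀ j → pow x k · pow y j ≡ pow c (k * j) · pow y j · pow x k
  pow-twistʳ {x} {y} {c} k e cx cy j = outer k
    where
    d = pow c j
    inner : ∀ j → x · pow y j ≡ pow c j · pow y j · x
    inner zero = begin
      x · ε      ≡⟨ identityʳ x ⟩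
      x          ≡⟨ identityˡ x ⟨
      ε · x      ≡⟨ identityˡ _ ⟨
      ε · ε · x  ∎
    inner (suc j) = begin
      x · y · pow y j                      ≡⟨ sym (assoc _ _ _) ⟩
      (x · y) · pow y j                    ≡⟨ cong (_· pow y j) e ⟩
      (c · y · x) · pow y j                ≡⟨ assoc _ _ _ ⟩
      c · (y · x) · pow y j                ≡⟨ cong (c ·_) (assoc _ _ _) ⟩
      c · y · x · pow y j                  ≡⟨ cong (λ w → c · y · w) (inner j) ⟩
      c · y · pow c j · pow y j · x        ≡⟨ cong (c ·_) (head-≡ (sym (commute-pow j cy)) _) ⟩
      c · pow c j · y · pow y j · x        ≡⟨ sym (assoc _ _ _) ⟩
      (c · pow c j) · y · pow y j · x      ≡⟨ cong ((c · pow c j) ·_) (sym (assoc _ _ _)) ⟩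
      (c · pow c j) · (y · pow y j) · x    ∎
    outer : ∀ k → pow x k · pow y j ≡ pow c (k * j) · pow y j · pow x k
    outer zero = begin
      ε · pow y j      ≡⟨ identityˡ _ ⟩
      pow y j          ≡⟨ identityʳ _ ⟨
      pow y j · ε      ≡⟨ identityˡ _ ⟨
      ε · pow y j · ε  ∎
    outer (suc k) = begin
      (x · pow x k) · pow y j                          ≡⟨ assoc _ _ _ ⟩
      x · pow x k · pow y j                            ≡⟨ cong (x ·_) (outer k) ⟩
      x · pow c (k * j) · pow y j · pow x k            ≡⟨ head-≡ (sym (commute-pow (k * j) cx)) _ ⟩
      pow c (k * j) · x · pow y j · pow x k            ≡⟨ cong (pow c (k * j) ·_) (sym (assoc _ _ _)) ⟩
      pow c (k * j) · (x · pow y j) · pow x k          ≡⟨ cong (λ w → pow c (k * j) · w · pow x k) (inner j) ⟩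
      pow c (k * j) · (d · pow y j · x) · pow x k      ≡⟨ cong (pow c (k * j) ·_) (trans (assoc _ _ _) (cong (d ·_) (assoc _ _ _))) ⟩
      pow c (k * j) · d · pow y j · x · pow x k        ≡⟨ sym (assoc _ _ _) ⟩
      (pow c (k * j) · d) · pow y j · x · pow x k      ≡⟨ cong (_· pow y j · x · pow x k) (trans (sym (pow-+ c (k * j) j)) (cong (pow c) (ℕP.+-comm (k * j) j))) ⟩
      pow c (j + k * j) · pow y j · x · pow x k        ∎

  pow-cancel : ∀ x i j → pow x i ≡ pow x (i + j) → pow x j ≡ ε
  pow-cancel x i j e = cancelˡ (pow x i) (trans (sym (pow-+ x i j)) (trans (sym e) (sym (identityʳ _))))

  module Order (c : Fin n) (q : ℕ) (c-order : pow c (suc q) ≡ ε) where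

    pow-mod : ∀ i k → pow c (i + suc q * k) ≡ pow c i
    pow-mod i k = begin
      pow c (i + suc q * k)              ≡⟨ pow-+ c i (suc q * k) ⟩
      pow c i · pow c (suc q * k)        ≡⟨ cong (λ e → pow c i · pow c e) (ℕP.*-comm (suc q) k) ⟩
      pow c i · pow c (k * suc q)        ≡⟨ cong (pow c i ·_) (pow-* c k (suc q)) ⟩
      pow c i · pow (pow c (suc q)) k    ≡⟨ cong (λ d → pow c i · pow d k) c-order ⟩
      pow c i · pow ε k                  ≡⟨ cong (pow c i ·_) (pow-ε k) ⟩
      pow c i · ε                        ≡⟨ identityʳ _ ⟩
      pow c i                            ∎

    -- Since q ≡ -1 modulo q + 1, the natural number `q * k` serves as the exponent -k.
    pow-inv : ∀ k z → pow c (q * k) · pow c k · z ≡ z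
    pow-inv k z = begin
      pow c (q * k) · pow c k · z    ≡⟨ sym (assoc _ _ _) ⟩
      (pow c (q * k) · pow c k) · z  ≡⟨ cong (_· z) (sym (pow-+ c (q * k) k)) ⟩
      pow c (q * k + k) · z          ≡⟨ cong (λ e → pow c e · z) (ℕP.+-comm (q * k) k) ⟩
      pow c (suc q * k) · z          ≡⟨ cong (_· z) (pow-mod 0 k) ⟩
      ε · z                          ≡⟨ identityˡ z ⟩
      z                              ∎

    reduce : ∀ k → ∃[ i ] pow c k ≡ pow c (toℕ {suc q} i)
    reduce k = Fin.fromℕ< (m%n<n k (suc q)) , (begin
      pow c k                          ≡⟨ cong (pow c) (m≡m%n+[m/n]*n k (suc q)) ⟩
      pow c (k % suc q + k / suc q * suc q)        ≡⟨ cong (λ e → pow c (k % suc q + e)) (ℕP.*-comm (k / suc q) (suc q)) ⟩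
      pow c (k % suc q + suc q * (k / suc q))      ≡⟨ pow-mod (k % suc q) (k / suc q) ⟩
      pow c (k % suc q)                    ≡⟨ cong (pow c) (sym (FinP.toℕ-fromℕ< (m%n<n k (suc q)))) ⟩
      pow c (toℕ (Fin.fromℕ< (m%n<n k (suc q)))) ∎)

    -- Equality of cosets of ⟨c⟩; the exponent ranges over a finite type to make it decidable.
    _~_ : Fin n → Fin n → Set
    x ~ y = ∃[ k ] y ≡ pow c (toℕ {suc q} k) · x

    _~?_ : ∀ x y → Dec (x ~ y)
    x ~? y = FinP.any? (λ k → y FinP.≟ (pow c (toℕ k) · x))

    ~-refl : ∀ {x} → x ~ x
    ~-refl = Fin.zero , sym (identityˡ _)

    ~-sym : ∀ {x y} → x ~ y → y ~ x
    ~-sym {x} {y} (k , refl) with i , e ← reduce (q * toℕ k) = i , sym (trans (cong (_· y) (sym e)) (pow-inv (toℕ k) x))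

    ~-trans : ∀ {x y z} → x ~ y → y ~ z → x ~ z
    ~-trans {x} (i , refl) (j , refl) with k , e ← reduce (toℕ j + toℕ i) =
      k , trans (sym (assoc _ _ _)) (cong (_· x) (trans (sym (pow-+ c (toℕ j) (toℕ i))) e))

    module Exact (minimal : ∀ j → j < q → pow c (suc j) ≢ ε) where

      powers-distinct : ∀ (i j : Fin (suc q)) → toℕ i < toℕ j → pow c (toℕ i) ≢ pow c (toℕ j)
      powers-distinct i j i<j e with r , eq ← ℕP.m≤n⇒∃[o]m+o≡n i<j =
        minimal r (ℕP.≤-trans (subst (suc r ≤_) (trans (ℕP.+-suc (toℕ i) r) eq) (ℕP.m≤n+m (suc r) (toℕ i))) (FinP.toℕ≤pred[n] j))
          (pow-cancel c (toℕ i) (suc r) (trans e (cong (pow c) (sym (trans (ℕP.+-suc (toℕ i) r) eq)))))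

      powers-injective : ∀ {i j : Fin (suc q)} → pow c (toℕ i) ≡ pow c (toℕ j) → i ≡ j
      powers-injective {i} {j} e with ℕP.<-cmp (toℕ i) (toℕ j)
      ... | tri≈ _ i≡j _ = FinP.toℕ-injective i≡j
      ... | tri< i<j _ _ = ⊥-elim (powers-distinct i j i<j e)
      ... | tri> _ _ j<i = ⊥-elim (powers-distinct j i j<i (sym e))

  prod-++ : ∀ xs ys → prod _∙_ ε (xs ++ ys) ≡ prod _∙_ ε xs · prod _∙_ ε ys
  prod-++ []       ys = sym (identityˡ _)
  prod-++ (x ∷ xs) ys = trans (cong (x ·_) (prod-++ xs ys)) (sym (assoc _ _ _))

-- Splitting product-one sequences over a group of class two

rearrange-short : ∀ p r S → p + r + p * S ≡ r + p * suc S
rearrange-short = ℕS.solve-∀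

rearrange-long : ∀ w r a L → w + r + a + w * L ≡ r + a + w * suc L
rearrange-long = ℕS.solve-∀

count-short : ∀ k L S → k + (L + suc S) ≡ suc k + (L + S)
count-short = ℕS.solve-∀

count-long : ∀ k L S → k + (suc L + S) ≡ suc k + (L + S)
count-long = ℕS.solve-∀

-- Here a and b count the noncentral and the central elements: when few elements are noncentral, the
-- central ones alone are numerous enough for a pigeonhole in a set of size m p.
central-room : ∀ q m a b → 1 ≤ m → a ≤ suc q → (q * q + 4 * q + 1) * m < a + b → m * suc q ≤ b
central-room q m a b m≥1 a≤ big = ℕP.+-cancelˡ-≤ (suc q) _ _ (begin
  suc q + m * suc q                          ≤⟨ ℕP.+-monoˡ-≤ (m * suc q) (s≤s (ℕP.≤-trans (ℕP.≤-reflexive (sym (ℕP.*-identityʳ q))) (ℕP.*-monoʳ-≤ q m≥1))) ⟩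
  suc (q * m) + m * suc q                    ≤⟨ ℕP.m≤m+n _ ((q * q + 2 * q) * m) ⟩
  suc (q * m) + m * suc q + (q * q + 2 * q) * m  ≡⟨ lemma q m ⟩
  suc ((q * q + 4 * q + 1) * m)              ≤⟨ big ⟩
  a + b                                      ≤⟨ ℕP.+-monoˡ-≤ b a≤ ⟩
  suc q + b                                  ∎)
  where
  open ℕP.≤-Reasoning
  lemma : ∀ q m → suc (q * m) + m * suc q + (q * q + 2 * q) * m ≡ suc ((q * q + 4 * q + 1) * m)
  lemma = ℕS.solve-∀

module Splitting (q : ℕ) (p-prime : Prime (suc q))
  {n : ℕ} (_∙_ : Op₂ (Fin n)) (ε : Fin n) (_⁻¹ : Op₁ (Fin n)) (isGroup : IsGroup _≡_ _∙_ ε _⁻¹) where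

  open GroupFacts _∙_ ε _⁻¹ isGroup
  open Mod-p q p-prime
  open SubsetSums q p-prime
  open Plane p p-prime

  -- Elements of a group in which the commutator of x and y is c to the power
  -- det (s x , t x) (s y , t y); the products with (s , t) ≡ 0 modulo p form at most
  -- m cosets of ⟨c⟩.
  record Symplectic (m : ℕ) : Set₁ where
    field
      X         : Set
      val       : X → Fin n
      s t       : X → ℕ
      c         : Fin n
      c-order   : pow c p ≡ ε
      c-central : ∀ x → Commute c (val x)
      commutator : ∀ x y → pow c (s y * t x) · val x · val y ≡ pow c (s x * t y) · val y · val x

    open ZeroSum s t public

    prodX : List X → Fin n
    prodX xs = prod _∙_ ε (map val xs)

    ZeroΣ : List X → Set
    ZeroΣ xs = p ∣ Σs xs × p ∣ Σt xs

    field
      coset      : ∀ xs → ZeroΣ xs → Fin m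
      coset-≡    : ∀ {xs ys z w} → coset xs z ≡ coset ys w → ∃[ k ] prodX ys ≡ pow c k · prodX xs
      position   : ∀ xs → ZeroΣ xs → Fin (m * p)
      position-≡ : ∀ {xs ys z w} → position xs z ≡ position ys w → prodX ys ≡ prodX xs

  module Commutation {m : ℕ} (𝕊 : Symplectic m) where
    open Symplectic 𝕊

    open Order c q c-order public

    pow-central : ∀ k x → Commute (pow c k) (val x)
    pow-central k x = commute-pow k (c-central x)

    pow-central* : ∀ k xs → Commute (pow c k) (prodX xs)
    pow-central* k [] = sym commute-ε
    pow-central* k (x ∷ xs) = sym (commute-· (sym (pow-central k x)) (sym (pow-central* k xs)))

    pow-central-left : ∀ k x z → val x · pow c k · z ≡ pow c k · val x · z
    pow-central-left k x z = head-≡ (sym (pow-central k x)) z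

    prodX-++ : ∀ xs ys → prodX (xs ++ ys) ≡ prodX xs · prodX ys
    prodX-++ xs ys = trans (cong (prod _∙_ ε) (ListP.map-++ val xs ys)) (prod-++ (map val xs) (map val ys))

    Σs-++ : ∀ xs ys → Σs (xs ++ ys) ≡ Σs xs + Σs ys
    Σs-++ [] ys = refl
    Σs-++ (x ∷ xs) ys = trans (cong (λ e → s x + e) (Σs-++ xs ys)) (sym (ℕP.+-assoc (s x) _ _))

    Σt-++ : ∀ xs ys → Σt (xs ++ ys) ≡ Σt xs + Σt ys
    Σt-++ [] ys = refl
    Σt-++ (x ∷ xs) ys = trans (cong (λ e → t x + e) (Σt-++ xs ys)) (sym (ℕP.+-assoc (t x) _ _))

    ZeroΣ-++ : ∀ {xs ys} → ZeroΣ xs → ZeroΣ ys → ZeroΣ (xs ++ ys)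
    ZeroΣ-++ {xs} {ys} (a , b) (c , d) =
      subst (p ∣_) (sym (Σs-++ xs ys)) (ℕD.∣m∣n⇒∣m+n a c) , subst (p ∣_) (sym (Σt-++ xs ys)) (ℕD.∣m∣n⇒∣m+n b d)

    -- The exponent of the commutator is additive in its second argument and powers of c are
    -- central, so only the sums of s and t over ys enter, not their order.
    commutator* : ∀ x ys → pow c (Σs ys * t x) · val x · prodX ys ≡ pow c (s x * Σt ys) · prodX ys · val x
    commutator* x [] = begin
      ε · val x · ε                ≡⟨ identityˡ _ ⟩
      val x · ε                    ≡⟨ commute-ε ⟨
      ε · val x                    ≡⟨ identityˡ _ ⟨
      ε · ε · val x                ≡⟨ cong (λ e → pow c e · ε · val x) (sym (ℕP.*-zeroʳ (s x))) ⟩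
      pow c (s x * 0) · ε · val x  ∎
      where open ≡-Reasoning
    commutator* x (y ∷ ys) = begin
      pow c ((s y + S) * t x) · val x · val y · P
        ≡⟨ cong (_· (val x · val y · P)) (trans (cong (pow c) (ℕP.*-distribʳ-+ (t x) (s y) S))
             (trans (cong (pow c) (ℕP.+-comm (s y * t x) (S * t x))) (pow-+ c (S * t x) (s y * t x)))) ⟩
      (pow c (S * t x) · pow c (s y * t x)) · val x · val y · P
        ≡⟨ assoc _ _ _ ⟩
      pow c (S * t x) · pow c (s y * t x) · val x · val y · P
        ≡⟨ cong (λ w → pow c (S * t x) · w) (twist P) ⟩
      pow c (S * t x) · pow c (s x * t y) · val y · val x · P
        ≡⟨ head-≡ (commute-pow (S * t x) (sym (commute-pow (s x * t y) refl))) _ ⟩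
      pow c (s x * t y) · pow c (S * t x) · val y · val x · P
        ≡⟨ cong (pow c (s x * t y) ·_) (sym (pow-central-left (S * t x) y _)) ⟩
      pow c (s x * t y) · val y · pow c (S * t x) · val x · P
        ≡⟨ cong (λ w → pow c (s x * t y) · val y · w) (commutator* x ys) ⟩
      pow c (s x * t y) · val y · pow c (s x * T) · P · val x
        ≡⟨ cong (pow c (s x * t y) ·_) (pow-central-left (s x * T) y _) ⟩
      pow c (s x * t y) · pow c (s x * T) · val y · P · val x
        ≡⟨ sym (assoc _ _ _) ⟩
      (pow c (s x * t y) · pow c (s x * T)) · val y · P · val x
        ≡⟨ cong (_· (val y · P · val x)) (trans (sym (pow-+ c (s x * t y) (s x * T))) (cong (pow c) (sym (ℕP.*-distribˡ-+ (s x) (t y) T)))) ⟩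
      pow c (s x * (t y + T)) · val y · P · val x
        ≡⟨ cong (pow c (s x * (t y + T)) ·_) (sym (assoc _ _ _)) ⟩
      pow c (s x * (t y + T)) · (val y · P) · val x ∎
      where
      open ≡-Reasoning
      S = Σs ys
      T = Σt ys
      P = prodX ys
      twist : ∀ z → pow c (s y * t x) · val x · val y · z ≡ pow c (s x * t y) · val y · val x · z
      twist z = begin
        pow c (s y * t x) · val x · val y · z    ≡⟨ cong (pow c (s y * t x) ·_) (sym (assoc _ _ _)) ⟩
        pow c (s y * t x) · (val x · val y) · z  ≡⟨ sym (assoc _ _ _) ⟩
        (pow c (s y * t x) · val x · val y) · z  ≡⟨ cong (_· z) (commutator x y) ⟩
        (pow c (s x * t y) · val y · val x) · z  ≡⟨ assoc _ _ _ ⟩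
        pow c (s x * t y) · (val y · val x) · z  ≡⟨ cong (pow c (s x * t y) ·_) (assoc _ _ _) ⟩
        pow c (s x * t y) · val y · val x · z    ∎

    -- q ≡ −1 modulo p, so this is −det x (Σ ys): the exponent of c picked up when x
    -- moves from the left end of ys to the right end.
    shiftExp : X → List X → ℕ
    shiftExp x ys = q * (s x * Σt ys) + Σs ys * t x

    shift-right : ∀ x ys → prodX ys · val x ≡ pow c (shiftExp x ys) · val x · prodX ys
    shift-right x ys = begin
      P · val x                                              ≡⟨ sym (pow-inv B _) ⟩
      pow c (q * B) · pow c B · P · val x                    ≡⟨ cong (pow c (q * B) ·_) (sym (commutator* x ys)) ⟩
      pow c (q * B) · pow c A · val x · P                    ≡⟨ sym (assoc _ _ _) ⟩
      (pow c (q * B) · pow c A) · val x · P                  ≡⟨ cong (_· (val x · P)) (sym (pow-+ c (q * B) A)) ⟩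
      pow c (q * B + A) · val x · P                          ∎
      where
      open ≡-Reasoning
      A = Σs ys * t x
      B = s x * Σt ys
      P = prodX ys

    vec : X → Vec²
    vec x = + s x , + t x

    vecΣ : List X → Vec²
    vecΣ xs = + Σs xs , + Σt xs

    p∣shiftExp⇒p∣det : ∀ x ys → p ∣ shiftExp x ys → p∣ det (vec x) (vecΣ ys)
    p∣shiftExp⇒p∣det x ys d = subst p∣_ eq
      (ℤD.∣m∣n⇒∣m-n (ℤD.∣m⇒∣m*n (+ s x ℤ.* + Σt ys) (ℤD.∣-refl {+ p})) (subst p∣_ cast (pos-∣ d)))
      where
      cast : + shiftExp x ys ≡ + q ℤ.* (+ s x ℤ.* + Σt ys) ℤ.+ + Σs ys ℤ.* + t x
      cast = trans (ℤP.pos-+ (q * (s x * Σt ys)) (Σs ys * t x))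
        (cong₂ ℤ._+_ (trans (ℤP.pos-* q (s x * Σt ys)) (cong (+ q ℤ.*_) (ℤP.pos-* (s x) (Σt ys)))) (ℤP.pos-* (Σs ys) (t x)))
      lemma : ∀ Q a b → (1ℤ ℤ.+ Q) ℤ.* a - (Q ℤ.* a ℤ.+ b) ≡ a - b
      lemma = ℤS.solve-∀
      eq : + p ℤ.* (+ s x ℤ.* + Σt ys) - (+ q ℤ.* (+ s x ℤ.* + Σt ys) ℤ.+ + Σs ys ℤ.* + t x) ≡ det (vec x) (vecΣ ys)
      eq = lemma (+ q) (+ s x ℤ.* + Σt ys) (+ Σs ys ℤ.* + t x)

    -- Congruent to the determinant of x and y modulo p, since q ≡ -1.
    swapExp : X → X → ℕ
    swapExp x y = q * (s y * t x) + s x * t y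

    swap-heads : ∀ x y z → val x · val y · z ≡ pow c (swapExp x y) · val y · val x · z
    swap-heads x y z = begin
      val x · val y · z                              ≡⟨ sym (pow-inv A _) ⟩
      pow c (q * A) · pow c A · val x · val y · z    ≡⟨ cong (pow c (q * A) ·_) (reassoc (pow c A) x y z) ⟩
      pow c (q * A) · (pow c A · val x · val y) · z  ≡⟨ cong (λ w → pow c (q * A) · w · z) (commutator x y) ⟩
      pow c (q * A) · (pow c B · val y · val x) · z  ≡⟨ cong (pow c (q * A) ·_) (sym (reassoc (pow c B) y x z)) ⟩
      pow c (q * A) · pow c B · val y · val x · z    ≡⟨ sym (assoc _ _ _) ⟩
      (pow c (q * A) · pow c B) · val y · val x · z  ≡⟨ cong (_· (val y · val x · z)) (sym (pow-+ c (q * A) B)) ⟩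
      pow c (q * A + B) · val y · val x · z          ∎
      where
      open ≡-Reasoning
      A = s y * t x
      B = s x * t y
      reassoc : ∀ d x y z → d · val x · val y · z ≡ (d · val x · val y) · z
      reassoc d x y z = sym (trans (assoc _ _ _) (cong (d ·_) (assoc _ _ _)))

    -- Serves for equality modulo ⟨c⟩ of arbitrary elements, and for true equality when the elements
    -- are all parallel or all central.
    prodX-resp-↭ : {P : X → Set} (_≈_ : Fin n → Fin n → Set) →
      (∀ {u} → u ≈ u) → (∀ {u v w} → u ≈ v → v ≈ w → u ≈ w) →
      (∀ x {u v} → u ≈ v → (val x · u) ≈ (val x · v)) →
      (∀ x y → P x → P y → ∀ z → (val x · val y · z) ≈ (val y · val x · z)) →
      ∀ {xs ys} → xs ↭ ys → All P xs → prodX xs ≈ prodX ys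
    prodX-resp-↭ {P} _≈_ ≈-refl ≈-trans ≈-cong ≈-swap = go
      where
      go : ∀ {xs ys} → xs ↭ ys → All P xs → prodX xs ≈ prodX ys
      go Perm.refl _ = ≈-refl
      go (Perm.prep x π) (_ ∷ ps) = ≈-cong x (go π ps)
      go (Perm.swap x y π) (px ∷ py ∷ ps) = ≈-trans (≈-cong x (≈-cong y (go π ps))) (≈-swap x y px py _)
      go (Perm.trans π ρ) ps = ≈-trans (go π ps) (go ρ (All-resp-↭ π ps))

    prodX-↭-mod : ∀ {xs ys} → xs ↭ ys → ∃[ k ] prodX xs ≡ pow c k · prodX ys
    prodX-↭-mod {xs} π = prodX-resp-↭ {λ _ → ⊤} (λ u v → ∃[ k ] u ≡ pow c k · v)
      (0 , sym (identityˡ _))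
      (λ { {w = w} (i , refl) (j , refl) → i + j , trans (sym (assoc _ _ _)) (cong (_· w) (sym (pow-+ c i j))) })
      (λ { x {v = v} (k , refl) → k , pow-central-left k x v })
      (λ x y _ _ z → swapExp x y , swap-heads x y z)
      π (All.universal (λ _ → tt) xs)

    -- Sequences whose orderings fill a coset of ⟨c⟩

    Full : List X → Set
    Full T = ∀ k → ∃[ T′ ] (T′ ↭ T × prodX T′ ≡ pow c k · prodX T)

    Full-++ : ∀ {T} R → Full T → Full (T ++ R)
    Full-++ {T} R full k with T′ , π , e ← full k =
      T′ ++ R , ++⁺ʳ R π , (begin
        prodX (T′ ++ R)                ≡⟨ prodX-++ T′ R ⟩
        prodX T′ · prodX R             ≡⟨ cong (_· prodX R) e ⟩
        (pow c k · prodX T) · prodX R  ≡⟨ assoc _ _ _ ⟩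
        pow c k · prodX T · prodX R    ≡⟨ cong (pow c k ·_) (sym (prodX-++ T R)) ⟩
        pow c k · prodX (T ++ R)       ∎)
      where open ≡-Reasoning

    -- The reference product changes only by some c^j, which is compensated by asking for the
    -- exponent k + q j, that is k - j.
    Full-resp-↭ : ∀ {T S} → T ↭ S → Full T → Full S
    Full-resp-↭ {T} {S} π full k with j , e ← prodX-↭-mod π with T′ , ρ , e′ ← full (k + q * j) =
      T′ , ↭-trans ρ π , (begin
        prodX T′                            ≡⟨ e′ ⟩
        pow c (k + q * j) · prodX T         ≡⟨ cong (pow c (k + q * j) ·_) e ⟩
        pow c (k + q * j) · pow c j · prodX S    ≡⟨ cong (_· (pow c j · prodX S)) (pow-+ c k (q * j)) ⟩
        (pow c k · pow c (q * j)) · pow c j · prodX S  ≡⟨ assoc _ _ _ ⟩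
        pow c k · pow c (q * j) · pow c j · prodX S  ≡⟨ cong (pow c k ·_) (pow-inv j _) ⟩
        pow c k · prodX S                   ∎)
      where open ≡-Reasoning

    Full-product-one : ∀ {T} → Full T → (∃[ k ] prodX T ≡ pow c k) → ∃[ T′ ] (T′ ↭ T × prodX T′ ≡ ε)
    Full-product-one {T} full (k , e) with T′ , π , e′ ← full (q * k) =
      T′ , π , trans e′ (trans (cong (pow c (q * k) ·_) (trans e (sym (identityʳ _)))) (pow-inv k ε))

    -- Each new x can be put to the left or to the right of T, and the two products
    -- differ by a nontrivial power of c.
    data Good : List X → Set where
      one : ∀ x → Good (x ∷ [])
      add : ∀ {x T} → Good T → ¬ (p∣ det (vec x) (vecΣ T)) → Good (x ∷ T)

    abstract
      -- Moving an added x to the right end contributes the factor c^`shiftExp x T`. The choices are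
      -- independent, because this exponent depends on T only through its sum and earlier choices
      -- contribute central factors. The initial element offers no choice, so `ds` is shorter than T
      -- by one.
      Good-subsums : ∀ {T} → Good T → ∃[ ds ] (suc (length ds) ≡ length T × All (λ d → ¬ (p ∣ d)) ds ×
        (∀ {e} → SubSum ds e → ∃[ T′ ] (T′ ↭ T × prodX T′ ≡ pow c e · prodX T)))
      Good-subsums (one x) = [] , refl , [] , λ { [] → [ x ] , ↭-refl , sym (identityˡ _) }
      Good-subsums (add {x} {T} good x∦T) with ds , len , p∤ , real ← Good-subsums good =
        shiftExp x T ∷ ds , cong suc len , (λ d → x∦T (p∣shiftExp⇒p∣det x T d)) ∷ p∤ , realise
        where
        open ≡-Reasoning
        realise : ∀ {e} → SubSum (shiftExp x T ∷ ds) e → ∃[ T′ ] (T′ ↭ x ∷ T × prodX T′ ≡ pow c e · prodX (x ∷ T))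
        realise (skip {e = e} σ) with T′ , π , eq ← real σ =
          x ∷ T′ , prep x π , trans (cong (val x ·_) eq) (pow-central-left e x (prodX T))
        realise (keep {e = e} σ) with T′ , π , eq ← real σ =
          T′ ++ [ x ] , ↭-trans (++-comm T′ [ x ]) (prep x π) , (begin
            prodX (T′ ++ [ x ])                      ≡⟨ prodX-++ T′ [ x ] ⟩
            prodX T′ · val x · ε                     ≡⟨ cong (prodX T′ ·_) (identityʳ _) ⟩
            prodX T′ · val x                         ≡⟨ cong (_· val x) eq ⟩
            (pow c e · prodX T) · val x              ≡⟨ assoc _ _ _ ⟩
            pow c e · prodX T · val x                ≡⟨ cong (pow c e ·_) (shift-right x T) ⟩
            pow c e · pow c d · val x · prodX T      ≡⟨ sym (assoc _ _ _) ⟩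
            (pow c e · pow c d) · val x · prodX T    ≡⟨ cong (_· (val x · prodX T)) (trans (sym (pow-+ c e d)) (cong (pow c) (ℕP.+-comm e d))) ⟩
            pow c (d + e) · val x · prodX T          ∎)
          where
          d : ℕ
          d = shiftExp x T

    abstract
      Good⇒Full : ∀ {T} → Good T → length T ≡ p → Full T
      Good⇒Full {T} good len k
        with ds , len′ , p∤ , real ← Good-subsums good
        -- Making e + q k a multiple of p amounts to e ≡ k.
        with e , σ , divides r eq ← subsum-surjective ds p∤ (ℕP.suc-injective (trans len′ len)) (q * k)
        with T′ , π , eq′ ← real σ
        = T′ , π , trans eq′ (cong (_· prodX T) (begin
            pow c e                  ≡⟨ sym (pow-mod e k) ⟩
            pow c (e + p * k)        ≡⟨ cong (pow c) (trans (lemma e q k) (trans (cong (λ z → z + k) eq) (trans (ℕP.+-comm (r * p) k) (cong (λ z → k + z) (ℕP.*-comm r p))))) ⟩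
            pow c (k + p * r)        ≡⟨ pow-mod k r ⟩
            pow c k                  ∎))
        where
        open ≡-Reasoning
        lemma : ∀ e q k → e + suc q * k ≡ (e + q * k) + k
        lemma = ℕS.solve-∀

    p∣det⇒p∣swapExp : ∀ x y → p∣ det (vec x) (vec y) → p ∣ swapExp x y
    p∣det⇒p∣swapExp x y d = ℤD.∣⇒∣ᵤ (subst p∣_ eq (ℤD.∣m∣n⇒∣m+n (ℤD.∣m⇒∣m*n (+ s y ℤ.* + t x) (ℤD.∣-refl {+ p})) d))
      where
      lemma : ∀ Q a b → (1ℤ ℤ.+ Q) ℤ.* a ℤ.+ (b - a) ≡ Q ℤ.* a ℤ.+ b
      lemma = ℤS.solve-∀
      eq : + p ℤ.* (+ s y ℤ.* + t x) ℤ.+ det (vec x) (vec y) ≡ + swapExp x y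
      eq = trans (lemma (+ q) (+ s y ℤ.* + t x) (+ s x ℤ.* + t y)) (sym (trans (ℤP.pos-+ (q * (s y * t x)) (s x * t y))
        (cong₂ ℤ._+_ (trans (ℤP.pos-* q (s y * t x)) (cong (+ q ℤ.*_) (ℤP.pos-* (s y) (t x)))) (ℤP.pos-* (s x) (t y)))))

    parallel-swap : ∀ x y → p∣ det (vec x) (vec y) → ∀ z → val x · val y · z ≡ val y · val x · z
    parallel-swap x y d z with divides r e ← p∣det⇒p∣swapExp x y d =
      trans (swap-heads x y z) (trans (cong (_· (val y · val x · z)) (trans (cong (pow c) (trans e (ℕP.*-comm r p))) (pow-mod 0 r))) (identityˡ _))

    prodX-↭-parallel : ∀ {x₀ xs ys} → ¬ Zero (vec x₀) → All (λ x → p∣ det (vec x₀) (vec x)) xs → xs ↭ ys → prodX xs ≡ prodX ys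
    prodX-↭-parallel {x₀} nz par π = prodX-resp-↭ _≡_ refl trans (λ x → cong (val x ·_))
      (λ x y px py → parallel-swap x y (parallel-trans (vec x₀) (vec x) (vec y) nz px py)) π par

    zero-parallel : ∀ x y → Zero (vec x) → p∣ det (vec x) (vec y)
    zero-parallel x y (a , b) = ℤD.∣m∣n⇒∣m-n (ℤD.∣m⇒∣m*n (+ t y) a) (ℤD.∣n⇒∣m*n (+ s y) b)

    NC : X → Set
    NC x = ¬ Zero (vec x)

    Zero? : ∀ v → Dec (Zero v)
    Zero? (a , b) = (+ p ℤD.∣? a) ×-dec (+ p ℤD.∣? b)

    -- If neither y ∷ x ∷ T nor x ∷ y ∷ T is good, then x + y + Σ T ≡ 0, and then y′ ∷ x ∷ T
    -- or y′ ∷ y ∷ T is good.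
    abstract
      grow : ∀ {x T y y′} R → Good T → ¬ (p∣ det (vec x) (vecΣ T)) → NC y → NC y′ →
        ∃[ x′ ] ∃[ T′ ] ∃[ R′ ] (Good T′ × ¬ (p∣ det (vec x′) (vecΣ T′)) × length T′ ≡ suc (length T) ×
          x′ ∷ T′ ++ R′ ↭ x ∷ T ++ y ∷ y′ ∷ R)
      grow {x} {T} {y} {y′} R good x∦T ncy ncy′ with + p ℤD.∣? det (vec y) (vecΣ (x ∷ T))
      ... | no y∦ = y , x ∷ T , y′ ∷ R , add good x∦T , y∦ , refl , ↭-sym (shift y (x ∷ T) (y′ ∷ R))
      ... | yes y∥ with Zero? (vec x ⊕ (vec y ⊕ vecΣ T))
      ...   | no ¬0 = x , y ∷ T , y′ ∷ R , add good (proj₂ tr) , exchange (vec x) (vecΣ T) (vec y) (proj₁ tr) ¬0 y∥ , refl ,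
                      prep x (↭-sym (shift y T (y′ ∷ R)))
        where
        tr : ¬ (p∣ det (vec y) (vec x)) × ¬ (p∣ det (vec y) (vecΣ T))
        tr = transversal (vec x) (vecΣ T) (vec y) x∦T ncy y∥
      ...   | yes 0₁ with + p ℤD.∣? det (vec y′) (vecΣ (x ∷ T))
      ...     | no y′∦ = y′ , x ∷ T , y ∷ R , add good x∦T , y′∦ , refl , (begin
                  y′ ∷ x ∷ T ++ y ∷ R        ↭⟨ shift y′ (x ∷ T) (y ∷ R) ⟨
                  x ∷ T ++ y′ ∷ y ∷ R        ↭⟨ ++⁺ˡ (x ∷ T) (swap y′ y ↭-refl) ⟩
                  x ∷ T ++ y ∷ y′ ∷ R        ∎)
        where open PermutationReasoning
      ...     | yes y′∥ = y′ , y ∷ T , x ∷ R , add good (proj₂ tr) , y′∦ , refl , (begin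
                  y′ ∷ y ∷ T ++ x ∷ R        ↭⟨ prep y′ (prep y (shift x T R)) ⟩
                  y′ ∷ y ∷ x ∷ T ++ R        ↭⟨ prep y′ (swap y x ↭-refl) ⟩
                  y′ ∷ x ∷ y ∷ T ++ R        ↭⟨ shift y′ (x ∷ y ∷ T) R ⟨
                  x ∷ y ∷ T ++ y′ ∷ R        ↭⟨ prep x (shift y T (y′ ∷ R)) ⟨
                  x ∷ T ++ y ∷ y′ ∷ R        ∎)
        where
        open PermutationReasoning
        tr : ¬ (p∣ det (vec y) (vec x)) × ¬ (p∣ det (vec y) (vecΣ T))
        tr = transversal (vec x) (vecΣ T) (vec y) x∦T ncy y∥
        tr′ : ¬ (p∣ det (vec y′) (vec x)) × ¬ (p∣ det (vec y′) (vecΣ T))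
        tr′ = transversal (vec x) (vecΣ T) (vec y′) x∦T ncy′ y′∥
        det-zero : ∀ v w → Zero w → p∣ det v w
        det-zero (v₁ , v₂) (w₁ , w₂) (a , b) = ℤD.∣m∣n⇒∣m-n (ℤD.∣n⇒∣m*n v₁ b) (ℤD.∣m⇒∣m*n v₂ a)
        y′∦ : ¬ (p∣ det (vec y′) (vecΣ (y ∷ T)))
        y′∦ h = proj₁ tr′ (p∣det-⊕ʳ (vec y′) (vec x) (vec y ⊕ vecΣ T) (det-zero (vec y′) (vec x ⊕ (vec y ⊕ vecΣ T)) 0₁) h)

    FullPart : List X → Set
    FullPart B = ∃[ T ] ∃[ R ] (T ++ R ↭ B × Full T × length T ≡ p)

    abstract
      grow-to-full : ∀ k {x T R} → Good T → ¬ (p∣ det (vec x) (vecΣ T)) → All NC (x ∷ T ++ R) →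
        suc (length T) + k ≡ p → p < length (x ∷ T ++ R) → FullPart (x ∷ T ++ R)
      grow-to-full zero {x} {T} {R} good x∦T ncs len _ =
        x ∷ T , R , ↭-refl , Good⇒Full (add good x∦T) (trans (sym (ℕP.+-identityʳ _)) len) , trans (sym (ℕP.+-identityʳ _)) len
      grow-to-full (suc k) {x} {T} {[]} good x∦T ncs len long = ⊥-elim (ℕP.<⇒≱ long (begin
        suc (length (T ++ []))     ≡⟨ cong (suc ∘ length) (ListP.++-identityʳ T) ⟩
        suc (length T)             ≤⟨ ℕP.m≤m+n _ (suc k) ⟩
        suc (length T) + suc k     ≡⟨ len ⟩
        p                          ∎))
        where open ℕP.≤-Reasoning
      grow-to-full (suc k) {x} {T} {y ∷ []} good x∦T ncs len long = ⊥-elim (ℕP.<⇒≱ long (begin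
        suc (length (T ++ y ∷ [])) ≡⟨ cong suc (trans (ListP.length-++ T) (ℕP.+-comm (length T) 1)) ⟩
        suc (suc (length T))       ≤⟨ s≤s (s≤s (ℕP.m≤m+n (length T) k)) ⟩
        suc (suc (length T + k))   ≡⟨ cong suc (sym (ℕP.+-suc (length T) k)) ⟩
        suc (length T) + suc k     ≡⟨ len ⟩
        p                          ∎))
        where open ℕP.≤-Reasoning
      grow-to-full (suc k) {x} {T} {y ∷ y′ ∷ R} good x∦T ncs len long
        with ncy ∷ ncy′ ∷ _ ← AllP.++⁻ʳ (x ∷ T) ncs
        with x′ , T′ , R′ , good′ , x′∦ , len′ , π ← grow R good x∦T ncy ncy′
        with T″ , R″ , ρ , full , l ← grow-to-full k {x′} {T′} {R′} good′ x′∦ (All-resp-↭ (↭-sym π) ncs)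
               (trans (cong (λ e → suc e + k) len′) (trans (cong suc (sym (ℕP.+-suc (length T) k))) len))
               (subst (p <_) (sym (↭-length π)) long)
        = T″ , R″ , ↭-trans ρ π , full , l

    parallel-or-not : ∀ x₀ xs → (∃[ y ] ∃[ R ] (y ∷ R ↭ xs × ¬ (p∣ det (vec x₀) (vec y)))) ⊎ All (λ x → p∣ det (vec x₀) (vec x)) xs
    parallel-or-not x₀ [] = inj₂ []
    parallel-or-not x₀ (x ∷ xs) with + p ℤD.∣? det (vec x₀) (vec x) | parallel-or-not x₀ xs
    ... | no ∦  | _ = inj₁ (x , xs , ↭-refl , ∦)
    ... | yes ∥ | inj₁ (y , R , π , ∦) = inj₁ (y , x ∷ R , ↭-trans (swap y x ↭-refl) (prep x π) , ∦)
    ... | yes ∥ | inj₂ ∥s = inj₂ (∥ ∷ ∥s)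

    abstract
      full-or-parallel : ∀ x₀ B → All NC (x₀ ∷ B) → p < length (x₀ ∷ B) →
        FullPart (x₀ ∷ B) ⊎ All (λ x → p∣ det (vec x₀) (vec x)) (x₀ ∷ B)
      full-or-parallel x₀ B ncs long with parallel-or-not x₀ B
      ... | inj₂ ∥s = inj₂ (p∣det-self (vec x₀) ∷ ∥s)
      ... | inj₁ (y , R , π , ∦)
        with k , e ← ℕP.m≤n⇒∃[o]m+o≡n 0<q
        with T , R′ , ρ , full , l ← grow-to-full k {x₀} {y ∷ []} {R} (one y) (subst (λ v → ¬ (p∣ det (vec x₀) v)) (cong₂ _,_ (cong +_ (sym (ℕP.+-identityʳ (s y)))) (cong +_ (sym (ℕP.+-identityʳ (t y))))) ∦)
               (All-resp-↭ (prep x₀ (↭-sym π)) ncs) (cong suc e) (subst (p <_) (cong suc (sym (↭-length π))) long)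
        = inj₁ (T , R′ , ↭-trans ρ (prep x₀ π) , full , l)

  -- Zero-sum blocks and the splitting of long sequences

  module Blocks {m : ℕ} (𝕊 : Symplectic m) where
    open Symplectic 𝕊
    open Commutation 𝕊

    abstract
      mod-pigeonhole : ∀ (f : X → ℕ) xs → p ≤ length xs →
        ∃[ u ] ∃[ v ] ∃[ w ] (xs ≡ u ++ v ++ w × v ≢ [] × length v ≤ p × p ∣ sum (map f v))
      mod-pigeonhole f xs long
        with u , v , w , e , v≢[] , len , eq ← prefix-pigeonhole (λ u → Fin.fromℕ< (m%n<n (sum (map f u)) p)) xs long
        = u , v , w , e , v≢[] , len , p∣v
        where
        Σf : List X → ℕ
        Σf u = sum (map f u)
        Σf-++ : ∀ u v → Σf (u ++ v) ≡ Σf u + Σf v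
        Σf-++ []      v = refl
        Σf-++ (x ∷ u) v = trans (cong (λ e → f x + e) (Σf-++ u v)) (sym (ℕP.+-assoc (f x) _ _))
        a b : ℕ
        a = Σf u
        b = Σf v
        same : a % p ≡ (a + b) % p
        same = trans (FinP.fromℕ<-injective _ _ (m%n<n a p) (m%n<n (Σf (u ++ v)) p) eq) (cong (_% p) (Σf-++ u v))
        p∣v : p ∣ b
        p∣v = ℕD.∣m+n∣m⇒∣n (divides ((a + b) / p) (ℕP.+-cancelˡ-≡ (a % p) _ _ (begin
          a % p + (a / p * p + b)          ≡⟨ ℕP.+-assoc (a % p) _ b ⟨
          a % p + a / p * p + b            ≡⟨ cong (λ z → z + b) (sym (m≡m%n+[m/n]*n a p)) ⟩
          a + b                            ≡⟨ m≡m%n+[m/n]*n (a + b) p ⟩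
          (a + b) % p + (a + b) / p * p    ≡⟨ cong (λ z → z + (a + b) / p * p) (sym same) ⟩
          a % p + (a + b) / p * p          ∎))) (divides (a / p) refl)
          where open ≡-Reasoning

    parallel-Σ : ∀ x₀ xs → All (λ x → p∣ det (vec x₀) (vec x)) xs → p∣ det (vec x₀) (vecΣ xs)
    parallel-Σ x₀ [] [] = subst p∣_ (lemma (+ s x₀) (+ t x₀)) (ℤD.divides 0ℤ refl)
      where
      lemma : ∀ a b → 0ℤ ≡ a ℤ.* 0ℤ - 0ℤ ℤ.* b
      lemma = ℤS.solve-∀
    parallel-Σ x₀ (x ∷ xs) (∥ ∷ ∥s) = p∣det-⊕ (vec x₀) (vec x) (vecΣ xs) ∥ (parallel-Σ x₀ xs ∥s)

    abstract
      -- On a line one coordinate controls the sum, so a segment between two prefixes with the same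
      -- residue in that coordinate is a block; this costs p elements instead of 2p - 1. The
      -- coordinate is one in which x₀ does not vanish.
      parallel-short-block : ∀ {x₀} B → NC x₀ → All (λ x → p∣ det (vec x₀) (vec x)) B → p ≤ length B →
        ∃[ I ] ∃[ J ] (I ++ J ↭ B × I ≢ [] × ZeroΣ I × length I ≤ p)
      parallel-short-block {x₀} B nc par long with + p ℤD.∣? + s x₀
      ... | no p∤s with u , v , w , refl , v≢[] , len , p∣v ← mod-pigeonhole s B long =
        v , u ++ w , shifts v u , v≢[] ,
        (p∣v , ℤD.∣⇒∣ᵤ (parallel-second (vec x₀) (vecΣ v) (parallel-Σ x₀ v (AllP.++⁻ˡ v (AllP.++⁻ʳ u par))) p∤s (pos-∣ p∣v))) , len
      ... | yes p∣s with u , v , w , refl , v≢[] , len , p∣v ← mod-pigeonhole t B long =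
        v , u ++ w , shifts v u , v≢[] ,
        (ℤD.∣⇒∣ᵤ (parallel-first (vec x₀) (vecΣ v) (parallel-Σ x₀ v (AllP.++⁻ˡ v (AllP.++⁻ʳ u par))) (λ p∣t → nc (p∣s , p∣t)) (pos-∣ p∣v)) , p∣v) , len

    zero-or-all-NC : ∀ xs → (∃[ z ] ∃[ R ] (z ∷ R ↭ xs × Zero (vec z))) ⊎ All NC xs
    zero-or-all-NC [] = inj₂ []
    zero-or-all-NC (x ∷ xs) with Zero? (vec x) | zero-or-all-NC xs
    ... | yes z | _ = inj₁ (x , xs , ↭-refl , z)
    ... | no nc | inj₁ (z , R , π , h) = inj₁ (z , x ∷ R , ↭-trans (swap z x ↭-refl) (prep x π) , h)
    ... | no nc | inj₂ ncs = inj₂ (nc ∷ ncs)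

    Zero⇒ZeroΣ : ∀ {z} → Zero (vec z) → ZeroΣ (z ∷ [])
    Zero⇒ZeroΣ {z} (a , b) = subst (p ∣_) (sym (ℕP.+-identityʳ (s z))) (ℤD.∣⇒∣ᵤ a) , subst (p ∣_) (sym (ℕP.+-identityʳ (t z))) (ℤD.∣⇒∣ᵤ b)

    -- A block that is longer than p has to compensate for its length by being full.
    BlockOf : List X → Set
    BlockOf ys = ∃[ I ] ∃[ J ] (I ++ J ↭ ys × I ≢ [] × ZeroΣ I × length I ≤ suc (q + q) × (length I ≤ p ⊎ Full I))

    short : ∀ {k} → k ≤ p → k ≤ suc (q + q)
    short k≤p = ℕP.≤-trans k≤p (s≤s (ℕP.m≤m+n q q))

    reblock : ∀ {I J ys : List X} → I ++ J ↭ ys → (∃[ I′ ] ∃[ J′ ] (I′ ++ J′ ↭ I × I′ ≢ [] × ZeroΣ I′ × length I′ ≤ p)) → BlockOf ys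
    reblock {I} {J} π (I′ , J′ , ρ , ne , z , len) =
      I′ , J′ ++ J , ↭-trans (↭-sym (PermP.++-assoc I′ J′ J)) (↭-trans (++⁺ʳ J ρ) π) , ne , z , short len , inj₁ len

    abstract
      -- A zero-sum subsequence I longer than p is itself full if it has a full part. Otherwise it
      -- yields a shorter block: a single central element, or, when its elements are all parallel, a
      -- segment of length at most p.
      block-exact : ∀ ys → length ys ≡ suc (q + q) → BlockOf ys
      block-exact ys len with zero-sum ys len
      ... | [] , J , π , ne , _ = ⊥-elim (ne refl)
      ... | I@(x₀ ∷ B) , J , π , ne , z₁ , z₂ with length I ℕP.≤? p
      ...   | yes l = I , J , π , ne , (z₁ , z₂) , short l , inj₁ l
      ...   | no ¬l with zero-or-all-NC I
      ...     | inj₁ (z , R , ρ , h) = reblock π (z ∷ [] , R , ρ , (λ ()) , Zero⇒ZeroΣ h , s≤s z≤n)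
      ...     | inj₂ ncs with full-or-parallel x₀ B ncs (ℕP.≰⇒> ¬l)
      ...       | inj₁ (T , R , ρ , full , _) = I , J , π , ne , (z₁ , z₂) ,
                    ℕP.≤-trans (ℕP.m≤m+n (length I) (length J)) (ℕP.≤-reflexive (trans (sym (ListP.length-++ I)) (trans (↭-length π) len))) ,
                    inj₂ (Full-resp-↭ ρ (Full-++ R full))
      ...       | inj₂ par = reblock π (parallel-short-block I (All.head ncs) par (ℕP.<⇒≤ (ℕP.≰⇒> ¬l)))

    abstract
      block : ∀ ys → suc (q + q) ≤ length ys → BlockOf ys
      block ys long with I , J , π , rest ← block-exact (take (suc (q + q)) ys) (trans (ListP.length-take (suc (q + q)) ys) (ℕP.m≤n⇒m⊓n≡m long)) =
        I , J ++ drop (suc (q + q)) ys ,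
        ↭-trans (↭-sym (PermP.++-assoc I J _)) (↭-trans (++⁺ʳ _ π) (↭-reflexive (ListP.take++drop≡id (suc (q + q)) ys))) , rest

    record Block : Set where
      constructor mkBlock
      field
        elems    : List X
        nonempty : elems ≢ []
        zeroΣ    : ZeroΣ elems
    open Block

    flat : List Block → List X
    flat []       = []
    flat (b ∷ bs) = elems b ++ flat bs

    flat-++ : ∀ bs cs → flat (bs ++ cs) ≡ flat bs ++ flat cs
    flat-++ []       cs = refl
    flat-++ (b ∷ bs) cs = trans (cong (elems b ++_) (flat-++ bs cs)) (sym (ListP.++-assoc (elems b) _ _))

    flat-ZeroΣ : ∀ bs → ZeroΣ (flat bs)
    flat-ZeroΣ []       = (p ℕD.∣0) , (p ℕD.∣0)
    flat-ZeroΣ (b ∷ bs) = ZeroΣ-++ {elems b} (zeroΣ b) (flat-ZeroΣ bs)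

    flat-nonempty : ∀ {bs} → bs ≢ [] → flat bs ≢ []
    flat-nonempty {[]}     ne _ = ne refl
    flat-nonempty {b ∷ bs} _  e = nonempty b (ListP.++-conicalˡ (elems b) _ e)

    ProductOnePart : List X → Set
    ProductOnePart W = ∃[ R ] ∃[ V ] (R ++ V ↭ W × R ≢ [] × prodX R ≡ ε)

    flat-middle : ∀ u v w → flat v ++ flat u ++ flat w ↭ flat (u ++ v ++ w)
    flat-middle u v w = ↭-trans (shifts (flat v) (flat u)) (↭-reflexive (sym (trans (flat-++ u (v ++ w)) (cong (flat u ++_) (flat-++ v w)))))

    cancel-prefix : ∀ u v k → prodX (flat (u ++ v)) ≡ pow c k · prodX (flat u) → prodX (flat v) ≡ pow c k
    cancel-prefix u v k e = cancelˡ (prodX (flat u)) (begin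
      prodX (flat u) · prodX (flat v)  ≡⟨ sym (prodX-++ (flat u) (flat v)) ⟩
      prodX (flat u ++ flat v)         ≡⟨ cong prodX (sym (flat-++ u v)) ⟩
      prodX (flat (u ++ v))            ≡⟨ e ⟩
      pow c k · prodX (flat u)         ≡⟨ pow-central* k (flat u) ⟩
      prodX (flat u) · pow c k         ∎)
      where open ≡-Reasoning

    abstract
      collect : ∀ bs → m * p ≤ length bs → ProductOnePart (flat bs)
      collect bs long with u , v , w , refl , ne , _ , eq ← prefix-pigeonhole (λ bs → position (flat bs) (flat-ZeroΣ bs)) bs long =
        flat v , flat u ++ flat w , flat-middle u v w , flat-nonempty ne ,
        cancel-prefix u v 0 (trans (position-≡ eq) (sym (identityˡ _)))

    abstract
      -- The pigeonhole principle yields consecutive blocks with product in ⟨c⟩ only; one full block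
      -- among them allows a reordering with product ε.
      collect-full : ∀ bs → All (Full ∘ elems) bs → m ≤ length bs → ProductOnePart (flat bs)
      collect-full bs full long with prefix-pigeonhole (λ bs → coset (flat bs) (flat-ZeroΣ bs)) bs long
      ... | u , [] , w , _ , ne , _ = ⊥-elim (ne refl)
      ... | u , v@(b ∷ v′) , w , refl , ne , _ , eq
        with k , e ← coset-≡ eq
        with full-b ∷ _ ← AllP.++⁻ʳ u full
        with T , π , e′ ← Full-product-one (Full-++ (flat v′) full-b) (k , cancel-prefix u v k e)
        = T , flat u ++ flat w , ↭-trans (++⁺ʳ _ π) (flat-middle u v w) ,
          (λ { refl → flat-nonempty ne (PermP.↭-empty-inv (↭-sym π)) }) , e′

    -- p² + 2p − 2
    K : ℕ
    K = q * q + 4 * q + 1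

    m≥1 : 1 ≤ m
    m≥1 = ℕP.≤-trans (s≤s z≤n) (FinP.toℕ<n (coset [] ((p ℕD.∣0) , (p ℕD.∣0))))

    -- S short and L full blocks with S + L ≤ m p - 1 and L ≤ m - 1 use at most p (m p - 1) + q (m -
    -- 1) elements. Of at least K m - q elements there remain q m + p, and this is at least 2q + 1
    -- because m ≥ 1.
    room : ∀ k L S r → suc k + (L + S) ≡ m * p → L < m → K * m ≤ r + p * S + (p + q) * L + q → suc (q + q) ≤ r
    room k L S r count L<m big = ℕP.+-cancelʳ-≤ (q * m * (q + 3) + m) _ _ (begin
      suc (q + q) + (q * m * (q + 3) + m)              ≡⟨ lemma₁ q (q * m * (q + 3) + m) ⟩
      q * 1 + (q * m * (q + 3) + m) + p * 1             ≤⟨ ℕP.+-mono-≤ (ℕP.+-monoˡ-≤ (q * m * (q + 3) + m) (ℕP.*-monoʳ-≤ q m≥1)) (ℕP.*-monoʳ-≤ p (s≤s z≤n)) ⟩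
      q * m + (q * m * (q + 3) + m) + p * suc k         ≡⟨ cong (λ z → z + p * suc k) (lemma₂ q m) ⟩
      K * m + p * suc k                                 ≤⟨ ℕP.+-monoˡ-≤ (p * suc k) big ⟩
      r + p * S + (p + q) * L + q + p * suc k           ≡⟨ lemma₃ r q S L (suc k) ⟩
      r + p * (suc k + (L + S)) + q * suc L             ≡⟨ cong (λ z → r + p * z + q * suc L) count ⟩
      r + p * (m * p) + q * suc L                       ≤⟨ ℕP.+-monoʳ-≤ (r + p * (m * p)) (ℕP.*-monoʳ-≤ q L<m) ⟩
      r + p * (m * p) + q * m                           ≡⟨ lemma₄ r q m ⟩
      r + (q * m * (q + 3) + m)                         ∎)
      where
      open ℕP.≤-Reasoning
      lemma₁ : ∀ q e → suc (q + q) + e ≡ q * 1 + e + suc q * 1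
      lemma₁ = ℕS.solve-∀
      lemma₂ : ∀ q m → q * m + (q * m * (q + 3) + m) ≡ (q * q + 4 * q + 1) * m
      lemma₂ = ℕS.solve-∀
      lemma₃ : ∀ r q S L k → r + suc q * S + (suc q + q) * L + q + suc q * k ≡ r + suc q * (k + (L + S)) + q * suc L
      lemma₃ = ℕS.solve-∀
      lemma₄ : ∀ r q m → r + suc q * (m * suc q) + q * m ≡ r + (q * m * (q + 3) + m)
      lemma₄ = ℕS.solve-∀

    ProductOnePart-↭ : ∀ {W W′} → W ↭ W′ → ProductOnePart W → ProductOnePart W′
    ProductOnePart-↭ π (R , V , ρ , rest) = R , V , ↭-trans ρ π , rest

    ProductOnePart-++ : ∀ {W} Z → ProductOnePart W → ProductOnePart (W ++ Z)
    ProductOnePart-++ Z (R , V , ρ , rest) = R , V ++ Z , ↭-trans (↭-sym (PermP.++-assoc R V Z)) (++⁺ʳ Z ρ) , rest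

    short-bound : ∀ {I J rest : List X} S → I ++ J ↭ rest → length I ≤ p → length rest + p * S ≤ length J + p * suc S
    short-bound {I} {J} {rest} S π len = begin
      length rest + p * S            ≡⟨ cong (λ z → z + p * S) (trans (sym (↭-length π)) (ListP.length-++ I)) ⟩
      length I + length J + p * S    ≤⟨ ℕP.+-monoˡ-≤ (p * S) (ℕP.+-monoˡ-≤ (length J) len) ⟩
      p + length J + p * S           ≡⟨ rearrange-short p (length J) S ⟩
      length J + p * suc S           ∎
      where open ℕP.≤-Reasoning

    long-bound : ∀ {I J rest : List X} S L → I ++ J ↭ rest → length I ≤ suc (q + q) →
      length rest + p * S + (p + q) * L ≤ length J + p * S + (p + q) * suc L
    long-bound {I} {J} {rest} S L π len = begin
      length rest + p * S + (p + q) * L               ≡⟨ cong (λ z → z + p * S + (p + q) * L) (trans (sym (↭-length π)) (ListP.length-++ I)) ⟩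
      length I + length J + p * S + (p + q) * L       ≤⟨ ℕP.+-monoˡ-≤ ((p + q) * L) (ℕP.+-monoˡ-≤ (p * S) (ℕP.+-monoˡ-≤ (length J) len)) ⟩
      p + q + length J + p * S + (p + q) * L          ≡⟨ rearrange-long (p + q) (length J) (p * S) L ⟩
      length J + p * S + (p + q) * suc L              ∎
      where open ℕP.≤-Reasoning

    -- Blocks with (s , t)-sum zero are removed until there are m full ones, where only the
    -- product modulo ⟨c⟩ matters, or m p blocks altogether.
    abstract
      extract : ∀ k longs shorts rest → All (Full ∘ elems) longs → k + (length longs + length shorts) ≡ m * p →
        K * m ≤ length rest + p * length shorts + (p + q) * length longs + q →
        ProductOnePart (flat longs ++ flat shorts ++ rest)
      extract-block : ∀ k longs shorts rest → All (Full ∘ elems) longs → suc k + (length longs + length shorts) ≡ m * p →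
        K * m ≤ length rest + p * length shorts + (p + q) * length longs + q → BlockOf rest →
        ProductOnePart (flat longs ++ flat shorts ++ rest)

      extract k longs shorts rest full count big with m ℕP.≤? length longs
      ... | yes m≤L = ProductOnePart-++ _ (collect-full longs full m≤L)
      extract zero longs shorts rest full count big | no _ =
        ProductOnePart-↭ (↭-reflexive (trans (cong (_++ rest) (flat-++ longs shorts)) (ListP.++-assoc (flat longs) _ _)))
          (ProductOnePart-++ rest (collect (longs ++ shorts) (ℕP.≤-reflexive (trans (sym count) (sym (ListP.length-++ longs))))))
      extract (suc k) longs shorts rest full count big | no m≰L =
        extract-block k longs shorts rest full count big
          (block rest (room k (length longs) (length shorts) (length rest) count (ℕP.≰⇒> m≰L) big))

      extract-block k longs shorts rest full count big (I , J , π , ne , z , len , inj₁ len-p) =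
        ProductOnePart-↭ (++⁺ˡ (flat longs) (↭-trans (PermP.++-assoc I (flat shorts) J) (↭-trans (shifts I (flat shorts)) (++⁺ˡ (flat shorts) π))))
          (extract k longs (mkBlock I ne z ∷ shorts) J full
            (trans (count-short k (length longs) (length shorts)) count)
            (ℕP.≤-trans big (ℕP.+-monoˡ-≤ q (ℕP.+-monoˡ-≤ ((p + q) * length longs) (short-bound {I} (length shorts) π len-p)))))
      extract-block k longs shorts rest full count big (I , J , π , ne , z , len , inj₂ full-I) =
        ProductOnePart-↭ (↭-trans (PermP.++-assoc I (flat longs) _) (↭-trans (shifts I (flat longs))
            (++⁺ˡ (flat longs) (↭-trans (shifts I (flat shorts)) (++⁺ˡ (flat shorts) π)))))
          (extract k (mkBlock I ne z ∷ longs) shorts J (full-I ∷ full)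
            (trans (count-long k (length longs) (length shorts)) count)
            (ℕP.≤-trans big (ℕP.+-monoˡ-≤ q (long-bound {I} (length shorts) (length longs) π len))))

    -- The slack q is the price of T: a sequence strictly longer than K m still has K m - q elements
    -- after p = q + 1 of them are set aside.
    product-one-part : ∀ W → K * m ≤ length W + q → ProductOnePart W
    product-one-part W big = extract (m * p) [] [] W [] (ℕP.+-identityʳ _) (subst (K * m ≤_) (lemma (length W) q) big)
      where
      lemma : ∀ l q → l + q ≡ l + suc q * 0 + (suc q + q) * 0 + q
      lemma = ℕS.solve-∀

    split-central : ∀ xs → ∃[ as ] ∃[ bs ] (as ++ bs ↭ xs × All NC as × All (Zero ∘ vec) bs × prodX xs ≡ prodX bs · prodX as)
    split-central [] = [] , [] , ↭-refl , [] , [] , sym (identityˡ _)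
    split-central (x ∷ xs) with Zero? (vec x) | split-central xs
    ... | yes z | as , bs , π , ncs , zs , e =
      as , x ∷ bs , ↭-trans (shift x as bs) (prep x π) , ncs , z ∷ zs , trans (cong (val x ·_) e) (sym (assoc _ _ _))
    ... | no nc | as , bs , π , ncs , zs , e =
      x ∷ as , bs , prep x π , nc ∷ ncs , zs , trans (cong (val x ·_) e) (move bs zs (prodX as))
      where
      open ≡-Reasoning
      move : ∀ bs → All (Zero ∘ vec) bs → ∀ w → val x · prodX bs · w ≡ prodX bs · val x · w
      move [] [] w = trans (cong (val x ·_) (identityˡ w)) (sym (identityˡ _))
      move (b ∷ bs) (z ∷ zs) w = begin
        val x · (val b · prodX bs) · w    ≡⟨ cong (val x ·_) (assoc _ _ _) ⟩
        val x · val b · prodX bs · w      ≡⟨ parallel-swap b x (zero-parallel b x z) _ ⟨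
        val b · val x · prodX bs · w      ≡⟨ cong (val b ·_) (move bs zs w) ⟩
        val b · prodX bs · val x · w      ≡⟨ assoc _ _ _ ⟨
        (val b · prodX bs) · val x · w    ∎

    Splits : List X → Set
    Splits hs = ∃[ U ] ∃[ V ] (U ++ V ↭ hs × U ≢ [] × V ≢ [] × prodX U ≡ ε × prodX V ≡ ε)

    drop-identity : ∀ R V {z} → prodX R ≡ ε → prodX (R ++ V) ≡ z → prodX V ≡ z
    drop-identity R V e e′ = trans (sym (identityˡ _)) (trans (cong (_· prodX V) (sym e)) (trans (sym (prodX-++ R V)) e′))

    -- If the order is irrelevant, the complement of a product-one part has product one by itself.
    -- The part is sought in xs, so that x keeps the complement nonempty.
    splits-commuting : ∀ x xs → (∀ {ys} → ys ↭ x ∷ xs → prodX ys ≡ prodX (x ∷ xs)) →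
      K * m < length (x ∷ xs) → prodX (x ∷ xs) ≡ ε → Splits (x ∷ xs)
    splits-commuting x xs comm long e
      with R , V , π , ne , eR ← product-one-part xs (ℕP.≤-trans (ℕ.s≤s⁻¹ long) (ℕP.m≤m+n _ q))
      with ρ ← ↭-trans (shift x R V) (prep x π)
      = R , x ∷ V , ρ , ne , (λ ()) , eR , drop-identity R (x ∷ V) eR (trans (comm ρ) e)

    splits-full : ∀ hs → FullPart hs → K * m < length hs → prodX hs ≡ ε → Splits hs
    splits-full hs (T , W , π , full , lenT) long e
      with len-W ← trans (sym (↭-length π)) (trans (ListP.length-++ T) (trans (cong (λ z → z + length W) lenT) (cong suc (ℕP.+-comm q (length W)))))
      with R , V , ρ , ne , eR ← product-one-part W (ℕ.s≤s⁻¹ (subst (K * m <_) len-W long))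
      with σ ← ↭-trans (shifts R T) (↭-trans (++⁺ˡ T ρ) π)
      with k , e′ ← prodX-↭-mod σ
      with V′ , τ , eV ← Full-product-one (Full-++ V full) (k , drop-identity R (T ++ V) eR (trans e′ (trans (cong (pow c k ·_) e) (identityʳ _))))
      = R , V′ , ↭-trans (++⁺ˡ R τ) σ , ne , nonempty-V′ (↭-length τ) , eR , eV
      where
      nonempty-V′ : ∀ {V′ V} → length V′ ≡ length (T ++ V) → V′ ≢ []
      nonempty-V′ {V = V} l refl with () ← trans l (trans (ListP.length-++ T) (cong (λ z → z + length V) lenT))

    singles : ∀ bs → All (Zero ∘ vec) bs → ∃[ Bs ] (flat Bs ≡ bs × length Bs ≡ length bs)
    singles [] [] = [] , refl , refl
    singles (b ∷ bs) (z ∷ zs) with Bs , e , l ← singles bs zs =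
      mkBlock (b ∷ []) (λ ()) (Zero⇒ZeroΣ z) ∷ Bs , cong (b ∷_) e , cong suc l

    -- The product-one part consists of central elements, and the noncentral ones keep the
    -- complement nonempty. Their order is left unchanged, so no fullness enters.
    splits-central : ∀ hs as bs → as ++ bs ↭ hs → as ≢ [] → All (Zero ∘ vec) bs → prodX hs ≡ prodX bs · prodX as →
      m * p ≤ length bs → prodX hs ≡ ε → Splits hs
    splits-central hs [] bs π as≢[] zs e long eh = ⊥-elim (as≢[] refl)
    splits-central hs as@(a ∷ as′) bs π as≢[] zs e long eh
      with Bs , refl , l ← singles bs zs
      with R , V , ρ , ne , eR ← collect Bs (subst (m * p ≤_) (sym l) long)
      = R , V ++ as , ↭-trans (↭-sym (PermP.++-assoc R V as)) (↭-trans (++⁺ʳ as ρ) (↭-trans (++-comm bs as) π)) , ne ,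
        (λ h → as≢[] (ListP.++-conicalʳ V as h)) , eR ,
        trans (prodX-++ V as) (trans (cong (_· prodX as) (drop-identity R V eR (commute-zeros ρ))) (trans (sym e) eh))
      where
      commute-zeros : ∀ {ys} → ys ↭ bs → prodX ys ≡ prodX bs
      commute-zeros σ = prodX-resp-↭ _≡_ refl trans (λ x → cong (val x ·_))
        (λ x y zx zy → parallel-swap x y (zero-parallel x y zx)) σ (All-resp-↭ (↭-sym σ) zs)

    splits : ∀ hs → K * m < length hs → prodX hs ≡ ε → Splits hs
    splits [] () e
    splits hs@(h ∷ hs′) long e with split-central hs
    ... | [] , bs , π , _ , zs , _ = splits-commuting h hs′
          (λ {ys} σ → prodX-resp-↭ _≡_ refl trans (λ x → cong (val x ·_))
             (λ x y zx zy → parallel-swap x y (zero-parallel x y zx)) σ (All-resp-↭ (↭-trans π (↭-sym σ)) zs)) long e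
    ... | as@(a ∷ as′) , bs , π , ncs , zs , e′ with p ℕP.<? length as
    ...   | no p≮ = splits-central hs as bs π (λ ()) zs e′ (central-room q m (length as) (length bs) m≥1 (ℕP.≮⇒≥ p≮)
                      (subst (K * m <_) (trans (sym (↭-length π)) (ListP.length-++ as)) long)) e
    ...   | yes p< with full-or-parallel a as′ ncs p<
    ...     | inj₁ (T , R , ρ , full , l) =
                splits-full hs (T , R ++ bs , ↭-trans (↭-sym (PermP.++-assoc T R bs)) (↭-trans (++⁺ʳ bs ρ) π) , full , l) long e
    ...     | inj₂ par = splits-commuting h hs′
                (λ {ys} σ → prodX-↭-parallel (All.head ncs) (All-resp-↭ (↭-trans π (↭-sym σ))
                  (AllP.++⁺ par (All.map (λ {b} z → p∣det-swap (vec b) (vec a) (zero-parallel b a z)) zs))) σ) long e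

-- The subgroup H

∤⇒coprime : ∀ {p k} → Prime p → ¬ (p ∣ k) → Coprime p k
∤⇒coprime p-prime p∤k (d∣p , d∣k) with prime⇒irreducible p-prime d∣p
... | inj₁ d≡1 = d≡1
... | inj₂ refl = ⊥-elim (p∤k d∣k)

module _ {A : Set} {_~_ : A → A → Set} (_~?_ : ∀ x y → Dec (x ~ y)) (~-sym : ∀ {x y} → x ~ y → y ~ x) where

  representatives : ∀ zs → ∃[ rs ] (All (_∈ zs) rs × (∀ {z} → z ∈ zs → z ~ z → Any (_~ z) rs) × AllPairs (λ r r′ → ¬ (r ~ r′)) rs)
  representatives [] = [] , [] , (λ ()) , []
  representatives (z ∷ zs) with representatives zs
  ... | rs , mem , cover , distinct with Any.any? (_~? z) rs
  ...   | yes old = rs , All.map there mem , (λ { (here refl) _ → old ; (there i) → cover i }) , distinct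
  ...   | no new = z ∷ rs , here refl ∷ All.map there mem , (λ { (here refl) → here ; (there i) r → there (cover i r) }) ,
                   AllP.¬Any⇒All¬ rs (new ∘ Any.map ~-sym) ∷ distinct

AllPairs-lookup : ∀ {A : Set} {R : A → A → Set} {xs} → (∀ {x y} → R x y → R y x) → AllPairs R xs →
  ∀ i j → i ≢ j → R (List.lookup xs i) (List.lookup xs j)
AllPairs-lookup R-sym (ps ∷ _) Fin.zero Fin.zero i≢j = ⊥-elim (i≢j refl)
AllPairs-lookup R-sym (ps ∷ _) Fin.zero (Fin.suc j) i≢j = All.lookup ps (∈-lookup j)
AllPairs-lookup R-sym (ps ∷ _) (Fin.suc i) Fin.zero i≢j = R-sym (All.lookup ps (∈-lookup i))
AllPairs-lookup R-sym (_ ∷ pss) (Fin.suc i) (Fin.suc j) i≢j = AllPairs-lookup R-sym pss i j (i≢j ∘ cong Fin.suc)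

exponents₁ : ∀ s t k → s * 1 + (t * 0 + (k * 0 + 0)) ≡ s
exponents₁ = ℕS.solve-∀

exponents₂ : ∀ s t k → s * 0 + (t * 1 + (k * 0 + 0)) ≡ t
exponents₂ = ℕS.solve-∀

module Heisenberg (q : ℕ) (p-prime : Prime (suc q))
  {n : ℕ} (_∙_ : Op₂ (Fin n)) (ε : Fin n) (_⁻¹ : Op₁ (Fin n)) (isGroup : IsGroup _≡_ _∙_ ε _⁻¹) where

  open Splitting q p-prime _∙_ ε _⁻¹ isGroup
  open GroupFacts _∙_ ε _⁻¹ isGroup
  open Mod-p q p-prime

  record CommutatorPair : Set where
    field
      a g c   : Fin n
      a·g     : a · g ≡ c · g · a
      ca      : Commute c a
      cg      : Commute c g
      c-order : pow c p ≡ ε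
      c≢ε     : c ≢ ε

  module Subgroup (pair : CommutatorPair) where
    open CommutatorPair pair
    open Order c q c-order

    -- H is the subgroup of the x commuting with N = C(a) ∩ C(g) for which [x , g] and [a , x]
    -- are powers of c; its centre is Z₀ = Z(N), and H = ⟨a , g⟩ Z₀.
    N : Fin n → Set
    N y = Commute y a × Commute y g

    CN : Fin n → Set
    CN x = ∀ y → N y → Commute x y

    record H (x : Fin n) (s t : ℕ) : Set where
      constructor mkH
      field
        centralises : CN x
        twist-g     : x · g ≡ pow c s · g · x
        twist-a     : a · x ≡ pow c t · x · a

    N-c : N c
    N-c = ca , cg

    H-c : ∀ {x s t} k → H x s t → Commute (pow c k) x
    H-c k (mkH cn _ _) = commute-pow k (sym (cn c N-c))

    CN-· : ∀ {x y} → CN x → CN y → CN (x · y)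
    CN-· f h z nz = commute-· (f z nz) (h z nz)

    H-ε : H ε 0 0
    H-ε = mkH (λ y _ → commute-ε) (trans (identityˡ g) (sym (trans (identityˡ _) (identityʳ g))))
          (trans (identityʳ a) (sym (trans (identityˡ _) (identityˡ a))))

    H-· : ∀ {x y s t s′ t′} → H x s t → H y s′ t′ → H (x · y) (s + s′) (t + t′)
    H-· {x} {y} {s} {t} {s′} {t′} hx@(mkH f xg ax) hy@(mkH h yg ay) = mkH (CN-· f h) (begin
        (x · y) · g                          ≡⟨ assoc _ _ _ ⟩
        x · y · g                            ≡⟨ cong (x ·_) yg ⟩
        x · pow c s′ · g · y                 ≡⟨ head-≡ (sym (H-c s′ hx)) _ ⟩
        pow c s′ · x · g · y                 ≡⟨ cong (pow c s′ ·_) (sym (assoc _ _ _)) ⟩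
        pow c s′ · (x · g) · y               ≡⟨ cong (λ w → pow c s′ · w · y) xg ⟩
        pow c s′ · (pow c s · g · x) · y     ≡⟨ cong (pow c s′ ·_) (trans (assoc _ _ _) (cong (pow c s ·_) (assoc _ _ _))) ⟩
        pow c s′ · pow c s · g · x · y       ≡⟨ sym (assoc _ _ _) ⟩
        (pow c s′ · pow c s) · g · x · y     ≡⟨ cong (_· (g · x · y)) (trans (sym (pow-+ c s′ s)) (cong (pow c) (ℕP.+-comm s′ s))) ⟩
        pow c (s + s′) · g · x · y           ∎) (begin
        a · x · y                            ≡⟨ sym (assoc _ _ _) ⟩
        (a · x) · y                          ≡⟨ cong (_· y) ax ⟩
        (pow c t · x · a) · y                ≡⟨ trans (assoc _ _ _) (cong (pow c t ·_) (assoc _ _ _)) ⟩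
        pow c t · x · a · y                  ≡⟨ cong (λ w → pow c t · x · w) ay ⟩
        pow c t · x · pow c t′ · y · a       ≡⟨ cong (pow c t ·_) (head-≡ (sym (H-c t′ hx)) _) ⟩
        pow c t · pow c t′ · x · y · a       ≡⟨ sym (assoc _ _ _) ⟩
        (pow c t · pow c t′) · x · y · a     ≡⟨ cong (_· (x · y · a)) (sym (pow-+ c t t′)) ⟩
        pow c (t + t′) · x · y · a           ≡⟨ cong (pow c (t + t′) ·_) (sym (assoc _ _ _)) ⟩
        pow c (t + t′) · (x · y) · a         ∎)
      where open ≡-Reasoning

    H-⁻¹ : ∀ {x s t} → H x s t → H (x ⁻¹) (q * s) (q * t)
    H-⁻¹ {x} {s} {t} hx@(mkH f xg ax) = mkH (λ y ny → commute-⁻¹ (f y ny)) (cancelˡ x (begin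
        x · x ⁻¹ · g                           ≡⟨ cancel-invˡ x g ⟩
        g                                      ≡⟨ sym (pow-inv s g) ⟩
        pow c (q * s) · pow c s · g            ≡⟨ cong (λ w → pow c (q * s) · pow c s · w) (trans (sym (identityʳ g)) (cong (g ·_) (sym (inverseʳ x)))) ⟩
        pow c (q * s) · pow c s · g · x · x ⁻¹ ≡⟨ cong (pow c (q * s) ·_) (sym (trans (assoc _ _ _) (cong (pow c s ·_) (assoc _ _ _)))) ⟩
        pow c (q * s) · (pow c s · g · x) · x ⁻¹ ≡⟨ cong (λ w → pow c (q * s) · w · x ⁻¹) (sym xg) ⟩
        pow c (q * s) · (x · g) · x ⁻¹         ≡⟨ cong (pow c (q * s) ·_) (assoc _ _ _) ⟩
        pow c (q * s) · x · g · x ⁻¹           ≡⟨ head-≡ (H-c (q * s) hx) _ ⟩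
        x · pow c (q * s) · g · x ⁻¹           ∎)) (cancelˡ x (begin
        x · a · x ⁻¹                           ≡⟨ sym (pow-inv t _) ⟩
        pow c (q * t) · pow c t · x · a · x ⁻¹ ≡⟨ cong (pow c (q * t) ·_) (sym (trans (assoc _ _ _) (cong (pow c t ·_) (assoc _ _ _)))) ⟩
        pow c (q * t) · (pow c t · x · a) · x ⁻¹ ≡⟨ cong (λ w → pow c (q * t) · w · x ⁻¹) (sym ax) ⟩
        pow c (q * t) · (a · x) · x ⁻¹         ≡⟨ cong (pow c (q * t) ·_) (trans (assoc _ _ _) (trans (cong (a ·_) (inverseʳ x)) (identityʳ a))) ⟩
        pow c (q * t) · a                      ≡⟨ cong (pow c (q * t) ·_) (sym (cancel-invˡ x a)) ⟩
        pow c (q * t) · x · x ⁻¹ · a           ≡⟨ head-≡ (H-c (q * t) hx) _ ⟩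
        x · pow c (q * t) · x ⁻¹ · a           ∎))
      where open ≡-Reasoning

    H-pow : ∀ {x s t} k → H x s t → H (pow x k) (k * s) (k * t)
    H-pow zero    hx = H-ε
    H-pow (suc k) hx = H-· hx (H-pow k hx)

    twist : ∀ k j → pow a k · pow g j ≡ pow c (k * j) · pow g j · pow a k
    twist k j = pow-twistʳ k a·g ca cg j

    pow-1 : ∀ x → pow x 1 ≡ x
    pow-1 x = identityʳ x

    H-a : H a 1 0
    H-a = mkH (λ y (ya , _) → sym ya) (trans a·g (cong (_· (g · a)) (sym (pow-1 c)))) (sym (identityˡ _))

    H-g : H g 0 1
    H-g = mkH (λ y (_ , yg) → sym yg) (sym (identityˡ _)) (trans a·g (cong (_· (g · a)) (sym (pow-1 c))))

    Z₀ : Fin n → Set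
    Z₀ x = N x × CN x

    Z₀⇒H : ∀ {x} → Z₀ x → H x 0 0
    Z₀⇒H ((xa , xg) , f) = mkH f (trans xg (sym (identityˡ _))) (trans (sym xa) (sym (identityˡ _)))

    -- As the commutator of a and g, c commutes with everything that commutes with both.
    Z₀-c : Z₀ c
    Z₀-c = N-c , λ y (ya , yg) → cancelʳ (g · a) (begin
        (c · y) · g · a    ≡⟨ assoc _ _ _ ⟩
        c · y · g · a      ≡⟨ cong (c ·_) (commute-· (sym yg) (sym ya)) ⟨
        c · (g · a) · y    ≡⟨ sym (assoc _ _ _) ⟩
        (c · g · a) · y    ≡⟨ cong (_· y) a·g ⟨
        (a · g) · y        ≡⟨ commute-· (sym ya) (sym yg) ⟩
        y · a · g          ≡⟨ cong (y ·_) a·g ⟩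
        y · c · g · a      ≡⟨ sym (assoc _ _ _) ⟩
        (y · c) · g · a    ∎)
      where open ≡-Reasoning

    pow-∣ : ∀ {k} → p ∣ k → pow c k ≡ ε
    pow-∣ (divides r refl) = trans (cong (pow c) (ℕP.*-comm r p)) (pow-mod 0 r)

    H-kernel : ∀ {x s t} → H x s t → p ∣ s → p ∣ t → Z₀ x
    H-kernel {x} (mkH f xg ax) ds dt =
      (sym (trans ax (trans (cong (_· (x · a)) (pow-∣ dt)) (identityˡ _))) ,
       trans xg (trans (cong (_· (g · x)) (pow-∣ ds)) (identityˡ _))) , f

    -- Write x = a^s g^t z. Comparing the twists of x with those of a^s g^t shows z ∈ N, and y
    -- commutes with N; so only the powers of a and g contribute to the commutator.
    H-commutator : ∀ {x y s t s′ t′} → H x s t → H y s′ t′ → pow c (s′ * t) · x · y ≡ pow c (s * t′) · y · x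
    H-commutator {x} {y} {s} {t} {s′} {t′} hx@(mkH f xg ax) hy@(mkH h yg ay) = begin
      pow c (s′ * t) · x · y                          ≡⟨ cong (λ w → pow c (s′ * t) · w · y) (sym x≡) ⟩
      pow c (s′ * t) · (A · G · z) · y                ≡⟨ cong (pow c (s′ * t) ·_) (trans (assoc _ _ _) (cong (A ·_) (assoc _ _ _))) ⟩
      pow c (s′ * t) · A · G · z · y                  ≡⟨ cong (λ w → pow c (s′ * t) · A · G · w) (sym (h z Nz)) ⟩
      pow c (s′ * t) · A · G · y · z                  ≡⟨ head-≡ (commute-pow (s′ * t) (sym (commute-pow s (sym ca)))) _ ⟩
      A · pow c (s′ * t) · G · y · z                  ≡⟨ cong (A ·_) (step-g z) ⟩
      A · y · G · z                                   ≡⟨ step-a (G · z) ⟩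
      pow c (s * t′) · y · A · G · z                  ≡⟨ cong (λ w → pow c (s * t′) · y · w) x≡ ⟩
      pow c (s * t′) · y · x                          ∎
      where
      open ≡-Reasoning
      A = pow a s
      G = pow g t
      z = G ⁻¹ · A ⁻¹ · x
      x≡ : A · G · z ≡ x
      x≡ = trans (cong (A ·_) (cancel-invˡ G _)) (cancel-invˡ A x)
      A-g : ∀ w → A · g · w ≡ pow c s · g · A · w
      A-g w = begin
        A · g · w                ≡⟨ sym (assoc _ _ _) ⟩
        (A · g) · w              ≡⟨ cong (_· w) e ⟩
        (pow c s · g · A) · w    ≡⟨ trans (assoc _ _ _) (cong (pow c s ·_) (assoc _ _ _)) ⟩
        pow c s · g · A · w      ∎
        where
        e : A · g ≡ pow c s · g · A
        e = trans (cong (A ·_) (sym (pow-1 g))) (trans (twist s 1) (cong₂ (λ i w → pow c i · w · A) (ℕP.*-identityʳ s) (pow-1 g)))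
      a-G : ∀ w → a · G · w ≡ pow c t · G · a · w
      a-G w = begin
        a · G · w                ≡⟨ sym (assoc _ _ _) ⟩
        (a · G) · w              ≡⟨ cong (_· w) e ⟩
        (pow c t · G · a) · w    ≡⟨ trans (assoc _ _ _) (cong (pow c t ·_) (assoc _ _ _)) ⟩
        pow c t · G · a · w      ∎
        where
        e : a · G ≡ pow c t · G · a
        e = trans (cong (_· G) (sym (pow-1 a))) (trans (twist 1 t) (cong₂ (λ i w → pow c i · G · w) (ℕP.*-identityˡ t) (pow-1 a)))
      zg : Commute z g
      zg = cancelˡ G (cancelˡ A (begin
        A · G · z · g            ≡⟨ sym (trans (assoc _ _ _) (cong (A ·_) (assoc _ _ _))) ⟩
        (A · G · z) · g          ≡⟨ cong (_· g) x≡ ⟩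
        x · g                    ≡⟨ xg ⟩
        pow c s · g · x          ≡⟨ cong (λ w → pow c s · g · w) (sym x≡) ⟩
        pow c s · g · A · G · z  ≡⟨ sym (A-g (G · z)) ⟩
        A · g · G · z            ≡⟨ cong (A ·_) (head-≡ (sym (pow-· g t)) z) ⟩
        A · G · g · z            ∎))
      za : Commute z a
      za = sym (cancelˡ G (cancelˡ A (cancelˡ (pow c t) (begin
        pow c t · A · G · a · z          ≡⟨ head-≡ (commute-pow t (sym (commute-pow s (sym ca)))) _ ⟩
        A · pow c t · G · a · z          ≡⟨ cong (A ·_) (sym (a-G z)) ⟩
        A · a · G · z                    ≡⟨ head-≡ (pow-· a s) _ ⟩
        a · A · G · z                    ≡⟨ cong (a ·_) x≡ ⟩
        a · x                            ≡⟨ ax ⟩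
        pow c t · x · a                  ≡⟨ cong (λ w → pow c t · w · a) (sym x≡) ⟩
        pow c t · (A · G · z) · a        ≡⟨ cong (pow c t ·_) (trans (assoc _ _ _) (cong (A ·_) (assoc _ _ _))) ⟩
        pow c t · A · G · z · a          ∎))))
      Nz : N z
      Nz = za , zg
      cy : Commute c y
      cy = sym (h c N-c)
      step-g : ∀ w → pow c (s′ * t) · G · y · w ≡ y · G · w
      step-g w = begin
        pow c (s′ * t) · G · y · w      ≡⟨ cong (pow c (s′ * t) ·_) (sym (assoc _ _ _)) ⟩
        pow c (s′ * t) · (G · y) · w    ≡⟨ sym (assoc _ _ _) ⟩
        (pow c (s′ * t) · G · y) · w    ≡⟨ cong (_· w) e ⟩
        (y · G) · w                     ≡⟨ assoc _ _ _ ⟩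
        y · G · w                       ∎
        where
        e : pow c (s′ * t) · G · y ≡ y · G
        e = sym (trans (cong (_· G) (sym (pow-1 y))) (trans (pow-twistʳ 1 yg (commute-pow s′ cy) (commute-pow s′ cg) t)
          (cong₂ (λ i w → i · G · w) (trans (cong (pow (pow c s′)) (ℕP.*-identityˡ t)) (trans (sym (pow-* c t s′)) (cong (pow c) (ℕP.*-comm t s′)))) (pow-1 y))))
      step-a : ∀ w → A · y · w ≡ pow c (s * t′) · y · A · w
      step-a w = begin
        A · y · w                          ≡⟨ sym (assoc _ _ _) ⟩
        (A · y) · w                        ≡⟨ cong (_· w) e ⟩
        (pow c (s * t′) · y · A) · w       ≡⟨ trans (assoc _ _ _) (cong (pow c (s * t′) ·_) (assoc _ _ _)) ⟩
        pow c (s * t′) · y · A · w         ∎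
        where
        e : A · y ≡ pow c (s * t′) · y · A
        e = trans (cong (A ·_) (sym (pow-1 y))) (trans (pow-twistʳ s ay (commute-pow t′ ca) (commute-pow t′ cy) 1)
          (cong₂ (λ i w → i · w · A) (trans (cong (pow (pow c t′)) (ℕP.*-identityʳ s)) (sym (pow-* c s t′))) (pow-1 y)))

    -- If p did not divide k, a Bézout identity for p and k would turn c^p = c^k = ε into c = ε.
    pow-order : ∀ k → pow c k ≡ ε → p ∣ k
    pow-order k e with p ∣? k
    ... | yes d = d
    ... | no p∤k = ⊥-elim (c≢ε (bezout (coprime-Bézout (∤⇒coprime p-prime p∤k))))
      where
      bezout : GCD.Bézout.Identity 1 p k → c ≡ ε
      bezout (GCD.Bézout.+- x y eq) = trans (sym (pow-1 c)) (trans (sym (identityʳ _)) (trans (cong (pow c 1 ·_) (sym (trans (pow-* c y k) (trans (cong (λ w → pow w y) e) (pow-ε y)))))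
        (trans (sym (pow-+ c 1 (y * k))) (trans (cong (pow c) eq) (pow-∣ (divides x refl))))))
      bezout (GCD.Bézout.-+ x y eq) = trans (sym (pow-1 c)) (trans (sym (identityʳ _)) (trans (cong (pow c 1 ·_) (sym (pow-∣ (divides x refl))))
        (trans (sym (pow-+ c 1 (x * p))) (trans (cong (pow c) eq) (trans (pow-* c y k) (trans (cong (λ w → pow w y) e) (pow-ε y)))))))

    open Exact (λ j j<q e → ℕP.<⇒≱ (s≤s j<q) (ℕD.∣⇒≤ (pow-order (suc j) e)))

    N? : ∀ y → Dec (N y)
    N? y = ((y · a) FinP.≟ (a · y)) ×-dec ((y · g) FinP.≟ (g · y))

    CN? : ∀ x → Dec (CN x)
    CN? x = FinP.all? (λ y → N? y →-dec ((x · y) FinP.≟ (y · x)))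

    Z₀? : ∀ x → Dec (Z₀ x)
    Z₀? x = N? x ×-dec CN? x

    cosets : ∃[ rs ] (All (_∈ List.filter Z₀? (List.allFin n)) rs ×
      (∀ {z} → z ∈ List.filter Z₀? (List.allFin n) → z ~ z → Any (_~ z) rs) × AllPairs (λ r r′ → ¬ (r ~ r′)) rs)
    cosets = representatives _~?_ ~-sym (List.filter Z₀? (List.allFin n))

    abstract
      rs : List (Fin n)
      rs = proj₁ cosets

      rs-Z₀ : ∀ i → Z₀ (List.lookup rs i)
      rs-Z₀ i = proj₂ (∈-filter⁻ Z₀? {xs = List.allFin n} (All.lookup (proj₁ (proj₂ cosets)) (∈-lookup i)))

      rs-cover : ∀ z → Z₀ z → Any (_~ z) rs
      rs-cover z h = proj₁ (proj₂ (proj₂ cosets)) (∈-filter⁺ Z₀? (∈-allFin z) h) ~-refl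

      rs-distinct : ∀ i j → i ≢ j → ¬ (List.lookup rs i ~ List.lookup rs j)
      rs-distinct = AllPairs-lookup (λ f e → f (~-sym e)) (proj₂ (proj₂ (proj₂ cosets)))

    -- The index of ⟨c⟩ in Z₀, since `rs` holds one representative of each coset.
    m : ℕ
    m = length rs

    -- The exponents are unrestricted natural numbers so that they add along products; `InH` takes
    -- them below p instead, which makes membership decidable.
    X : Set
    X = ∃[ x ] ∃[ s ] ∃[ t ] H x s t

    val : X → Fin n
    val = proj₁

    sX tX : X → ℕ
    sX (_ , s , _) = s
    tX (_ , _ , t , _) = t

    open ZeroSum sX tX using (Σs; Σt)

    H-prod : ∀ xs → H (prod _∙_ ε (map val xs)) (Σs xs) (Σt xs)
    H-prod [] = H-ε
    H-prod ((x , s , t , h) ∷ xs) = H-· h (H-prod xs)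

    cover : ∀ xs → p ∣ Σs xs × p ∣ Σt xs → Any (_~ prod _∙_ ε (map val xs)) rs
    cover xs (ds , dt) = rs-cover _ (H-kernel (H-prod xs) ds dt)

    exponent : ∀ {z} → (i : Any (_~ z) rs) → Fin p
    exponent i = proj₁ (AnyP.lookup-index i)

    cover-≡ : ∀ {z} (i : Any (_~ z) rs) → z ≡ pow c (toℕ (exponent i)) · List.lookup rs (Any.index i)
    cover-≡ i = proj₂ (AnyP.lookup-index i)

    same-coset : ∀ {z w} (i : Any (_~ z) rs) (j : Any (_~ w) rs) → Any.index i ≡ Any.index j → ∃[ k ] w ≡ pow c k · z
    same-coset {z} {w} i j e = f + q * d , (begin
      w                                           ≡⟨ cover-≡ j ⟩
      pow c f · List.lookup rs (Any.index j)      ≡⟨ cong (λ l → pow c f · List.lookup rs l) (sym e) ⟩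
      pow c f · r                                 ≡⟨ cong (pow c f ·_) (sym (pow-inv d r)) ⟩
      pow c f · pow c (q * d) · pow c d · r       ≡⟨ sym (assoc _ _ _) ⟩
      (pow c f · pow c (q * d)) · pow c d · r     ≡⟨ cong₂ _·_ (sym (pow-+ c f (q * d))) (sym (cover-≡ i)) ⟩
      pow c (f + q * d) · z                       ∎)
      where
      open ≡-Reasoning
      d = toℕ (exponent i)
      f = toℕ (exponent j)
      r = List.lookup rs (Any.index i)

    same-position : ∀ {z w} (i : Any (_~ z) rs) (j : Any (_~ w) rs) →
      Fin.combine (Any.index i) (exponent i) ≡ Fin.combine (Any.index j) (exponent j) → w ≡ z
    same-position i j e with e₁ , e₂ ← FinP.combine-injective (Any.index i) (exponent i) (Any.index j) (exponent j) e =
      trans (cover-≡ j) (trans (cong₂ (λ k l → pow c (toℕ k) · List.lookup rs l) (sym e₂) (sym e₁)) (sym (cover-≡ i)))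

    symplectic : Symplectic m
    symplectic = record
      { X          = X
      ; val        = val
      ; s          = sX
      ; t          = tX
      ; c          = c
      ; c-order    = c-order
      ; c-central  = λ (x , s , t , h) → sym (H.centralises h c N-c)
      ; commutator = λ (x , s , t , h) (y , s′ , t′ , h′) → H-commutator h h′
      ; coset      = λ xs z → Any.index (cover xs z)
      ; coset-≡    = λ {xs} {ys} {z} {w} → same-coset (cover xs z) (cover ys w)
      ; position   = λ xs z → Fin.combine (Any.index (cover xs z)) (exponent (cover xs z))
      ; position-≡ = λ {xs} {ys} {z} {w} → same-position (cover xs z) (cover ys w)
      }

    InH : Fin n → Set
    InH x = ∃[ s ] ∃[ t ] H x (toℕ {p} s) (toℕ {p} t)

    H? : ∀ x s t → Dec (H x s t)
    H? x s t = Dec.map′ (λ (f , e , e′) → mkH f e e′) (λ (mkH f e e′) → f , e , e′)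
      (CN? x ×-dec (((x · g) FinP.≟ (pow c s · g · x)) ×-dec ((a · x) FinP.≟ (pow c t · x · a))))

    InH? : ∀ x → Dec (InH x)
    InH? x = FinP.any? (λ s → FinP.any? (λ t → H? x (toℕ s) (toℕ t)))

    H⇒InH : ∀ {x s t} → H x s t → InH x
    H⇒InH {x} {s} {t} (mkH f e e′) with i , eᵢ ← reduce s | j , eⱼ ← reduce t =
      i , j , mkH f (trans e (cong (_· (g · x)) eᵢ)) (trans e′ (cong (_· (x · a)) eⱼ))

    InH-ε : InH ε
    InH-ε = H⇒InH H-ε

    InH-divide : ∀ {x y} → InH x → InH (x · y) → InH y
    InH-divide {x} {y} (_ , _ , hx) (_ , _ , hxy) = subst InH (inv-cancelˡ x y) (H⇒InH (H-· (H-⁻¹ hx) hxy))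

    InH-· : ∀ {x y} → InH x → InH y → InH (x · y)
    InH-· (_ , _ , hx) (_ , _ , hy) = H⇒InH (H-· hx hy)

    -- Normal form in H: powers of a and g, a power of c, and a representative of a coset of ⟨c⟩ in
    -- Z₀, with m p³ parameter values.
    element : Fin m → Fin p → Fin p → Fin p → Fin n
    element i k s t = pow a (toℕ s) · pow g (toℕ t) · pow c (toℕ k) · List.lookup rs i

    H-element : ∀ i k s t → H (element i k s t) (toℕ s) (toℕ t)
    H-element i k s t = subst₂ (H (element i k s t)) (exponents₁ (toℕ s) (toℕ t) (toℕ k)) (exponents₂ (toℕ s) (toℕ t) (toℕ k))
      (H-· (H-pow (toℕ s) H-a) (H-· (H-pow (toℕ t) H-g) (H-· (H-pow (toℕ k) (Z₀⇒H Z₀-c)) (Z₀⇒H (rs-Z₀ i)))))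

    H-unique-s : ∀ {x} (s t s′ t′ : Fin p) → H x (toℕ s) (toℕ t) → H x (toℕ s′) (toℕ t′) → s ≡ s′
    H-unique-s {x} s t s′ t′ (mkH _ e _) (mkH _ e′ _) = powers-injective (cancelʳ (g · x) (trans (sym e) e′))

    H-unique-t : ∀ {x} (s t s′ t′ : Fin p) → H x (toℕ s) (toℕ t) → H x (toℕ s′) (toℕ t′) → t ≡ t′
    H-unique-t {x} s t s′ t′ (mkH _ _ e) (mkH _ _ e′) = powers-injective (cancelʳ (x · a) (trans (sym e) e′))

    pow-~ : ∀ k l {x y} → pow c k · x ≡ pow c l · y → x ~ y
    pow-~ k l {x} {y} e with i , eᵢ ← reduce (q * l + k) = i , (begin
      y                                ≡⟨ sym (pow-inv l y) ⟩
      pow c (q * l) · pow c l · y      ≡⟨ cong (pow c (q * l) ·_) (sym e) ⟩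
      pow c (q * l) · pow c k · x      ≡⟨ sym (assoc _ _ _) ⟩
      (pow c (q * l) · pow c k) · x    ≡⟨ cong (_· x) (trans (sym (pow-+ c (q * l) k)) eᵢ) ⟩
      pow c (toℕ i) · x                ∎)
      where open ≡-Reasoning

    -- The twists with g and a give back the exponents of a and g. After cancellation the coset of
    -- ⟨c⟩ determines i, and then the power of c determines k.
    element-injective : ∀ i k s t i′ k′ s′ t′ → element i k s t ≡ element i′ k′ s′ t′ → i ≡ i′ × k ≡ k′ × s ≡ s′ × t ≡ t′
    element-injective i k s t i′ k′ s′ t′ e
      with refl ← H-unique-s s t s′ t′ (H-element i k s t) (subst (λ x → H x (toℕ s′) (toℕ t′)) (sym e) (H-element i′ k′ s′ t′))
      with refl ← H-unique-t s t s t′ (H-element i k s t) (subst (λ x → H x (toℕ s) (toℕ t′)) (sym e) (H-element i′ k′ s t′))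
      with e′ ← cancelˡ (pow g (toℕ t)) (cancelˡ (pow a (toℕ s)) e)
      with i FinP.≟ i′
    ... | no i≢i′ = ⊥-elim (rs-distinct i i′ i≢i′ (pow-~ (toℕ k) (toℕ k′) e′))
    ... | yes refl = refl , powers-injective (cancelʳ (List.lookup rs i) e′) , refl , refl

    digits : Fin (m * (p * (p * p))) → Fin m × Fin p × Fin p × Fin p
    digits x =
      let i , y = Fin.remQuot {m} (p * (p * p)) x
          k , z = Fin.remQuot {p} (p * p) y
      in i , k , Fin.remQuot {p} p z

    remQuot-injective : ∀ {k} l (x y : Fin (k * l)) → Fin.remQuot {k} l x ≡ Fin.remQuot {k} l y → x ≡ y
    remQuot-injective {k} l x y e = trans (sym (FinP.combine-remQuot {k} l x))
      (trans (cong (λ z → Fin.combine (proj₁ z) (proj₂ z)) e) (FinP.combine-remQuot {k} l y))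

    digits-injective : ∀ x y → digits x ≡ digits y → x ≡ y
    digits-injective x y e = remQuot-injective {m} (p * (p * p)) x y (cong₂ _,_ (cong proj₁ e)
      (remQuot-injective {p} (p * p) _ _ (cong₂ _,_ (cong (proj₁ ∘ proj₂) e)
        (remQuot-injective {p} p _ _ (cong (proj₂ ∘ proj₂) e)))))

    elementOf : Fin m × Fin p × Fin p × Fin p → Fin n
    elementOf (i , k , s , t) = element i k s t

    elementOf-InH : ∀ u → InH (elementOf u)
    elementOf-InH (i , k , s , t) = H⇒InH (H-element i k s t)

    elementOf-injective : ∀ u v → elementOf u ≡ elementOf v → u ≡ v
    elementOf-injective (i , k , s , t) (i′ , k′ , s′ , t′) e
      with refl , refl , refl , refl ← element-injective i k s t i′ k′ s′ t′ e = refl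

    abstract
      enumerate : Fin (m * (p * (p * p))) → Fin n
      enumerate x = elementOf (digits x)

      enumerate-InH : ∀ x → InH (enumerate x)
      enumerate-InH x = elementOf-InH (digits x)

      enumerate-injective : ∀ {x y} → enumerate x ≡ enumerate y → x ≡ y
      enumerate-injective {x} {y} e = digits-injective x y (elementOf-injective (digits x) (digits y) e)

-- Visits to the cosets of a subgroup

count : {A : Set} {P : A → Set} → (∀ x → Dec (P x)) → List A → ℕ
count P? xs = length (List.filter P? xs)

indicator : {P : Set} → Dec P → ℕ
indicator (yes _) = 1
indicator (no _)  = 0

module _ {A : Set} where

  sum-indicator : {P : A → Set} (P? : ∀ x → Dec (P x)) (xs : List A) → sum (map (λ x → indicator (P? x)) xs) ≡ count P? xs
  sum-indicator P? [] = refl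
  sum-indicator P? (x ∷ xs) with P? x
  ... | yes _ = cong suc (sum-indicator P? xs)
  ... | no _  = sum-indicator P? xs

  sum-map-+ : ∀ (f h : A → ℕ) xs → sum (map (λ x → f x + h x) xs) ≡ sum (map f xs) + sum (map h xs)
  sum-map-+ f h [] = refl
  sum-map-+ f h (x ∷ xs) = trans (cong (λ e → f x + h x + e) (sum-map-+ f h xs)) (interchange (f x) (h x) _ _)
    where
    interchange : ∀ a b c d → a + b + (c + d) ≡ a + c + (b + d)
    interchange = ℕS.solve-∀

  sum-map-≤ : ∀ (f : A → ℕ) b xs → (∀ x → f x ≤ b) → sum (map f xs) ≤ b * length xs
  sum-map-≤ f b [] _ = z≤n
  sum-map-≤ f b (x ∷ xs) f≤ = ℕP.≤-trans (ℕP.+-mono-≤ (f≤ x) (sum-map-≤ f b xs f≤)) (ℕP.≤-reflexive (sym (ℕP.*-suc b (length xs))))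

injection⇒≤count : ∀ {M n} {P : Fin n → Set} (P? : ∀ x → Dec (P x)) (f : Fin M → Fin n) →
  (∀ {i j} → f i ≡ f j → i ≡ j) → (∀ i → P (f i)) → M ≤ count P? (List.allFin n)
injection⇒≤count {M} {n} P? f f-inj Pf = FinP.injective⇒≤ {f = λ i → Any.index (mem i)} λ {i} {j} e → f-inj (begin
    f i                                        ≡⟨ AnyP.lookup-index (mem i) ⟩
    List.lookup ps (Any.index (mem i))         ≡⟨ cong (List.lookup ps) e ⟩
    List.lookup ps (Any.index (mem j))         ≡⟨ AnyP.lookup-index (mem j) ⟨
    f j                                        ∎)
  where
  open ≡-Reasoning
  ps = List.filter P? (List.allFin n)
  mem : ∀ i → f i ∈ ps
  mem i = ∈-filter⁺ P? (∈-allFin (f i)) (Pf i)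

map-++⁻ : ∀ {A B : Set} (f : A → B) xs {ys zs} → map f xs ≡ ys ++ zs →
  ∃[ us ] ∃[ vs ] (xs ≡ us ++ vs × map f us ≡ ys × map f vs ≡ zs)
map-++⁻ f xs {[]} e = [] , xs , refl , refl , e
map-++⁻ f (x ∷ xs) {y ∷ ys} e with us , vs , e₁ , e₂ , e₃ ← map-++⁻ f xs {ys} (ListP.∷-injectiveʳ e) =
  x ∷ us , vs , cong (x ∷_) e₁ , cong₂ _∷_ (ListP.∷-injectiveˡ e) e₂ , e₃

concat-↭ : ∀ {A : Set} {xss yss : List (List A)} → xss ↭ yss → concat xss ↭ concat yss
concat-↭ Perm.refl = ↭-refl
concat-↭ (Perm.prep xs π) = ++⁺ˡ xs (concat-↭ π)
concat-↭ (Perm.swap xs ys π) = ↭-trans (shifts xs ys) (++⁺ˡ ys (++⁺ˡ xs (concat-↭ π)))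
concat-↭ (Perm.trans π ρ) = ↭-trans (concat-↭ π) (concat-↭ ρ)

concat-nonempty : ∀ {A : Set} {xss : List (List A)} → xss ≢ [] → All (_≢ []) xss → concat xss ≢ []
concat-nonempty xss≢[] [] _ = xss≢[] refl
concat-nonempty {xss = xs ∷ xss} _ (ne ∷ _) e = ne (ListP.++-conicalˡ xs _ e)

module Cosets {n : ℕ} (_∙_ : Op₂ (Fin n)) (ε : Fin n) (_⁻¹ : Op₁ (Fin n)) (isGroup : IsGroup _≡_ _∙_ ε _⁻¹) where

  open GroupFacts _∙_ ε _⁻¹ isGroup

  Π : List (Fin n) → Fin n
  Π = prod _∙_ ε

  Π-concat : ∀ xss → Π (concat xss) ≡ Π (map Π xss)
  Π-concat [] = refl
  Π-concat (xs ∷ xss) = trans (prod-++ xs (concat xss)) (cong (Π xs ·_) (Π-concat xss))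

  module _ {InH : Fin n → Set} (InH? : ∀ x → Dec (InH x)) (InH-ε : InH ε)
    (InH-· : ∀ {x y} → InH x → InH y → InH (x · y))
    (InH-divide : ∀ {x y} → InH x → InH (x · y) → InH y) where

    -- Counts the proper prefixes u with x · Π u in H, that is, the visits to the coset x⁻¹ H. The
    -- whole list is left out: when its product is ε it leads back to the start, so each visit on
    -- the cycle counts once.
    hits : Fin n → List (Fin n) → ℕ
    hits x []       = 0
    hits x (y ∷ ys) = indicator (InH? x) + hits (x · y) ys

    -- `acc` is the block under construction, begun at the most recent visit x₀, and x is the
    -- current position. The piece v after the last visit stays open, to be closed by wrapping
    -- around.
    cut : ∀ {x x₀} acc ys → acc ≢ [] → InH x₀ → x ≡ x₀ · Π acc →
      ∃[ ws ] ∃[ v ] (acc ++ ys ≡ concat ws ++ v × v ≢ [] × All (_≢ []) ws × All (InH ∘ Π) ws × length ws ≡ hits x ys)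
    cut acc [] ne h₀ e = [] , acc , ListP.++-identityʳ acc , ne , [] , [] , refl
    cut {x} {x₀} acc (y ∷ ys) ne h₀ e with InH? x
    ... | yes h with ws , v , e′ , v≢[] , nes , hs , l ← cut {x · y} {x} (y ∷ []) ys (λ ()) h (cong (x ·_) (sym (identityʳ y))) =
      acc ∷ ws , v , trans (cong (acc ++_) e′) (sym (ListP.++-assoc acc (concat ws) v)) , v≢[] , ne ∷ nes ,
      InH-divide h₀ (subst InH e h) ∷ hs , cong suc l
    ... | no _ with ws , v , e′ , rest ← cut {x · y} {x₀} (acc ++ y ∷ []) ys (λ z → ne (ListP.++-conicalˡ acc _ z)) h₀
                       (trans (cong (_· y) e) (trans (assoc _ _ _) (cong (x₀ ·_) (trans (cong (Π acc ·_) (sym (identityʳ y))) (sym (prod-++ acc (y ∷ [])))))))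
      = ws , v , trans (sym (ListP.++-assoc acc (y ∷ []) ys)) e′ , rest

    first-hit : ∀ x ys → 0 < hits x ys → ∃[ u ] ∃[ y ] ∃[ v ] (ys ≡ u ++ y ∷ v × InH (x · Π u) × hits x ys ≡ suc (hits ((x · Π u) · y) v))
    first-hit x (y ∷ ys) pos with InH? x
    ... | yes h = [] , y , ys , refl , subst InH (sym (identityʳ x)) h , cong (λ z → suc (hits (z · y) ys)) (sym (identityʳ x))
    ... | no _ with u , y′ , v , e , h , l ← first-hit (x · y) ys pos =
      y ∷ u , y′ , v , cong (y ∷_) e , subst InH (assoc _ _ _) h , trans l (cong (λ z → suc (hits (z · y′) v)) (assoc _ _ _))

    -- The last block wraps around the end of the cyclic sequence ys.
    cyclic-blocks : ∀ x ys → Π ys ≡ ε → 0 < hits x ys →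
      ∃[ ws ] (concat ws ↭ ys × All (_≢ []) ws × All (InH ∘ Π) ws × length ws ≡ hits x ys × Π (map Π ws) ≡ ε)
    cyclic-blocks x ys e pos
      with u , y , v , refl , h , l ← first-hit x ys pos
      with ws , z , e′ , z≢[] , nes , hs , l′ ← cut {(x · Π u) · y} {x · Π u} (y ∷ []) v (λ ()) h (cong ((x · Π u) ·_) (sym (identityʳ y)))
      = ws ++ (z ++ u) ∷ [] ,
        ↭-trans (↭-reflexive (trans (sym (ListP.concat-++ ws _)) (cong (concat ws ++_) (ListP.++-identityʳ (z ++ u)))))
          (↭-trans (↭-reflexive (trans (sym (ListP.++-assoc (concat ws) z u)) (cong (_++ u) (sym e′)))) (++-comm (y ∷ v) u)) ,
        AllP.++⁺ nes ((λ q → z≢[] (ListP.++-conicalˡ z u q)) ∷ []) ,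
        AllP.++⁺ hs (last ∷ []) ,
        trans (ListP.length-++ ws) (trans (ℕP.+-comm (length ws) 1) (trans (cong suc l′) (sym l))) ,
        (begin
          Π (map Π (ws ++ (z ++ u) ∷ []))              ≡⟨ Π-concat (ws ++ (z ++ u) ∷ []) ⟨
          Π (concat (ws ++ (z ++ u) ∷ []))             ≡⟨ cong Π (sym (ListP.concat-++ ws _)) ⟩
          Π (concat ws ++ (z ++ u) ++ [])              ≡⟨ cong (λ w → Π (concat ws ++ w)) (ListP.++-identityʳ (z ++ u)) ⟩
          Π (concat ws ++ z ++ u)                      ≡⟨ prod-++ (concat ws) (z ++ u) ⟩
          Π (concat ws) · Π (z ++ u)                   ≡⟨ total ⟩
          ε                                            ∎)
      where
      open ≡-Reasoning
      total : Π (concat ws) · Π (z ++ u) ≡ ε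
      total = begin
        Π (concat ws) · Π (z ++ u)          ≡⟨ sym (prod-++ (concat ws) (z ++ u)) ⟩
        Π (concat ws ++ z ++ u)             ≡⟨ cong Π (trans (sym (ListP.++-assoc (concat ws) z u)) (cong (_++ u) (sym e′))) ⟩
        Π ((y ∷ v) ++ u)                    ≡⟨ prod-++ (y ∷ v) u ⟩
        Π (y ∷ v) · Π u                     ≡⟨ cancelˡ (Π u) (begin
            Π u · Π (y ∷ v) · Π u           ≡⟨ sym (assoc _ _ _) ⟩
            (Π u · Π (y ∷ v)) · Π u         ≡⟨ cong (_· Π u) (trans (sym (prod-++ u (y ∷ v))) e) ⟩
            ε · Π u                         ≡⟨ commute-ε ⟩
            Π u · ε                         ∎) ⟩
        ε                                   ∎
      InH-concat : ∀ {ws} → All (InH ∘ Π) ws → InH (Π (concat ws))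
      InH-concat [] = InH-ε
      InH-concat {w ∷ ws} (h ∷ hs) = subst InH (sym (prod-++ w (concat ws))) (InH-· h (InH-concat hs))
      last : InH (Π (z ++ u))
      last = InH-divide (InH-concat hs) (subst InH (sym total) InH-ε)

    module _ (B : ℕ) (splits : ∀ hs → All InH hs → B < length hs → Π hs ≡ ε →
        ∃[ U ] ∃[ V ] (U ++ V ↭ hs × U ≢ [] × V ≢ [] × Π U ≡ ε × Π V ≡ ε)) where

      hits-≤ : ∀ {xs} → MinimalProductOne _∙_ ε xs → ∀ {ys} → ys ↭ xs → Π ys ≡ ε → ∀ x → hits x ys ≤ B
      hits-≤ {xs} (_ , _ , minimal) {ys} π e x with hits x ys ℕP.≤? B
      ... | yes h≤B = h≤B
      ... | no h≰B
        with ws , ρ , nes , hs , l , eΠ ← cyclic-blocks x ys e (ℕP.≤-trans (s≤s z≤n) (ℕP.≰⇒> h≰B))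
        with U , V , σ , U≢[] , V≢[] , eU , eV ← splits (map Π ws) (AllP.map⁺ hs)
               (subst (B <_) (trans (sym l) (sym (ListP.length-map Π ws))) (ℕP.≰⇒> h≰B)) eΠ
        with bs , eq , τ ← PermP.↭-map-inv Π (↭-sym σ)
        with us , vs , refl , refl , refl ← map-++⁻ Π bs {U} {V} (sym eq)
        with ne-us , ne-vs ← AllP.++⁻ us (All-resp-↭ τ nes)
        = ⊥-elim (minimal (concat us) (concat vs)
            (↭-trans (↭-reflexive (ListP.concat-++ us vs)) (↭-trans (concat-↭ (↭-sym τ)) (↭-trans ρ π)))
            (concat-nonempty (λ { refl → U≢[] refl }) ne-us) (concat-nonempty (λ { refl → V≢[] refl }) ne-vs)
            ((concat us , ↭-refl , trans (Π-concat us) eU) , (concat vs , ↭-refl , trans (Π-concat vs) eV)))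

      module _ {M : ℕ} (enum : Fin M → Fin n) (enum-injective : ∀ {i j} → enum i ≡ enum j → i ≡ j) (enum-InH : ∀ i → InH (enum i)) where

        M≤count : ∀ x → M ≤ count (λ g → InH? (g · x)) (List.allFin n)
        M≤count x = injection⇒≤count (λ g → InH? (g · x)) (λ i → enum i · x ⁻¹) (λ e → enum-injective (cancelʳ (x ⁻¹) e))
          (λ i → subst InH (sym (trans (assoc _ _ _) (trans (cong (enum i ·_) (inverseˡ x)) (identityʳ _)))) (enum-InH i))

        -- Double counting: each prefix product is carried into H by at least M elements g. Summing
        -- over all g in G replaces a choice of coset representatives.
        Σ-hits : ∀ x ys → length ys * M ≤ sum (map (λ g → hits (g · x) ys) (List.allFin n))
        Σ-hits x [] = z≤n
        Σ-hits x (y ∷ ys) = begin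
          M + length ys * M
            ≤⟨ ℕP.+-mono-≤ (M≤count x) (Σ-hits (x · y) ys) ⟩
          count (λ g → InH? (g · x)) (List.allFin n) + sum (map (λ g → hits (g · x · y) ys) (List.allFin n))
            ≡⟨ cong₂ _+_ (sym (sum-indicator (λ g → InH? (g · x)) (List.allFin n)))
                 (cong sum (ListP.map-cong (λ g → cong (λ z → hits z ys) (sym (assoc g x y))) (List.allFin n))) ⟩
          sum (map (λ g → indicator (InH? (g · x))) (List.allFin n)) + sum (map (λ g → hits ((g · x) · y) ys) (List.allFin n))
            ≡⟨ sum-map-+ (λ g → indicator (InH? (g · x))) (λ g → hits ((g · x) · y) ys) (List.allFin n) ⟨
          sum (map (λ g → hits (g · x) (y ∷ ys)) (List.allFin n)) ∎
          where open ℕP.≤-Reasoning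

        index-bound : ∀ {xs} → MinimalProductOne _∙_ ε xs → length xs * M ≤ B * n
        index-bound {xs} min@(_ , (ys , π , e) , _) = begin
          length xs * M                                             ≡⟨ cong (_* M) (sym (↭-length π)) ⟩
          length ys * M                                             ≤⟨ Σ-hits ε ys ⟩
          sum (map (λ g → hits (g · ε) ys) (List.allFin n))         ≤⟨ sum-map-≤ _ B (List.allFin n) (λ g → hits-≤ min π e (g · ε)) ⟩
          B * length (List.allFin n)                                ≡⟨ cong (B *_) (ListP.length-tabulate (λ x → x)) ⟩
          B * n                                                     ∎
          where open ℕP.≤-Reasoning

-- Class equation

module _ {A : Set} where

  sum-map-cong : ∀ {f h : A → ℕ} xs → (∀ x → f x ≡ h x) → sum (map f xs) ≡ sum (map h xs)
  sum-map-cong xs e = cong sum (ListP.map-cong e xs)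

  sum-map-const : ∀ k (xs : List A) → sum (map (λ _ → k) xs) ≡ length xs * k
  sum-map-const k []       = refl
  sum-map-const k (x ∷ xs) = cong (λ e → k + e) (sum-map-const k xs)

  sum-map-*ʳ : ∀ (f : A → ℕ) k xs → sum (map (λ x → f x * k) xs) ≡ sum (map f xs) * k
  sum-map-*ʳ f k []       = refl
  sum-map-*ʳ f k (x ∷ xs) = trans (cong (λ e → f x * k + e) (sum-map-*ʳ f k xs)) (sym (ℕP.*-distribʳ-+ k (f x) _))

module _ {A : Set} where

  sum-swap : ∀ {B : Set} (f : A → B → ℕ) xs ys →
    sum (map (λ x → sum (map (f x) ys)) xs) ≡ sum (map (λ y → sum (map (λ x → f x y) xs)) ys)
  sum-swap f [] ys = sym (trans (sum-map-const 0 ys) (ℕP.*-zeroʳ (length ys)))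
  sum-swap f (x ∷ xs) ys = trans (cong (λ e → sum (map (f x) ys) + e) (sum-swap f xs ys))
    (sym (sum-map-+ (f x) (λ y → sum (map (λ x → f x y) xs)) ys))

  count-filter : {P Q : A → Set} (P? : ∀ x → Dec (P x)) (Q? : ∀ x → Dec (Q x)) → (∀ {x} → P x → Q x) →
    ∀ xs → count P? (List.filter Q? xs) ≡ count P? xs
  count-filter P? Q? P⇒Q [] = refl
  count-filter P? Q? P⇒Q (x ∷ xs) with Q? x
  ... | yes q with P? x
  ...   | yes _ = cong suc (count-filter P? Q? P⇒Q xs)
  ...   | no _  = count-filter P? Q? P⇒Q xs
  count-filter P? Q? P⇒Q (x ∷ xs) | no ¬q with P? x
  ...   | yes p = ⊥-elim (¬q (P⇒Q p))
  ...   | no _  = count-filter P? Q? P⇒Q xs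

  count-complement : {P : A → Set} (P? : ∀ x → Dec (P x)) → ∀ xs → count P? xs + count (λ x → ¬? (P? x)) xs ≡ length xs
  count-complement P? [] = refl
  count-complement P? (x ∷ xs) with P? x
  ... | yes _ = cong suc (count-complement P? xs)
  ... | no _  = trans (ℕP.+-suc _ _) (cong suc (count-complement P? xs))

  module _ {R : A → A → Set} (R? : ∀ x y → Dec (R x y)) (R-refl : ∀ {x} → R x x)
    (R-sym : ∀ {x y} → R x y → R y x) (R-trans : ∀ {x y z} → R x y → R y z → R x z) (d : ℕ) where

    -- Removing the class of the first element leaves every other class intact. The bound k makes
    -- the recursion structural.
    classes-divide-length : ∀ k xs → length xs ≤ k → (∀ {x} → x ∈ xs → d ∣ count (R? x) xs) → d ∣ length xs
    classes-divide-length k [] _ _ = d ℕD.∣0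
    classes-divide-length (suc k) xs@(x ∷ t) (s≤s l) hyp =
      subst (d ∣_) (count-complement (R? x) xs) (ℕD.∣m∣n⇒∣m+n (hyp (here refl))
        (classes-divide-length k rest
          (subst (_≤ k) (cong length (sym rest≡)) (ℕP.≤-trans (ListP.length-filter (λ y → ¬? (R? x y)) t) l))
          (λ {y} y∈ → subst (d ∣_) (sym (same (proj₂ (∈-filter⁻ (λ y → ¬? (R? x y)) {xs = xs} y∈))))
            (hyp (proj₁ (∈-filter⁻ (λ y → ¬? (R? x y)) {xs = xs} y∈))))))
      where
      rest = List.filter (λ y → ¬? (R? x y)) xs
      rest≡ : rest ≡ List.filter (λ y → ¬? (R? x y)) t
      rest≡ = ListP.filter-reject (λ y → ¬? (R? x y)) (λ ¬r → ¬r R-refl)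
      same : ∀ {y} → ¬ R x y → count (R? y) rest ≡ count (R? y) xs
      same {y} ¬r = count-filter (R? y) (λ y → ¬? (R? x y)) (λ ryz rxz → ¬r (R-trans rxz (R-sym ryz))) xs

classes-divide : ∀ {n} {R : Fin n → Fin n → Set} (R? : ∀ x y → Dec (R x y)) → (∀ {x} → R x x) →
  (∀ {x y} → R x y → R y x) → (∀ {x y z} → R x y → R y z → R x z) →
  ∀ {Q : Fin n → Set} (Q? : ∀ x → Dec (Q x)) → (∀ {x y} → Q x → R x y → Q y) →
  ∀ d → (∀ x → Q x → d ∣ count (R? x) (List.allFin n)) → d ∣ count Q? (List.allFin n)
classes-divide {n} R? R-refl R-sym R-trans Q? closed d hyp =
  classes-divide-length R? R-refl R-sym R-trans d _ (List.filter Q? (List.allFin n)) ℕP.≤-refl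
    (λ {x} x∈ → let qx = proj₂ (∈-filter⁻ Q? {xs = List.allFin n} x∈) in
      subst (d ∣_) (sym (count-filter (R? x) Q? (closed qx) (List.allFin n))) (hyp x qx))

filter-lookup-injective : ∀ {n} {P : Fin n → Set} (P? : ∀ x → Dec (P x)) {i j} →
  List.lookup (List.filter P? (List.allFin n)) i ≡ List.lookup (List.filter P? (List.allFin n)) j → i ≡ j
filter-lookup-injective {n} P? {i} {j} e with i FinP.≟ j
... | yes i≡j = i≡j
... | no i≢j = ⊥-elim (AllPairs-lookup (λ ne e → ne (sym e)) (UniqueP.filter⁺ P? (UniqueP.allFin⁺ n)) i j i≢j e)

filter-lookup : ∀ {n} {P : Fin n → Set} (P? : ∀ x → Dec (P x)) i → P (List.lookup (List.filter P? (List.allFin n)) i)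
filter-lookup {n} P? i = proj₂ (∈-filter⁻ P? {xs = List.allFin n} (∈-lookup i))

count-≤-codes : ∀ {n d} {P : Fin n → Set} (P? : ∀ x → Dec (P x)) (code : ∀ {x} → P x → Fin d) →
  (∀ {x y} (px : P x) (py : P y) → code px ≡ code py → x ≡ y) → count P? (List.allFin n) ≤ d
count-≤-codes P? code code-inj = FinP.injective⇒≤ {f = λ i → code (filter-lookup P? i)}
  λ e → filter-lookup-injective P? (code-inj _ _ e)

count-≤ : ∀ {n} {P Q : Fin n → Set} (P? : ∀ x → Dec (P x)) (Q? : ∀ x → Dec (Q x)) (f : Fin n → Fin n) →
  (∀ {x y} → f x ≡ f y → x ≡ y) → (∀ {x} → P x → Q (f x)) → count P? (List.allFin n) ≤ count Q? (List.allFin n)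
count-≤ {n} P? Q? f f-inj P⇒Q = injection⇒≤count Q? (λ i → f (List.lookup (List.filter P? (List.allFin n)) i))
  (λ e → filter-lookup-injective P? (f-inj e)) (λ i → P⇒Q (filter-lookup P? i))

∣prime^⇒1∨p∣ : ∀ {p t} → Prime p → ∀ k → t ∣ p ℕ.^ k → t ≡ 1 ⊎ p ∣ t
∣prime^⇒1∨p∣ pr zero t∣1 = inj₁ (ℕD.∣1⇒≡1 t∣1)
∣prime^⇒1∨p∣ {p} {t} pr (suc k) t∣ with p ∣? t
... | yes p∣t = inj₂ p∣t
... | no p∤t  = ∣prime^⇒1∨p∣ pr k (coprime-divisor (Coprime.sym (∤⇒coprime pr p∤t)) t∣)

least : {P : ℕ → Set} (P? : ∀ k → Dec (P k)) → ∀ e → P e → ∃[ d ] (P d × (∀ j → j < d → ¬ P j))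
least {P} P? e Pe = go e 0 (λ _ ()) (ℕP.+-identityʳ e)
  where
  go : ∀ r k → (∀ j → j < k → ¬ P j) → r + k ≡ e → ∃[ d ] (P d × (∀ j → j < d → ¬ P j))
  go r k none eq with P? k
  ... | yes Pk = k , Pk , none
  go zero k none refl | no ¬Pk = ⊥-elim (¬Pk Pe)
  go (suc r) k none eq | no ¬Pk = go r (suc k) none′ (trans (ℕP.+-suc r k) eq)
    where
    none′ : ∀ j → j < suc k → ¬ P j
    none′ j j<1+k with ℕP.m<1+n⇒m<n∨m≡n j<1+k
    ... | inj₁ j<k  = none j j<k
    ... | inj₂ refl = ¬Pk

module PGroup (q : ℕ) (p-prime : Prime (suc q))
  {n : ℕ} (_∙_ : Op₂ (Fin n)) (ε : Fin n) (_⁻¹ : Op₁ (Fin n)) (isGroup : IsGroup _≡_ _∙_ ε _⁻¹) (k : ℕ) (n≡p^k : n ≡ suc q ℕ.^ k) where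

  open GroupFacts _∙_ ε _⁻¹ isGroup
  open Mod-p q p-prime
  open Heisenberg q p-prime _∙_ ε _⁻¹ isGroup

  G : List (Fin n)
  G = List.allFin n

  |G| : length G ≡ n
  |G| = ListP.length-tabulate (λ x → x)

  divisor-of-n : ∀ {t} → t ∣ n → t ≡ 1 ⊎ p ∣ t
  divisor-of-n t∣n = ∣prime^⇒1∨p∣ p-prime k (subst (_ ∣_) n≡p^k t∣n)

  Z : Fin n → Set
  Z z = ∀ y → Commute z y

  Z? : ∀ z → Dec (Z z)
  Z? z = FinP.all? (λ y → (z · y) FinP.≟ (y · z))

  Z-ε : Z ε
  Z-ε y = commute-ε

  Z-· : ∀ {z w} → Z z → Z w → Z (z · w)
  Z-· f h y = commute-· (f y) (h y)

  Z-⁻¹ : ∀ {z} → Z z → Z (z ⁻¹)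
  Z-⁻¹ f y = commute-⁻¹ (f y)

  ζ : ℕ
  ζ = count Z? G

  _≈_ : Fin n → Fin n → Set
  x ≈ y = ∃[ z ] (Z z × y ≡ x · z)

  _≈?_ : ∀ x y → Dec (x ≈ y)
  x ≈? y = FinP.any? (λ z → Z? z ×-dec (y FinP.≟ (x · z)))

  ≈-refl : ∀ {x} → x ≈ x
  ≈-refl = ε , Z-ε , sym (identityʳ _)

  ≈-sym : ∀ {x y} → x ≈ y → y ≈ x
  ≈-sym {x} (z , h , refl) = z ⁻¹ , Z-⁻¹ h , sym (trans (assoc _ _ _) (trans (cong (x ·_) (inverseʳ z)) (identityʳ x)))

  ≈-trans : ∀ {x y w} → x ≈ y → y ≈ w → x ≈ w
  ≈-trans (z , h , refl) (z′ , h′ , refl) = z · z′ , Z-· h h′ , assoc _ _ _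

  ≈-class : ∀ x → count (x ≈?_) G ≡ ζ
  ≈-class x = ℕP.≤-antisym
    (count-≤ (x ≈?_) Z? (x ⁻¹ ·_) (cancelˡ (x ⁻¹)) (λ { (z , h , refl) → subst Z (sym (inv-cancelˡ x z)) h }))
    (count-≤ Z? (x ≈?_) (x ·_) (cancelˡ x) (λ {z} h → z , h , refl))

  ζ-divides : ∀ {Q : Fin n → Set} (Q? : ∀ x → Dec (Q x)) → (∀ {x y} → Q x → x ≈ y → Q y) → ζ ∣ count Q? G
  ζ-divides Q? closed = classes-divide _≈?_ ≈-refl ≈-sym ≈-trans Q? closed ζ
    (λ x _ → subst (ζ ∣_) (sym (≈-class x)) ℕD.∣-refl)

  -- g conjugates x to y modulo the centre.
  Conj : Fin n → Fin n → Fin n → Set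
  Conj x y g = ∃[ z ] (Z z × y · g ≡ g · x · z)

  Conj? : ∀ x y g → Dec (Conj x y g)
  Conj? x y g = FinP.any? (λ z → Z? z ×-dec ((y · g) FinP.≟ (g · x · z)))

  -- Conjugacy in G / Z, phrased for representatives in G so that no quotient group is formed.
  Class : Fin n → Fin n → Set
  Class x y = ∃[ g ] Conj x y g

  Class? : ∀ x y → Dec (Class x y)
  Class? x y = FinP.any? (Conj? x y)

  Class-refl : ∀ {x} → Class x x
  Class-refl {x} = ε , ε , Z-ε , trans (identityʳ x) (sym (trans (identityˡ _) (identityʳ x)))

  Class-sym : ∀ {x y} → Class x y → Class y x
  Class-sym {x} {y} (g , z , h , e) = g ⁻¹ , z ⁻¹ , Z-⁻¹ h , cancelˡ g (cancelʳ g (begin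
    (g · x · g ⁻¹) · g          ≡⟨ trans (assoc _ _ _) (cong (g ·_) (trans (assoc _ _ _) (trans (cong (x ·_) (inverseˡ g)) (identityʳ x)))) ⟩
    g · x                       ≡⟨ cong (g ·_) (trans (sym (identityʳ x)) (cong (x ·_) (sym (inverseʳ z)))) ⟩
    g · x · z · z ⁻¹            ≡⟨ sym (trans (assoc _ _ _) (cong (g ·_) (assoc _ _ _))) ⟩
    (g · x · z) · z ⁻¹          ≡⟨ cong (_· z ⁻¹) (sym e) ⟩
    (y · g) · z ⁻¹              ≡⟨ trans (assoc _ _ _) (cong (y ·_) (sym (Z-⁻¹ h g))) ⟩
    y · z ⁻¹ · g                ≡⟨ sym (assoc _ _ _) ⟩
    (y · z ⁻¹) · g              ≡⟨ cong (_· g) (sym (cancel-invˡ g (y · z ⁻¹))) ⟩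
    (g · g ⁻¹ · y · z ⁻¹) · g   ∎))
    where open ≡-Reasoning

  Class-trans : ∀ {x y w} → Class x y → Class y w → Class x w
  Class-trans {x} {y} {w} (g , z , h , e) (g′ , z′ , h′ , e′) = g′ · g , z · z′ , Z-· h h′ , (begin
    w · g′ · g                  ≡⟨ sym (assoc _ _ _) ⟩
    (w · g′) · g                ≡⟨ cong (_· g) e′ ⟩
    (g′ · y · z′) · g           ≡⟨ trans (assoc _ _ _) (cong (g′ ·_) (assoc _ _ _)) ⟩
    g′ · y · z′ · g             ≡⟨ cong (λ u → g′ · y · u) (h′ g) ⟩
    g′ · y · g · z′             ≡⟨ cong (g′ ·_) (sym (assoc _ _ _)) ⟩
    g′ · (y · g) · z′           ≡⟨ cong (λ u → g′ · u · z′) e ⟩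
    g′ · (g · x · z) · z′       ≡⟨ cong (g′ ·_) (trans (assoc _ _ _) (cong (g ·_) (assoc _ _ _))) ⟩
    g′ · g · x · z · z′         ≡⟨ sym (assoc _ _ _) ⟩
    (g′ · g) · x · z · z′       ∎)
    where open ≡-Reasoning

  Class-≈ : ∀ {x y w} → Class x y → y ≈ w → Class x w
  Class-≈ {x} {y} (g , z , h , e) (z′ , h′ , refl) = g , z · z′ , Z-· h h′ , (begin
    (y · z′) · g      ≡⟨ trans (assoc _ _ _) (trans (cong (y ·_) (h′ g)) (sym (assoc _ _ _))) ⟩
    (y · g) · z′      ≡⟨ cong (_· z′) e ⟩
    (g · x · z) · z′  ≡⟨ trans (assoc _ _ _) (cong (g ·_) (assoc _ _ _)) ⟩
    g · x · z · z′    ∎)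
    where open ≡-Reasoning

  -- The order of the preimage in G of the centraliser of x Z in G / Z.
  σ : Fin n → ℕ
  σ x = count (Conj? x x) G

  conjugates-by : ∀ x g → count (λ y → Conj? x y g) G ≡ ζ
  conjugates-by x g = ℕP.≤-antisym
    (count-≤ (λ y → Conj? x y g) Z? (λ y → x ⁻¹ · g ⁻¹ · y · g) (λ e → cancelʳ g (cancelˡ (g ⁻¹) (cancelˡ (x ⁻¹) e)))
      (λ (z , h , e) → subst Z (sym (trans (cong (λ u → x ⁻¹ · g ⁻¹ · u) e) (trans (cong (x ⁻¹ ·_) (inv-cancelˡ g (x · z))) (inv-cancelˡ x z)))) h))
    (count-≤ Z? (λ y → Conj? x y g) (λ z → g · x · z · g ⁻¹) (λ e → cancelʳ (g ⁻¹) (cancelˡ x (cancelˡ g e)))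
      (λ {z} h → z , h , trans (assoc _ _ _) (cong (g ·_) (trans (assoc _ _ _) (cong (x ·_) (trans (assoc _ _ _) (trans (cong (z ·_) (inverseˡ g)) (identityʳ z))))))))

  conjugators : ∀ x y → Class x y → count (Conj? x y) G ≡ σ x
  conjugators x y (g₀ , z₀ , h₀ , e₀) = ℕP.≤-antisym
    (count-≤ (Conj? x y) (Conj? x x) (g₀ ⁻¹ ·_) (cancelˡ (g₀ ⁻¹)) to)
    (count-≤ (Conj? x x) (Conj? x y) (g₀ ·_) (cancelˡ g₀) from)
    where
    open ≡-Reasoning
    from : ∀ {f} → Conj x x f → Conj x y (g₀ · f)
    from {f} (z , h , e) = z · z₀ , Z-· h h₀ , (begin
      y · g₀ · f              ≡⟨ sym (assoc _ _ _) ⟩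
      (y · g₀) · f            ≡⟨ cong (_· f) e₀ ⟩
      (g₀ · x · z₀) · f       ≡⟨ trans (assoc _ _ _) (cong (g₀ ·_) (assoc _ _ _)) ⟩
      g₀ · x · z₀ · f         ≡⟨ cong (λ u → g₀ · x · u) (h₀ f) ⟩
      g₀ · x · f · z₀         ≡⟨ cong (g₀ ·_) (trans (sym (assoc _ _ _)) (trans (cong (_· z₀) e) (trans (assoc _ _ _) (cong (f ·_) (assoc _ _ _))))) ⟩
      g₀ · f · x · z · z₀     ≡⟨ sym (assoc _ _ _) ⟩
      (g₀ · f) · x · z · z₀   ∎)
    to : ∀ {g} → Conj x y g → Conj x x (g₀ ⁻¹ · g)
    to {g} (z , h , e) = z · z₀ ⁻¹ , Z-· h (Z-⁻¹ h₀) , cancelʳ z₀ (cancelˡ g₀ (begin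
      g₀ · (x · g₀ ⁻¹ · g) · z₀               ≡⟨ cong (g₀ ·_) (trans (assoc _ _ _) (cong (x ·_) (sym (h₀ (g₀ ⁻¹ · g))))) ⟩
      g₀ · x · z₀ · g₀ ⁻¹ · g                 ≡⟨ sym (trans (assoc _ _ _) (cong (g₀ ·_) (assoc _ _ _))) ⟩
      (g₀ · x · z₀) · g₀ ⁻¹ · g               ≡⟨ cong (_· (g₀ ⁻¹ · g)) (sym e₀) ⟩
      (y · g₀) · g₀ ⁻¹ · g                    ≡⟨ trans (assoc _ _ _) (cong (y ·_) (cancel-invˡ g₀ g)) ⟩
      y · g                                   ≡⟨ e ⟩
      g · x · z                               ≡⟨ cong (λ u → g · x · u) (sym (trans (assoc _ _ _) (trans (cong (z ·_) (inverseˡ z₀)) (identityʳ z)))) ⟩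
      g · x · (z · z₀ ⁻¹) · z₀                ≡⟨ cong (_· (x · (z · z₀ ⁻¹) · z₀)) (sym (cancel-invˡ g₀ g)) ⟩
      (g₀ · g₀ ⁻¹ · g) · x · (z · z₀ ⁻¹) · z₀ ≡⟨ assoc _ _ _ ⟩
      g₀ · (g₀ ⁻¹ · g) · x · (z · z₀ ⁻¹) · z₀ ≡⟨ cong (g₀ ·_) (sym (trans (assoc _ _ _) (cong ((g₀ ⁻¹ · g) ·_) (assoc _ _ _)))) ⟩
      g₀ · ((g₀ ⁻¹ · g) · x · z · z₀ ⁻¹) · z₀ ∎))

  conjugators-count : ∀ x y → count (Conj? x y) G ≡ indicator (Class? x y) * σ x
  conjugators-count x y with Class? x y
  ... | yes cl = trans (conjugators x y cl) (sym (ℕP.+-identityʳ (σ x)))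
  ... | no ¬cl = cong length (ListP.filter-none (Conj? x y) (All.universal (λ g cj → ¬cl (g , cj)) G))

  -- The pairs (g , y) with `Conj x y g` counted twice: each g admits ζ elements y, and each y in
  -- the class admits σ x elements g.
  orbit-stabiliser : ∀ x → n * ζ ≡ count (Class? x) G * σ x
  orbit-stabiliser x = begin
    n * ζ                                                                     ≡⟨ cong (_* ζ) (sym |G|) ⟩
    length G * ζ                                                              ≡⟨ sum-map-const ζ G ⟨
    sum (map (λ _ → ζ) G)                                                     ≡⟨ sum-map-cong G (λ g → trans (sym (conjugates-by x g)) (sym (sum-indicator (λ y → Conj? x y g) G))) ⟩
    sum (map (λ g → sum (map (λ y → indicator (Conj? x y g)) G)) G)           ≡⟨ sum-swap (λ g y → indicator (Conj? x y g)) G G ⟩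
    sum (map (λ y → sum (map (λ g → indicator (Conj? x y g)) G)) G)           ≡⟨ sum-map-cong G (λ y → trans (sum-indicator (Conj? x y) G) (conjugators-count x y)) ⟩
    sum (map (λ y → indicator (Class? x y) * σ x) G)                          ≡⟨ sum-map-*ʳ (λ y → indicator (Class? x y)) (σ x) G ⟩
    sum (map (λ y → indicator (Class? x y)) G) * σ x                          ≡⟨ cong (_* σ x) (sum-indicator (Class? x) G) ⟩
    count (Class? x) G * σ x                                                  ∎
    where open ≡-Reasoning

  ζ>0 : 0 < ζ
  ζ>0 = ListP.filter-some Z? (Any.map (λ { refl → Z-ε }) (∈-allFin ε))

  ζ-nonZero : ℕ.NonZero ζ
  ζ-nonZero = ℕ.>-nonZero ζ>0

  -- The class is a union of r cosets of Z, and n = r · σ x. So r is 1 or a multiple of p, and r = 1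
  -- forces σ x = n.
  class-size : ∀ x → (∀ g → Conj x x g) ⊎ p * ζ ∣ count (Class? x) G
  class-size x with ζ-divides (Class? x) Class-≈
  ... | divides r e with divisor-of-n {r} (divides (σ x) n≡σr)
    where
    n≡rσ : n ≡ r * σ x
    n≡rσ = ℕP.*-cancelʳ-≡ n (r * σ x) ζ {{ζ-nonZero}} (trans (orbit-stabiliser x) (trans (cong (_* σ x) e)
      (trans (ℕP.*-assoc r ζ (σ x)) (trans (cong (r *_) (ℕP.*-comm ζ (σ x))) (sym (ℕP.*-assoc r (σ x) ζ))))))
    n≡σr : n ≡ σ x * r
    n≡σr = trans n≡rσ (ℕP.*-comm r (σ x))
  ...   | inj₂ (divides r′ refl) = inj₂ (divides r′ (trans e (ℕP.*-assoc r′ p ζ)))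
  ...   | inj₁ refl = inj₁ λ g → proj₂ (∈-filter⁻ (Conj? x x) {xs = G} (subst (g ∈_) (sym all) (∈-allFin g)))
    where
    σ≡n : n ≡ σ x
    σ≡n = ℕP.*-cancelʳ-≡ n (σ x) ζ {{ζ-nonZero}} (trans (orbit-stabiliser x) (trans (cong (_* σ x) e)
      (trans (cong (_* σ x) (ℕP.*-identityˡ ζ)) (ℕP.*-comm ζ (σ x)))))
    all : List.filter (Conj? x x) G ≡ G
    all = ListP.filter-complete (Conj? x x) (trans (sym σ≡n) (sym |G|))

  noncentral-closed : ∀ {x y} → ¬ Z x → Class x y → ¬ Z y
  noncentral-closed {x} {y} ¬Zx (g , z , h , e) Zy = ¬Zx (subst Z x≡ (Z-· Zy (Z-⁻¹ h)))
    where
    x≡ : y · z ⁻¹ ≡ x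
    x≡ = cancelʳ z (trans (assoc _ _ _) (trans (cong (y ·_) (inverseˡ z)) (trans (identityʳ y) (cancelˡ g (trans (sym (Zy g)) e)))))

  module _ (nonabelian : ¬ (∀ x y → x · y ≡ y · x)) where

    pζ∣n : p * ζ ∣ n
    pζ∣n with subst (ζ ∣_) (trans (cong length (ListP.filter-all (λ _ → yes tt) (All.universal (λ _ → tt) G))) |G|) (ζ-divides (λ _ → yes tt) (λ _ _ → tt))
    ... | divides r e with divisor-of-n {r} (divides ζ (trans e (ℕP.*-comm r ζ)))
    ...   | inj₂ (divides r′ refl) = divides r′ (trans e (ℕP.*-assoc r′ p ζ))
    ...   | inj₁ refl = ⊥-elim (nonabelian λ x → proj₂ (∈-filter⁻ Z? {xs = G} (subst (x ∈_) (sym all) (∈-allFin x))))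
      where
      all : List.filter Z? G ≡ G
      all = ListP.filter-complete Z? (trans (sym (trans e (ℕP.*-identityˡ ζ))) (sym |G|))

    -- The p-group G / Z has a nontrivial centre. Otherwise every class of noncentral elements has
    -- size divisible by pζ, hence so is n - ζ, and pζ ∣ n would give pζ ∣ ζ.
    second-centre : ∃[ a ] (¬ Z a × ∀ g → Conj a a g)
    second-centre with FinP.any? (λ a → ¬? (Z? a) ×-dec FinP.all? (Conj? a a))
    ... | yes r = r
    ... | no none = ⊥-elim (ℕP.<⇒≱ ζ<pζ (ℕD.∣⇒≤ {{ζ-nonZero}} pζ∣ζ))
      where
      noncentral? : ∀ x → Dec (¬ Z x)
      noncentral? x = ¬? (Z? x)
      big-class : ∀ x → ¬ Z x → p * ζ ∣ count (Class? x) G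
      big-class x ¬Zx with class-size x
      ... | inj₁ fixed = ⊥-elim (none (x , ¬Zx , fixed))
      ... | inj₂ d = d
      pζ∣rest : p * ζ ∣ count noncentral? G
      pζ∣rest = classes-divide Class? Class-refl Class-sym Class-trans noncentral? noncentral-closed (p * ζ) big-class
      pζ∣ζ : p * ζ ∣ ζ
      pζ∣ζ = ℕD.∣m+n∣m⇒∣n (subst (p * ζ ∣_) (trans (sym |G|) (trans (sym (count-complement Z? G)) (ℕP.+-comm ζ _))) pζ∣n) pζ∣rest
      ζ<pζ : ζ < p * ζ
      ζ<pζ = ℕP.m<m+n ζ (ℕP.*-mono-< 0<q ζ>0)

    order : ∀ c → ∃[ d ] (pow c (suc d) ≡ ε × (∀ j → j < d → pow c (suc j) ≢ ε))
    order c with i , j , i<j , e ← FinP.pigeonhole (ℕP.n<1+n n) (λ i → pow c (toℕ i))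
            with r , eq ← ℕP.m≤n⇒∃[o]m+o≡n i<j
      = least (λ d → pow c (suc d) FinP.≟ ε) r
          (pow-cancel c (toℕ i) (suc r) (trans e (cong (pow c) (sym (trans (ℕP.+-suc (toℕ i) r) eq)))))

    module _ (c : Fin n) (d : ℕ) (c-order : pow c (suc d) ≡ ε) (minimal : ∀ j → j < d → pow c (suc j) ≢ ε) where
      open Order c d c-order

      open Exact minimal

      ~-class : ∀ x → count (x ~?_) G ≡ suc d
      ~-class x = ℕP.≤-antisym
        (count-≤-codes (x ~?_) proj₁ (λ { (i , refl) (j , refl) refl → refl }))
        (injection⇒≤count (x ~?_) (λ i → pow c (toℕ i) · x) (λ e → powers-injective (cancelʳ x e)) (λ i → i , refl))

      order∣n : suc d ∣ n
      order∣n = subst (suc d ∣_) (trans (cong length (ListP.filter-all (λ _ → yes tt) (All.universal (λ _ → tt) G))) |G|)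
        (classes-divide _~?_ ~-refl ~-sym ~-trans (λ _ → yes tt) (λ _ _ → tt) (suc d)
          (λ x _ → subst (suc d ∣_) (sym (~-class x)) ℕD.∣-refl))

    -- The commutator z of a and g is central and its order has the form (r + 1) p. Replacing a by
    -- a^(r + 1) replaces z by z^(r + 1), which has order p.
    commutator-pair : CommutatorPair
    commutator-pair
      with a , ¬Za , fixed ← second-centre
      with g , ¬comm ← FinP.¬∀⟶∃¬ n _ (λ y → (a · y) FinP.≟ (y · a)) ¬Za
      with z , Zz , e ← fixed g
      with d , z-order , minimal ← order z
      with divisor-of-n (order∣n z d z-order minimal)
    ... | inj₁ refl = ⊥-elim (¬comm (trans e (cong (g ·_) (trans (cong (a ·_) (trans (sym (identityʳ z)) z-order)) (identityʳ a)))))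
    ... | inj₂ (divides zero ())
    ... | inj₂ (divides (suc r) eq) = record
      { a       = pow a (suc r)
      ; g       = g
      ; c       = pow z (suc r)
      ; a·g     = begin
          pow a (suc r) · g                           ≡⟨ cong (pow a (suc r) ·_) (sym (identityʳ g)) ⟩
          pow a (suc r) · pow g 1                     ≡⟨ pow-twistʳ (suc r) a·g≡ (Zz a) (Zz g) 1 ⟩
          pow z (suc r * 1) · pow g 1 · pow a (suc r) ≡⟨ cong₂ (λ i u → pow z i · u · pow a (suc r)) (ℕP.*-identityʳ (suc r)) (identityʳ g) ⟩
          pow z (suc r) · g · pow a (suc r)           ∎
      ; ca      = commute-pow (suc r) (Zz _)
      ; cg      = commute-pow (suc r) (Zz g)
      ; c-order = trans (sym (pow-* z p (suc r))) (trans (cong (pow z) (trans (ℕP.*-comm p (suc r)) (sym eq))) z-order)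
      -- q > 0 gives r + 1 < (r + 1) p, so r + 1 lies below the order of z.
      ; c≢ε     = minimal r (ℕ.s≤s⁻¹ (subst (suc (suc r) ≤_) (sym eq) (subst (suc (suc r) ≤_) (sym (ℕP.*-suc (suc r) q)) (ℕP.≤-trans (ℕP.≤-reflexive (ℕP.+-comm 1 (suc r))) (ℕP.+-monoʳ-≤ (suc r) (ℕP.*-mono-≤ {1} {suc r} (s≤s z≤n) 0<q))))))
      }
      where
      open ≡-Reasoning
      a·g≡ : a · g ≡ z · g · a
      a·g≡ = trans e (trans (sym (assoc _ _ _)) (trans (sym (Zz (g · a))) refl))

-- From the bound for H to the bound for G

cube-regroup : ∀ l q m → l * (suc q * (suc q * (suc q * 1))) * m ≡ l * (m * (suc q * (suc q * suc q)))
cube-regroup = ℕS.solve-∀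

*-swapʳ : ∀ k m n → k * m * n ≡ k * n * m
*-swapʳ = ℕS.solve-∀

p²+2p∸2 : ∀ q → suc q ^ 2 + 2 * suc q ∸ 2 ≡ q * q + 4 * q + 1
p²+2p∸2 q = trans (cong (_∸ 2) (lemma q)) (ℕP.m+n∸m≡n 2 _)
  where
  lemma : ∀ q → suc q * (suc q * 1) + 2 * suc q ≡ 2 + (q * q + 4 * q + 1)
  lemma = ℕS.solve-∀

module _ (q : ℕ) (p-prime : Prime (suc q))
  {n : ℕ} (_∙_ : Op₂ (Fin n)) (ε : Fin n) (_⁻¹ : Op₁ (Fin n)) (isGroup : IsGroup _≡_ _∙_ ε _⁻¹)
  (pair : Heisenberg.CommutatorPair q p-prime _∙_ ε _⁻¹ isGroup) where

  open Mod-p q p-prime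
  open Cosets _∙_ ε _⁻¹ isGroup
  open Heisenberg q p-prime _∙_ ε _⁻¹ isGroup
  open Subgroup pair
  open Splitting q p-prime _∙_ ε _⁻¹ isGroup
  open Blocks symplectic using (K; splits; m≥1)

  lift : ∀ hs → All InH hs → ∃[ xs ] map val xs ≡ hs
  lift [] [] = [] , refl
  lift (h ∷ hs) ((s , t , e) ∷ es) with xs , refl ← lift hs es = (h , toℕ s , toℕ t , e) ∷ xs , refl

  splits-InH : ∀ hs → All InH hs → K * m < length hs → Π hs ≡ ε →
    ∃[ U ] ∃[ V ] (U ++ V ↭ hs × U ≢ [] × V ≢ [] × Π U ≡ ε × Π V ≡ ε)
  splits-InH hs inH long e
    with xs , refl ← lift hs inH
    with U , V , π , U≢[] , V≢[] , eU , eV ← splits xs (subst (K * m <_) (ListP.length-map val xs) long) e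
    = map val U , map val V , ↭-trans (↭-reflexive (sym (ListP.map-++ val U V))) (PermP.map⁺ val π) ,
      (λ z → U≢[] (map-[] U z)) , (λ z → V≢[] (map-[] V z)) , eU , eV
    where
    map-[] : ∀ U → map val U ≡ [] → U ≡ []
    map-[] [] _ = refl

  -- The coset bound with at least m p³ elements in H and at most K m visits to each coset; the
  -- common factor m cancels.
  davenport-bound : ∀ xs → MinimalProductOne _∙_ ε xs → length xs * p ^ 3 ≤ (p ^ 2 + 2 * p ∸ 2) * n
  davenport-bound xs minimal = ℕP.*-cancelʳ-≤ _ _ m {{ℕ.>-nonZero m≥1}} (begin
    length xs * p ^ 3 * m               ≡⟨ cube-regroup (length xs) q m ⟩
    length xs * (m * (p * (p * p)))     ≤⟨ index-bound InH? InH-ε InH-· InH-divide (K * m) splits-InH enumerate enumerate-injective enumerate-InH minimal ⟩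
    K * m * n                           ≡⟨ *-swapʳ K m n ⟩
    K * n * m                           ≡⟨ cong (λ e → e * n * m) (sym (p²+2p∸2 q)) ⟩
    (p ^ 2 + 2 * p ∸ 2) * n * m         ∎)
    where open ℕP.≤-Reasoning

theorem4p1 : ∀ (p : ℕ) → Prime p →
    ∀ (n : ℕ) (_∙_ : Op₂ (Fin n)) (ε : Fin n) (_⁻¹ : Op₁ (Fin n)) →
    IsGroup _≡_ _∙_ ε _⁻¹ →
    (∃[ k ] n ≡ p ^ k) →
    ¬ (∀ (x y : Fin n) → (x ∙ y) ≡ (y ∙ x)) →
    ∀ (xs : List (Fin n)) → MinimalProductOne _∙_ ε xs →
    length xs * p ^ 3 ≤ (p ^ 2 + 2 * p ∸ 2) * n
theorem4p1 zero pr = ⊥-elim (¬prime[0] pr)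
theorem4p1 (suc q) pr n _∙_ ε _⁻¹ isGroup (k , n≡p^k) nonabelian xs minimal =
  davenport-bound q pr _∙_ ε _⁻¹ isGroup
    (PGroup.commutator-pair q pr _∙_ ε _⁻¹ isGroup k n≡p^k nonabelian) xs minimal
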